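{- Let $T=\{1324,2341,4123\}$. Then \[ F_T(x)=C(x)+\frac{x^3 - 3 x^4 +3 x^5 -5 x^6 + 9 x^7 -4 x^8}{(1-x)^6 (1-2x)^2}, \] where $C(x)=\frac{1-\sqrt{1-4x}}{2x}$ is the generating function of the Catalan numbers.
   Context: A permutation $\pi\in S_n$ contains a pattern $\tau\in S_k$ if some subsequence of $\pi$ of length $k$ is order-isomorphic to $\tau$; otherwise $\pi$ avoids $\tau$. For a set $T$ of patterns, $S_n(T)$ is the set of permutations of $[n]$ avoiding every pattern in $T$, and $F_T(x)=\sum_{n\ge0}|S_n(T)|x^n$ (with $|S_0(T)|=1$). -}

module Defs where

open import Data.Nat as ℕ using (ℕ; zero; suc; _<_)
open import Data.Nat.Combinatorics using (_C_)
open import Data.Nat.DivMod using (_/_)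
open import Data.Integer as ℤ using (ℤ; +_; -_; _+_; _*_)
open import Data.List using (List; []; _∷_; length; upTo)
open import Data.List.Membership.Propositional using (_∈_)
open import Data.List.Relation.Unary.Unique.Propositional using (Unique)
open import Data.List.Relation.Binary.Sublist.Propositional using (_⊆_)
open import Data.List.Relation.Binary.Permutation.Propositional using (_↭_)
open import Data.Product using (Σ; _×_; ∃)
open import Function.Bundles using (_⇔_)
open import Relation.Nullary using (¬_)
open import Relation.Binary.PropositionalEquality using (_≡_)

-- Permutations of [n] are written in one-line notation as lists of
-- natural numbers, using the values 0,1,…,n-1 (order-isomorphic to [n]).

-- i-th entry of a list (default 0 out of range; only used in range)
nth : List ℕ → ℕ → ℕ
nth []       _       = 0
nth (x ∷ xs) zero    = x
nth (x ∷ xs) (suc i) = nth xs i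

OrderIso : List ℕ → List ℕ → Set
OrderIso s τ = length s ≡ length τ ×
  (∀ i j → i < length s → j < length s → (nth s i < nth s j) ⇔ (nth τ i < nth τ j))

Contains : List ℕ → List ℕ → Set
Contains π τ = Σ (List ℕ) λ s → (s ⊆ π) × OrderIso s τ

Avoids : List ℕ → List ℕ → Set
Avoids π τ = ¬ Contains π τ

IsPerm : ℕ → List ℕ → Set
IsPerm n π = π ↭ upTo n

InSnT : List (List ℕ) → ℕ → List ℕ → Set
InSnT T n π = IsPerm n π × (∀ τ → τ ∈ T → Avoids π τ)

HasCard : (List ℕ → Set) → ℕ → Set
HasCard P k = Σ (List (List ℕ)) λ L → Unique L × (∀ π → (π ∈ L) ⇔ P π) × length L ≡ k

T : List (List ℕ)
T = (1 ∷ 3 ∷ 2 ∷ 4 ∷ []) ∷ (2 ∷ 3 ∷ 4 ∷ 1 ∷ []) ∷ (4 ∷ 1 ∷ 2 ∷ 3 ∷ []) ∷ []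

Series : Set
Series = ℕ → ℤ

convSum : (ℕ → ℕ → ℤ) → ℕ → ℤ
convSum f n = go n n
  where
  go : ℕ → ℕ → ℤ
  go zero    m = f 0 m
  go (suc i) m = f (suc i) (n ℕ.∸ suc i) + go i m

_⊛_ : Series → Series → Series
(a ⊛ b) n = convSum (λ i j → a i * b j) n

_⊕_ : Series → Series → Series
(a ⊕ b) n = a n + b n

neg : Series → Series
neg a n = - a n

poly : List ℤ → Series
poly []       _       = + 0
poly (c ∷ cs) zero    = c
poly (c ∷ cs) (suc n) = poly cs n

_^ˢ_ : Series → ℕ → Series
a ^ˢ zero  = poly (+ 1 ∷ [])
a ^ˢ suc k = a ⊛ (a ^ˢ k)

catalan : ℕ → ℕ
catalan n = ((2 ℕ.* n) C n) / suc n

C-series : Series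
C-series n = + catalan n

numer : Series
numer = poly (+ 0 ∷ + 0 ∷ + 0 ∷ + 1 ∷ - + 3 ∷ + 3 ∷ - + 5 ∷ + 9 ∷ - + 4 ∷ [])

denom : Series
denom = (poly (+ 1 ∷ - + 1 ∷ []) ^ˢ 6) ⊛ (poly (+ 1 ∷ - + 2 ∷ []) ^ˢ 2)

{-# OPTIONS --safe #-}
module Submission where

-- All three patterns contain 123, so the permutations avoiding 123 (counted by C(x)) all qualify.
-- Grow a permutation by prepending a value s and raising the old values ≥ s.  A site s that creates a
-- pattern of T stays dead forever, so only the live sites matter.  In an avoider of T that avoids 123, let
-- c be the least value above all bottoms of ascents: the sites c, …, n are live and keep 123 out, and at
-- most one site b < c is live; prepending b creates a 123, and then at most three live sites remain.  What
-- happens next depends only on which increasing and decreasing pairs occur between the blocks of values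
-- cut out by the live sites.  This gives a generating tree with eight classes of permutations containing
-- 123 and finitely many affine families of permutations avoiding it, and its level sizes exceed the
-- Catalan numbers by an explicit combination of binomials, 2ᵈ and d 2ᵈ.

open import Defs
open import Data.Bool using (Bool; true; false)
open import Data.Empty using (⊥; ⊥-elim)
open import Data.Integer using (ℤ; +_; -_; _+_; _-_; _*_)
import Data.Integer.Properties as ℤ
open import Data.Integer.Tactic.RingSolver using (solve-∀)
open import Data.List using (List; []; _∷_; _++_; map; length; foldr; concatMap; upTo; applyUpTo; applyDownFrom)
open import Data.List.Membership.Propositional using (_∈_)
open import Data.List.Membership.Propositional.Properties using (∈-map⁺; ∈-map⁻; ∈-++⁺ˡ; ∈-++⁺ʳ; ∈-++⁻; ∈-upTo⁺; ∈-upTo⁻; ∈-applyUpTo⁺; ∈-applyUpTo⁻; ∈-applyDownFrom⁺; ∈-applyDownFrom⁻)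
open import Data.List.Membership.Propositional.Properties.WithK using (unique∧set⇒bag)
open import Data.List.Properties using (∷-injective; map-injective; length-map; map-∘; map-id; map-id-local; map-++)
open import Data.List.Relation.Binary.BagAndSetEquality using (∼bag⇒↭)
open import Data.List.Relation.Binary.Permutation.Propositional using (↭-sym; ↭⇒↭ₛ)
open import Data.List.Relation.Binary.Permutation.Propositional.Properties using (∈-resp-↭)
open import Data.List.Relation.Binary.Pointwise as Pointwise using (Pointwise; []; _∷_)
open import Data.List.Relation.Binary.Sublist.Propositional using (_⊆_; []; _∷_; _∷ʳ_; from∈; to∈)
open import Data.List.Relation.Binary.Sublist.Propositional.Properties using (Any-resp-⊆) renaming (map⁺ to ⊆-map⁺)
open import Data.List.Relation.Unary.All as All using (All; []; _∷_)
open import Data.List.Relation.Unary.AllPairs using ([]; _∷_)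
open import Data.List.Relation.Unary.Any using (here; there)
open import Data.List.Relation.Unary.Unique.Propositional using (Unique)
import Data.List.Relation.Unary.Unique.Propositional.Properties as Unique
open import Data.Nat as ℕ using (ℕ; zero; suc; pred; _∸_; _≤_; _<_; z≤n; s≤s)
open import Data.Nat.Combinatorics using (_C_; nCk+nC[k+1]≡[n+1]C[k+1]; nCk≡nC[n∸k]; nC1≡n)
open import Data.Nat.DivMod using (m*n/n≡m; /-congˡ)
open import Data.Nat.ListAction using (sum)
open import Data.Nat.ListAction.Properties using (sum-++)
open import Data.Nat.Properties as ℕ
import Data.Nat.Tactic.RingSolver as ℕSolver
open import Data.Product using (Σ; ∃; ∃₂; _×_; _,_; proj₁; proj₂; map₂)
open import Data.Product.Properties using (≡-dec)
open import Data.Sum using (_⊎_; inj₁; inj₂; [_,_]′)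
open import Data.Unit using (⊤; tt)
open import Function.Base using (_∘_; id; const)
open import Function.Bundles using (_⇔_; mk⇔; Equivalence)
open import Relation.Binary.Definitions using (tri<; tri≈; tri>; DecidableEquality)
open import Relation.Binary.PropositionalEquality
open import Relation.Nullary using (¬_; yes; no; Dec)
open import Relation.Nullary.Decidable using (from-yes; _×-dec_; ¬?)

open import Data.List.Membership.DecPropositional (≡-dec _≟_ _≟_) using (_∈?_)
open import Data.List.Relation.Binary.Permutation.Setoid.Properties (setoid ℕ) using (Unique-resp-↭)

-- Prepending a value to a permutation

-- The obstacle is that a permutation avoiding 123 has unboundedly many live sites, so no finite
-- transition table covers it. What helps is that the parameter n - c never leaves the Catalan tree:
-- raising the top keeps c, a safe site s moves c to s + 1, and a node with parameter p gets
-- children with parameters 1, ..., p + 1 whatever else is true of it. A state therefore differs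
-- from a plain Catalan node only by the fate of the site b and by at most one additional child, the
-- one that contains 123. Its number of descendants is a ballot number plus an excess, and since the
-- excess of the children is affine in the parameters, the recurrences for the excess close up with
-- coefficients that depend on the depth alone. The factors of the denominator can be read off from
-- these recurrences: the doubling classes yield 2ᵈ and d 2ᵈ, hence (1-2x)², and repeated summation
-- of polynomials in d reaches binomials of order 5, hence (1-x)⁶.

bump : ℕ → ℕ → ℕ
bump zero    v       = suc v
bump (suc a) zero    = zero
bump (suc a) (suc v) = suc (bump a v)

-- Both `a` and `suc a` go to `a`, so this is a left inverse of `bump a` and of `bump (suc a)`
-- alike. The first undoes prepending; both together describe the fusion of two neighbouring blocks
-- in `drop`.
pinch : ℕ → ℕ → ℕ
pinch zero    zero    = zero
pinch zero    (suc v) = v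
pinch (suc a) zero    = zero
pinch (suc a) (suc v) = suc (pinch a v)

bump-< : ∀ {a v} → v < a → bump a v ≡ v
bump-< {suc a} {zero}  _         = refl
bump-< {suc a} {suc v} (s≤s v<a) = cong suc (bump-< v<a)

bump-≥ : ∀ {a v} → a ≤ v → bump a v ≡ suc v
bump-≥ {zero}          _         = refl
bump-≥ {suc a} {suc v} (s≤s a≤v) = cong suc (bump-≥ a≤v)

data BumpView (a v : ℕ) : Set where
  below : v < a → bump a v ≡ v → BumpView a v
  above : a ≤ v → bump a v ≡ suc v → BumpView a v

bumpView : ∀ a v → BumpView a v
bumpView a v with <-≤-connex v a
... | inj₁ v<a = below v<a (bump-< v<a)
... | inj₂ a≤v = above a≤v (bump-≥ a≤v)

bump-mono-< : ∀ a {v w} → v < w → bump a v < bump a w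
bump-mono-< zero    v<w                     = s≤s v<w
bump-mono-< (suc a) {zero}  {suc w} _         = s≤s z≤n
bump-mono-< (suc a) {suc v} {suc w} (s≤s v<w) = s≤s (bump-mono-< a v<w)

bump-cancel-< : ∀ a {v w} → bump a v < bump a w → v < w
bump-cancel-< zero    (s≤s v<w)               = v<w
bump-cancel-< (suc a) {zero}  {suc w} _         = s≤s z≤n
bump-cancel-< (suc a) {suc v} {suc w} (s≤s v<w) = s≤s (bump-cancel-< a v<w)

bump-injective : ∀ a {v w} → bump a v ≡ bump a w → v ≡ w
bump-injective zero    eq                   = suc-injective eq
bump-injective (suc a) {zero}  {zero}  _    = refl
bump-injective (suc a) {suc v} {suc w} eq   = cong suc (bump-injective a (suc-injective eq))

bump-≢ : ∀ a {v} → bump a v ≢ a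
bump-≢ (suc a) {suc v} eq = bump-≢ a (suc-injective eq)

bump-pinch : ∀ a {v} → v ≢ a → bump a (pinch a v) ≡ v
bump-pinch zero    {zero}  v≢a = ⊥-elim (v≢a refl)
bump-pinch zero    {suc v} v≢a = refl
bump-pinch (suc a) {zero}  v≢a = refl
bump-pinch (suc a) {suc v} v≢a = cong suc (bump-pinch a (v≢a ∘ cong suc))

bump-<-suc : ∀ a {v n} → v < n → bump a v < suc n
bump-<-suc a {v} v<n with bumpView a v
... | below _ eq = subst (_< suc _) (sym eq) (m<n⇒m<1+n v<n)
... | above _ eq = subst (_< suc _) (sym eq) (s≤s v<n)

≤bump : ∀ a v → v ≤ bump a v
≤bump a v with bumpView a v
... | below _ eq = ≤-reflexive (sym eq)
... | above _ eq = ≤-trans (n≤1+n v) (≤-reflexive (sym eq))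

ext : ℕ → List ℕ → List ℕ
ext a π = a ∷ map (bump a) π

record Perm (n : ℕ) (π : List ℕ) : Set where
  field
    unique : Unique π
    bound  : ∀ {v} → v ∈ π → v < n
    full   : ∀ {v} → v < n → v ∈ π
open Perm

upTo-perm : ∀ {n π} → IsPerm n π → Perm n π
upTo-perm {n} π↭ .unique    = Unique-resp-↭ (↭⇒↭ₛ (↭-sym π↭)) (Unique.upTo⁺ n)
upTo-perm {n} π↭ .bound v∈π = ∈-upTo⁻ (∈-resp-↭ π↭ v∈π)
upTo-perm {n} π↭ .full v<n  = ∈-resp-↭ (↭-sym π↭) (∈-upTo⁺ v<n)

perm-upTo : ∀ {n π} → Perm n π → IsPerm n π
perm-upTo {n} p = ∼bag⇒↭ (unique∧set⇒bag (unique p) (Unique.upTo⁺ n)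
  (mk⇔ (∈-upTo⁺ ∘ bound p) (full p ∘ ∈-upTo⁻)))

perm-ext : ∀ {n π a} → a ≤ n → Perm n π → Perm (suc n) (ext a π)
perm-ext {n} {π} {a} a≤n p .unique =
  All.tabulate (λ v∈ a≡v → let _ , _ , eq = ∈-map⁻ (bump a) v∈ in bump-≢ a (sym (trans a≡v eq)))
  ∷ Unique.map⁺ (bump-injective a) (unique p)
perm-ext a≤n p .bound (here refl) = s≤s a≤n
perm-ext {a = a} a≤n p .bound (there v∈) with ∈-map⁻ (bump a) v∈
... | u , u∈π , refl = bump-<-suc a (bound p u∈π)
perm-ext {a = a} a≤n p .full {v} v<1+n with <-cmp v a
... | tri< v<a _ _ = there (subst (_∈ _) (bump-< v<a) (∈-map⁺ (bump a) (full p (<-≤-trans v<a a≤n))))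
... | tri≈ _ refl _ = here refl
perm-ext {a = a} a≤n p .full {suc v} (s≤s v<n) | tri> _ _ (s≤s a≤v) =
  there (subst (_∈ _) (bump-≥ a≤v) (∈-map⁺ (bump a) (full p v<n)))

ext-perm⁻ : ∀ {n ρ} → Perm (suc n) ρ → ∃₂ λ a π → a ≤ n × Perm n π × ρ ≡ ext a π
ext-perm⁻ {ρ = []} p with full p (s≤s z≤n)
... | ()
ext-perm⁻ {n} {a ∷ ρ} p with unique p
... | a∉ρ ∷ uρ = a , map (pinch a) ρ , a≤n , q , cong (a ∷_) (sym eq)
  where
  a≤n : a ≤ n
  a≤n = ≤-pred (bound p (here refl))
  eq : map (bump a) (map (pinch a) ρ) ≡ ρ
  eq = trans (sym (map-∘ ρ)) (map-id-local (All.map (λ a≢v → bump-pinch a (≢-sym a≢v)) a∉ρ))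
  q : Perm n (map (pinch a) ρ)
  q .unique = Unique.map⁻ (subst Unique (sym eq) uρ)
  q .bound {v} v∈ with bumpView a v | bound p (there (subst (bump a v ∈_) eq (∈-map⁺ (bump a) v∈)))
  ... | below v<a _ | _  = <-≤-trans v<a a≤n
  ... | above _ eq′ | lt = ≤-pred (subst (_< suc n) eq′ lt)
  q .full {v} v<n with full p (bump-<-suc a v<n)
  ... | here eq′ = ⊥-elim (bump-≢ a eq′)
  ... | there v∈ρ with ∈-map⁻ (bump a) (subst (bump a v ∈_) (sym eq) v∈ρ)
  ...   | u , u∈ , eq′ = subst (_∈ _) (sym (bump-injective a eq′)) u∈

ext-injective : ∀ {a b π ρ} → ext a π ≡ ext b ρ → a ≡ b × π ≡ ρ
ext-injective {a} eq with ∷-injective eq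
... | refl , eq′ = refl , map-injective (bump-injective a) eq′

⊆-map⁻ : ∀ {A B : Set} (f : A → B) {xs ys} → xs ⊆ map f ys → ∃ λ us → us ⊆ ys × xs ≡ map f us
⊆-map⁻ f {ys = []}     []        = [] , [] , refl
⊆-map⁻ f {ys = y ∷ ys} (_ ∷ʳ s)  = let us , t , eq = ⊆-map⁻ f s in us , y ∷ʳ t , eq
⊆-map⁻ f {ys = y ∷ ys} (refl ∷ s) = let us , t , eq = ⊆-map⁻ f s in y ∷ us , refl ∷ t , cong (f y ∷_) eq

[]⊆ : ∀ {π : List ℕ} → [] ⊆ π
[]⊆ {[]}    = []
[]⊆ {x ∷ π} = x ∷ʳ []⊆

-- Occurrences of the patterns of T

data Bad (π : List ℕ) : Set where
  bad₁ : ∀ {w x y z} → w ∷ x ∷ y ∷ z ∷ [] ⊆ π → w < y → y < x → x < z → Bad π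
  bad₂ : ∀ {w x y z} → w ∷ x ∷ y ∷ z ∷ [] ⊆ π → z < w → w < x → x < y → Bad π
  bad₃ : ∀ {w x y z} → w ∷ x ∷ y ∷ z ∷ [] ⊆ π → x < y → y < z → z < w → Bad π

-- [Dead a π]: some pattern of T appears in [ext a π] with the new entry as its first letter.
data Dead (a : ℕ) (π : List ℕ) : Set where
  dead₁ : ∀ {x y z} → x ∷ y ∷ z ∷ [] ⊆ π → a ≤ y → y < x → x < z → Dead a π
  dead₂ : ∀ {x y z} → x ∷ y ∷ z ∷ [] ⊆ π → z < a → a ≤ x → x < y → Dead a π
  dead₃ : ∀ {x y z} → x ∷ y ∷ z ∷ [] ⊆ π → x < y → y < z → z < a → Dead a π

<bump⇒≤ : ∀ {a v} → a < bump a v → a ≤ v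
<bump⇒≤ {a} {v} lt with bumpView a v
... | below v<a eq = ⊥-elim (<-asym lt (subst (_< a) (sym eq) v<a))
... | above a≤v _  = a≤v

bump<⇒< : ∀ {a v} → bump a v < a → v < a
bump<⇒< {a} {v} lt = ≤-<-trans (≤bump a v) lt

≤⇒<bump : ∀ {a v} → a ≤ v → a < bump a v
≤⇒<bump a≤v = subst (_ <_) (sym (bump-≥ a≤v)) (s≤s a≤v)

<⇒bump< : ∀ {a v} → v < a → bump a v < a
<⇒bump< v<a = subst (_< _) (sym (bump-< v<a)) v<a

bad-ext⁻ : ∀ {a π} → Bad (ext a π) → Bad π ⊎ Dead a π
bad-ext⁻ {a} (bad₁ (_ ∷ʳ s) p q r) with ⊆-map⁻ (bump a) s
... | _ ∷ _ ∷ _ ∷ _ ∷ [] , t , refl = inj₁ (bad₁ t (bump-cancel-< a p) (bump-cancel-< a q) (bump-cancel-< a r))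
bad-ext⁻ {a} (bad₂ (_ ∷ʳ s) p q r) with ⊆-map⁻ (bump a) s
... | _ ∷ _ ∷ _ ∷ _ ∷ [] , t , refl = inj₁ (bad₂ t (bump-cancel-< a p) (bump-cancel-< a q) (bump-cancel-< a r))
bad-ext⁻ {a} (bad₃ (_ ∷ʳ s) p q r) with ⊆-map⁻ (bump a) s
... | _ ∷ _ ∷ _ ∷ _ ∷ [] , t , refl = inj₁ (bad₃ t (bump-cancel-< a p) (bump-cancel-< a q) (bump-cancel-< a r))
bad-ext⁻ {a} (bad₁ (refl ∷ s) p q r) with ⊆-map⁻ (bump a) s
... | _ ∷ _ ∷ _ ∷ [] , t , refl = inj₂ (dead₁ t (<bump⇒≤ p) (bump-cancel-< a q) (bump-cancel-< a r))
bad-ext⁻ {a} (bad₂ (refl ∷ s) p q r) with ⊆-map⁻ (bump a) s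
... | _ ∷ _ ∷ _ ∷ [] , t , refl = inj₂ (dead₂ t (bump<⇒< p) (<bump⇒≤ q) (bump-cancel-< a r))
bad-ext⁻ {a} (bad₃ (refl ∷ s) p q r) with ⊆-map⁻ (bump a) s
... | _ ∷ _ ∷ _ ∷ [] , t , refl = inj₂ (dead₃ t (bump-cancel-< a p) (bump-cancel-< a q) (bump<⇒< r))

bad-ext : ∀ {a π} → Bad π → Bad (ext a π)
bad-ext {a} (bad₁ s p q r) = bad₁ (a ∷ʳ ⊆-map⁺ (bump a) s) (bump-mono-< a p) (bump-mono-< a q) (bump-mono-< a r)
bad-ext {a} (bad₂ s p q r) = bad₂ (a ∷ʳ ⊆-map⁺ (bump a) s) (bump-mono-< a p) (bump-mono-< a q) (bump-mono-< a r)
bad-ext {a} (bad₃ s p q r) = bad₃ (a ∷ʳ ⊆-map⁺ (bump a) s) (bump-mono-< a p) (bump-mono-< a q) (bump-mono-< a r)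

dead⇒bad : ∀ {a π} → Dead a π → Bad (ext a π)
dead⇒bad {a} (dead₁ s p q r) = bad₁ (refl ∷ ⊆-map⁺ (bump a) s) (≤⇒<bump p) (bump-mono-< a q) (bump-mono-< a r)
dead⇒bad {a} (dead₂ s p q r) = bad₂ (refl ∷ ⊆-map⁺ (bump a) s) (<⇒bump< p) (≤⇒<bump q) (bump-mono-< a r)
dead⇒bad {a} (dead₃ s p q r) = bad₃ (refl ∷ ⊆-map⁺ (bump a) s) (bump-mono-< a p) (bump-mono-< a q) (<⇒bump< r)

-- Order isomorphism against inequalities between entries

nth-map : ∀ (f : ℕ → ℕ) xs i → i < length xs → nth (map f xs) i ≡ f (nth xs i)
nth-map f (x ∷ xs) zero    _         = refl
nth-map f (x ∷ xs) (suc i) (s≤s i<n) = nth-map f xs i i<n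

nth-∈ : ∀ xs i → i < length xs → nth xs i ∈ xs
nth-∈ (x ∷ xs) zero    _         = here refl
nth-∈ (x ∷ xs) (suc i) (s≤s i<n) = there (nth-∈ xs i i<n)

-- Monotonicity on the entries of `τ` suffices, because trichotomy turns it into an equivalence.
map-orderIso : ∀ τ (g : ℕ → ℕ) → (∀ {u v} → u ∈ τ → v ∈ τ → u < v → g u < g v) → OrderIso (map g τ) τ
map-orderIso τ g mono = length-map g τ , λ i j i< j< → go i j (subst (i <_) (length-map g τ) i<) (subst (j <_) (length-map g τ) j<)
  where
  go : ∀ i j → i < length τ → j < length τ → (nth (map g τ) i < nth (map g τ) j) ⇔ (nth τ i < nth τ j)
  go i j i< j< rewrite nth-map g τ i i< | nth-map g τ j j< = mk⇔ reflects (mono (nth-∈ τ i i<) (nth-∈ τ j j<))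
    where
    reflects : g (nth τ i) < g (nth τ j) → nth τ i < nth τ j
    reflects lt with <-cmp (nth τ i) (nth τ j)
    ... | tri< p _ _ = p
    ... | tri≈ _ e _ = ⊥-elim (<-irrefl (cong g e) lt)
    ... | tri> _ _ p = ⊥-elim (<-asym lt (mono (nth-∈ τ j j<) (nth-∈ τ i i<) p))

-- With the four values of an occurrence as `a < b < c < d`, mapping this over a pattern gives back
-- the occurrence, so `rank-orderIso` serves all three patterns.
rank : ℕ → ℕ → ℕ → ℕ → ℕ → ℕ
rank a b c d 1 = a
rank a b c d 2 = b
rank a b c d 3 = c
rank a b c d _ = d

rank-mono : ∀ {a b c d} → a < b → b < c → c < d →
            ∀ {u v} → 1 ≤ u × u ≤ 4 → 1 ≤ v × v ≤ 4 → u < v → rank a b c d u < rank a b c d v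
rank-mono p q r {1} {2} _ _ _ = p
rank-mono p q r {1} {3} _ _ _ = <-trans p q
rank-mono p q r {1} {4} _ _ _ = <-trans p (<-trans q r)
rank-mono p q r {2} {3} _ _ _ = q
rank-mono p q r {2} {4} _ _ _ = <-trans q r
rank-mono p q r {3} {4} _ _ _ = r
rank-mono p q r {suc _} {1} _ _ (s≤s ())
rank-mono p q r {suc (suc _)} {2} _ _ (s≤s (s≤s ()))
rank-mono p q r {suc (suc (suc _))} {3} _ _ (s≤s (s≤s (s≤s ())))
rank-mono p q r {suc (suc (suc (suc _)))} {4} _ _ (s≤s (s≤s (s≤s (s≤s ()))))
rank-mono p q r {v = suc (suc (suc (suc (suc _))))} _ (_ , s≤s (s≤s (s≤s (s≤s ())))) _

rank-orderIso : ∀ {a b c d} → a < b → b < c → c < d → ∀ τ → All (λ u → 1 ≤ u × u ≤ 4) τ →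
                OrderIso (map (rank a b c d) τ) τ
rank-orderIso p q r τ all = map-orderIso τ _ λ u∈ v∈ → rank-mono p q r (All.lookup all u∈) (All.lookup all v∈)


contains⇒bad : ∀ {π τ} → τ ∈ T → Contains π τ → Bad π
contains⇒bad (here refl) (w ∷ x ∷ y ∷ z ∷ [] , s , _ , iso) =
  -- The index pairs are the positions of the values 1 and 2, 2 and 3, 3 and 4 in the pattern;
  -- likewise in the other two clauses.
  bad₁ s (at 0 2 (<ᵇ⇒< _ _ _) (<ᵇ⇒< _ _ _) (<ᵇ⇒< _ _ _)) (at 2 1 (<ᵇ⇒< _ _ _) (<ᵇ⇒< _ _ _) (<ᵇ⇒< _ _ _)) (at 1 3 (<ᵇ⇒< _ _ _) (<ᵇ⇒< _ _ _) (<ᵇ⇒< _ _ _))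
  where
  at = λ i j i< j< → Equivalence.from (iso i j i< j<)
contains⇒bad (there (here refl)) (w ∷ x ∷ y ∷ z ∷ [] , s , _ , iso) =
  bad₂ s (at 3 0 (<ᵇ⇒< _ _ _) (<ᵇ⇒< _ _ _) (<ᵇ⇒< _ _ _)) (at 0 1 (<ᵇ⇒< _ _ _) (<ᵇ⇒< _ _ _) (<ᵇ⇒< _ _ _)) (at 1 2 (<ᵇ⇒< _ _ _) (<ᵇ⇒< _ _ _) (<ᵇ⇒< _ _ _))
  where
  at = λ i j i< j< → Equivalence.from (iso i j i< j<)
contains⇒bad (there (there (here refl))) (w ∷ x ∷ y ∷ z ∷ [] , s , _ , iso) =
  bad₃ s (at 1 2 (<ᵇ⇒< _ _ _) (<ᵇ⇒< _ _ _) (<ᵇ⇒< _ _ _)) (at 2 3 (<ᵇ⇒< _ _ _) (<ᵇ⇒< _ _ _) (<ᵇ⇒< _ _ _)) (at 3 0 (<ᵇ⇒< _ _ _) (<ᵇ⇒< _ _ _) (<ᵇ⇒< _ _ _))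
  where
  at = λ i j i< j< → Equivalence.from (iso i j i< j<)

inRange? : (τ : List ℕ) → Dec (All (λ u → 1 ≤ u × u ≤ 4) τ)
inRange? = All.all? λ u → (1 ≤? u) ×-dec (u ≤? 4)

bad⇒contains : ∀ {π} → Bad π → ∃ λ τ → τ ∈ T × Contains π τ
bad⇒contains (bad₁ s p q r) = _ , here refl , _ , s , rank-orderIso p q r _ (from-yes (inRange? (1 ∷ 3 ∷ 2 ∷ 4 ∷ [])))
bad⇒contains (bad₂ s p q r) = _ , there (here refl) , _ , s , rank-orderIso p q r _ (from-yes (inRange? (2 ∷ 3 ∷ 4 ∷ 1 ∷ [])))
bad⇒contains (bad₃ s p q r) = _ , there (there (here refl)) , _ , s , rank-orderIso p q r _ (from-yes (inRange? (4 ∷ 1 ∷ 2 ∷ 3 ∷ [])))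

record Avoider (n : ℕ) (π : List ℕ) : Set where
  field
    perm  : Perm n π
    ¬bad : ¬ Bad π

inSnT⇒avoider : ∀ {n π} → InSnT T n π → Avoider n π
inSnT⇒avoider (p , av) = record
  { perm = upTo-perm p
  ; ¬bad = λ b → let τ , τ∈T , c = bad⇒contains b in av τ τ∈T c }

avoider⇒inSnT : ∀ {n π} → Avoider n π → InSnT T n π
avoider⇒inSnT av = perm-upTo (Avoider.perm av) , λ τ τ∈T c → Avoider.¬bad av (contains⇒bad τ∈T c)

-- Increasing and decreasing pairs, and the sites that a new entry kills

Asc Dsc : List ℕ → ℕ → ℕ → Set
Asc π x y = x < y × x ∷ y ∷ [] ⊆ π
Dsc π x y = x < y × y ∷ x ∷ [] ⊆ π

asc-∈ˡ : ∀ {π x y} → Asc π x y → x ∈ π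
asc-∈ˡ (_ , s) = Any-resp-⊆ s (here refl)

asc-∈ʳ : ∀ {π x y} → Asc π x y → y ∈ π
asc-∈ʳ (_ , s) = Any-resp-⊆ s (there (here refl))

dsc-∈ˡ : ∀ {π x y} → Dsc π x y → x ∈ π
dsc-∈ˡ (_ , s) = Any-resp-⊆ s (there (here refl))

dsc-∈ʳ : ∀ {π x y} → Dsc π x y → y ∈ π
dsc-∈ʳ (_ , s) = Any-resp-⊆ s (here refl)

before-total : ∀ {π : List ℕ} {x y} → x ∈ π → y ∈ π → x ≢ y → x ∷ y ∷ [] ⊆ π ⊎ y ∷ x ∷ [] ⊆ π
before-total (here refl) (here refl) x≢y = ⊥-elim (x≢y refl)
before-total (here refl) (there y∈)  x≢y = inj₁ (refl ∷ from∈ y∈)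
before-total (there x∈)  (here refl) x≢y = inj₂ (refl ∷ from∈ x∈)
before-total (there x∈)  (there y∈)  x≢y with before-total x∈ y∈ x≢y
... | inj₁ s = inj₁ (_ ∷ʳ s)
... | inj₂ s = inj₂ (_ ∷ʳ s)

asc-or-dsc : ∀ {n π x y} → Perm n π → x < y → y < n → Asc π x y ⊎ Dsc π x y
asc-or-dsc p x<y y<n with before-total (full p (<-trans x<y y<n)) (full p y<n) (<⇒≢ x<y)
... | inj₁ s = inj₁ (x<y , s)
... | inj₂ s = inj₂ (x<y , s)

data AscExt (s : ℕ) (π : List ℕ) : ℕ → ℕ → Set where
  old : ∀ {x y} → Asc π x y → AscExt s π (bump s x) (bump s y)
  new : ∀ {y} → y ∈ π → s ≤ y → AscExt s π s (suc y)

data DscExt (s : ℕ) (π : List ℕ) : ℕ → ℕ → Set where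
  old : ∀ {x y} → Dsc π x y → DscExt s π (bump s x) (bump s y)
  new : ∀ {x} → x ∈ π → x < s → DscExt s π x s

asc-ext⁻ : ∀ {s π x y} → Asc (ext s π) x y → AscExt s π x y
asc-ext⁻ {s} (lt , _ ∷ʳ t) with ⊆-map⁻ (bump s) t
... | _ ∷ _ ∷ [] , u , refl = old (bump-cancel-< s lt , u)
asc-ext⁻ {s} (lt , refl ∷ t) with ⊆-map⁻ (bump s) t
... | y ∷ [] , u , refl = subst (AscExt s _ s) (sym (bump-≥ s≤y)) (new (to∈ u) s≤y)
  where s≤y = <bump⇒≤ lt

dsc-ext⁻ : ∀ {s π x y} → Dsc (ext s π) x y → DscExt s π x y
dsc-ext⁻ {s} (lt , _ ∷ʳ t) with ⊆-map⁻ (bump s) t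
... | _ ∷ _ ∷ [] , u , refl = old (bump-cancel-< s lt , u)
dsc-ext⁻ {s} (lt , refl ∷ t) with ⊆-map⁻ (bump s) t
... | x ∷ [] , u , refl = subst (λ v → DscExt s _ v s) (sym (bump-< x<s)) (new (to∈ u) x<s)
  where x<s = bump<⇒< lt

asc-old : ∀ {s π x y} → Asc π x y → Asc (ext s π) (bump s x) (bump s y)
asc-old {s} (lt , t) = bump-mono-< s lt , _ ∷ʳ ⊆-map⁺ (bump s) t

dsc-old : ∀ {s π x y} → Dsc π x y → Dsc (ext s π) (bump s x) (bump s y)
dsc-old {s} (lt , t) = bump-mono-< s lt , _ ∷ʳ ⊆-map⁺ (bump s) t

asc-new : ∀ {s π y} → y ∈ π → s ≤ y → Asc (ext s π) s (suc y)
asc-new {s} y∈π s≤y = s≤s s≤y , refl ∷ from∈ (subst (_∈ _) (bump-≥ s≤y) (∈-map⁺ (bump s) y∈π))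

dsc-new : ∀ {s π x} → x ∈ π → x < s → Dsc (ext s π) x s
dsc-new {s} x∈π x<s = x<s , refl ∷ from∈ (subst (_∈ _) (bump-< x<s) (∈-map⁺ (bump s) x∈π))

-- Prepending s kills a surviving site a ≤ s (which stays a), respectively a ≥ s (which becomes suc a).
data KillLo (s a : ℕ) (π : List ℕ) : Set where
  byAsc : ∀ {x y} → Asc π x y → a ≤ x → x < s → s ≤ y → KillLo s a π
  byDsc : ∀ {x y} → Dsc π x y → x < a → s ≤ y → KillLo s a π

data KillHi (s a : ℕ) (π : List ℕ) : Set where
  byAsc : ∀ {x y} → Asc π x y → s ≤ x → y < a → KillHi s a π

module _ {s a : ℕ} (a≤s : a ≤ s) where

  private
    ≤bump⇒≤ : ∀ {v} → a ≤ bump s v → a ≤ v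
    ≤bump⇒≤ {v} le with bumpView s v
    ... | below _ eq = subst (a ≤_) eq le
    ... | above s≤v _ = ≤-trans a≤s s≤v

    ≤⇒≤bump : ∀ {v} → a ≤ v → a ≤ bump s v
    ≤⇒≤bump {v} le = ≤-trans le (≤bump s v)

    <⇒bump<′ : ∀ {v} → v < a → bump s v < a
    <⇒bump<′ v<a = subst (_< a) (sym (bump-< (<-≤-trans v<a a≤s))) v<a

  -- A new occurrence uses `s` as its second letter: as the 3 of 1324, which leaves the increasing
  -- pair 24, or as the 3 of 2341, which leaves the decreasing pair 41. It cannot be the 1 of 4123,
  -- since `a ≤ s`.
  deadLo⁻ : ∀ {π} → Dead a (ext s π) → Dead a π ⊎ KillLo s a π
  deadLo⁻ (dead₁ (_ ∷ʳ t) p q r) with ⊆-map⁻ (bump s) t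
  ... | _ ∷ _ ∷ _ ∷ [] , u , refl = inj₁ (dead₁ u (≤bump⇒≤ p) (bump-cancel-< s q) (bump-cancel-< s r))
  deadLo⁻ (dead₂ (_ ∷ʳ t) p q r) with ⊆-map⁻ (bump s) t
  ... | _ ∷ _ ∷ _ ∷ [] , u , refl = inj₁ (dead₂ u (≤-<-trans (≤bump s _) p) (≤bump⇒≤ q) (bump-cancel-< s r))
  deadLo⁻ (dead₃ (_ ∷ʳ t) p q r) with ⊆-map⁻ (bump s) t
  ... | _ ∷ _ ∷ _ ∷ [] , u , refl = inj₁ (dead₃ u (bump-cancel-< s p) (bump-cancel-< s q) (≤-<-trans (≤bump s _) r))
  deadLo⁻ (dead₁ (refl ∷ t) p q r) with ⊆-map⁻ (bump s) t
  ... | _ ∷ _ ∷ [] , u , refl = inj₂ (byAsc (bump-cancel-< s (<-trans q r) , u) (≤bump⇒≤ p) (bump<⇒< q) (<bump⇒≤ r))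
  deadLo⁻ (dead₂ (refl ∷ t) p q r) with ⊆-map⁻ (bump s) t
  ... | _ ∷ _ ∷ [] , u , refl =
    inj₂ (byDsc (bump-cancel-< s (<-trans (<-≤-trans p a≤s) r) , u) (≤-<-trans (≤bump s _) p) (<bump⇒≤ r))
  deadLo⁻ (dead₃ (refl ∷ t) p q r) = ⊥-elim (<⇒≱ (<-trans p (<-trans q r)) a≤s)

  deadLo-old : ∀ {π} → Dead a π → Dead a (ext s π)
  deadLo-old (dead₁ u p q r) = dead₁ (_ ∷ʳ ⊆-map⁺ (bump s) u) (≤⇒≤bump p) (bump-mono-< s q) (bump-mono-< s r)
  deadLo-old (dead₂ u p q r) = dead₂ (_ ∷ʳ ⊆-map⁺ (bump s) u) (<⇒bump<′ p) (≤⇒≤bump q) (bump-mono-< s r)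
  deadLo-old (dead₃ u p q r) = dead₃ (_ ∷ʳ ⊆-map⁺ (bump s) u) (bump-mono-< s p) (bump-mono-< s q) (<⇒bump<′ r)

  deadLo-new : ∀ {π} → KillLo s a π → Dead a (ext s π)
  deadLo-new (byAsc (_ , u) p q r) = dead₁ (refl ∷ ⊆-map⁺ (bump s) u) (≤⇒≤bump p) (<⇒bump< q) (≤⇒<bump r)
  deadLo-new (byDsc (_ , u) p q)   = dead₂ (refl ∷ ⊆-map⁺ (bump s) u) (<⇒bump<′ p) a≤s (≤⇒<bump q)

module _ {s a : ℕ} (s≤a : s ≤ a) where

  private
    ≤bump⇒≤ : ∀ {v} → suc a ≤ bump s v → a ≤ v
    ≤bump⇒≤ {v} le with bumpView s v
    ... | below v<s eq = ⊥-elim (<⇒≱ (<-≤-trans v<s s≤a) (<⇒≤ (subst (suc a ≤_) eq le)))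
    ... | above _ eq   = ≤-pred (subst (suc a ≤_) eq le)

    ≤⇒≤bump : ∀ {v} → a ≤ v → suc a ≤ bump s v
    ≤⇒≤bump a≤v = subst (suc a ≤_) (sym (bump-≥ (≤-trans s≤a a≤v))) (s≤s a≤v)

    bump<⇒<′ : ∀ {v} → bump s v < suc a → v < a
    bump<⇒<′ {v} lt with bumpView s v
    ... | below v<s _ = <-≤-trans v<s s≤a
    ... | above _ eq  = ≤-pred (subst (_< suc a) eq lt)

  -- Above `s` the roles change: `s` can only be the 1 of 4123, and the remaining 23 is an
  -- increasing pair between `s` and `a`.
  deadHi⁻ : ∀ {π} → Dead (suc a) (ext s π) → Dead a π ⊎ KillHi s a π
  deadHi⁻ (dead₁ (_ ∷ʳ t) p q r) with ⊆-map⁻ (bump s) t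
  ... | _ ∷ _ ∷ _ ∷ [] , u , refl = inj₁ (dead₁ u (≤bump⇒≤ p) (bump-cancel-< s q) (bump-cancel-< s r))
  deadHi⁻ (dead₂ (_ ∷ʳ t) p q r) with ⊆-map⁻ (bump s) t
  ... | _ ∷ _ ∷ _ ∷ [] , u , refl = inj₁ (dead₂ u (bump<⇒<′ p) (≤bump⇒≤ q) (bump-cancel-< s r))
  deadHi⁻ (dead₃ (_ ∷ʳ t) p q r) with ⊆-map⁻ (bump s) t
  ... | _ ∷ _ ∷ _ ∷ [] , u , refl = inj₁ (dead₃ u (bump-cancel-< s p) (bump-cancel-< s q) (bump<⇒<′ r))
  deadHi⁻ (dead₁ (refl ∷ t) p q r) = ⊥-elim (<⇒≱ (≤-<-trans p q) (m≤n⇒m≤1+n s≤a))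
  deadHi⁻ (dead₂ (refl ∷ t) p q r) = ⊥-elim (<⇒≱ q s≤a)
  deadHi⁻ (dead₃ (refl ∷ t) p q r) with ⊆-map⁻ (bump s) t
  ... | _ ∷ _ ∷ [] , u , refl = inj₂ (byAsc (bump-cancel-< s q , u) (<bump⇒≤ p) (bump<⇒<′ r))

  deadHi-old : ∀ {π} → Dead a π → Dead (suc a) (ext s π)
  deadHi-old (dead₁ u p q r) = dead₁ (_ ∷ʳ ⊆-map⁺ (bump s) u) (≤⇒≤bump p) (bump-mono-< s q) (bump-mono-< s r)
  deadHi-old (dead₂ u p q r) = dead₂ (_ ∷ʳ ⊆-map⁺ (bump s) u) (bump-<-suc s p) (≤⇒≤bump q) (bump-mono-< s r)
  deadHi-old (dead₃ u p q r) = dead₃ (_ ∷ʳ ⊆-map⁺ (bump s) u) (bump-mono-< s p) (bump-mono-< s q) (bump-<-suc s r)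

  deadHi-new : ∀ {π} → KillHi s a π → Dead (suc a) (ext s π)
  deadHi-new (byAsc (lt , u) p q) = dead₃ (refl ∷ ⊆-map⁺ (bump s) u) (≤⇒<bump p) (bump-mono-< s lt) (bump-<-suc s q)

-- Block tables

-- The third value lets a table stay silent about entries that no transition consults, so that one
-- table can describe infinitely many permutations.
data Verdict : Set where
  holds fails unknown : Verdict

Sem : Verdict → Set → Set
Sem holds P = P
Sem fails P = ¬ P
Sem unknown P = ⊤

sem-map : ∀ v {P Q} → (P → Q) → (Q → P) → Sem v P → Sem v Q
sem-map holds f g p = f p
sem-map fails f g p = p ∘ g
sem-map unknown f g p = tt

infixr 5 _∨_

-- Kleene's three-valued disjunction: a single `holds` settles it, even next to `unknown`.
_∨_ : Verdict → Verdict → Verdict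
holds ∨ w   = holds
fails ∨ w   = w
unknown ∨ holds = holds
unknown ∨ fails = unknown
unknown ∨ unknown = unknown

sem-∨ : ∀ v w {P Q} → Sem v P → Sem w Q → Sem (v ∨ w) (P ⊎ Q)
sem-∨ holds w   p q = inj₁ p
sem-∨ fails holds p q = inj₂ q
sem-∨ fails fails p q = [ p , q ]′
sem-∨ fails unknown p q = tt
sem-∨ unknown holds p q = inj₂ q
sem-∨ unknown fails p q = tt
sem-∨ unknown unknown p q = tt

guard : ∀ {C : Set} → Dec C → Verdict → Verdict
guard (yes _) v = v
guard (no _)  v = fails

sem-guard : ∀ {C : Set} (d : Dec C) v {P} → Sem v P → Sem (guard d v) (C × P)
sem-guard (yes c) v = sem-map v (c ,_) proj₂
sem-guard (no ¬c) v _ = ¬c ∘ proj₁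

ors : ℕ → (ℕ → Verdict) → Verdict
ors zero    f = fails
ors (suc m) f = f m ∨ ors m f

sem-ors : ∀ m (f : ℕ → Verdict) {P : ℕ → Set} → (∀ i → Sem (f i) (P i)) → Sem (ors m f) (∃ λ i → i < m × P i)
sem-ors zero    f s (_ , () , _)
sem-ors (suc m) f {P} s = sem-map (f m ∨ ors m f) to from (sem-∨ (f m) (ors m f) (s m) (sem-ors m f s))
  where
  to : P m ⊎ (∃ λ i → i < m × P i) → ∃ λ i → i < suc m × P i
  to (inj₁ p)           = m , ≤-refl , p
  to (inj₂ (i , lt , p)) = i , m<n⇒m<1+n lt , p
  from : (∃ λ i → i < suc m × P i) → P m ⊎ (∃ λ i → i < m × P i)
  from (i , lt , p) with m<1+n⇒m<n∨m≡n lt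
  ... | inj₁ i<m  = inj₂ (i , i<m , p)
  ... | inj₂ refl = inj₁ p

-- [size] sites cut the values into blocks 0, …, size.  [asc i j] (resp. [dsc i j]) says whether some
-- x < y, x in block i and y in block j, appears in increasing (resp. decreasing) order.
record Table : Set where
  constructor table
  field
    size     : ℕ
    asc dsc  : ℕ → ℕ → Verdict
    nonempty₀ : Verdict
    siteDead : ℕ → Verdict
open Table

-- The first two laws say that block `suc q` starts at the value `site q`. By `others`, a site
-- missing from the table is dead unless it lies in `E`; this exempts live sites that the next step
-- is going to kill. As `site q < n`, the top site `n` is never listed.
record Fits (E : ℕ → Set) (t : Table) (n : ℕ) (π : List ℕ) : Set where
  field
    label site : ℕ → ℕ
    site≤⇒ : ∀ {q v} → q < size t → site q ≤ v → q < label v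
    site≤⇐ : ∀ {q v} → q < size t → q < label v → site q ≤ v
    label≤ : ∀ v → label v ≤ size t
    site<  : ∀ {q} → q < size t → site q < n
    site-mono : ∀ {p q} → p < q → q < size t → site p < site q
    asc-ok : ∀ i j → Sem (asc t i j) (∃₂ λ x y → Asc π x y × label x ≡ i × label y ≡ j)
    dsc-ok : ∀ i j → Sem (dsc t i j) (∃₂ λ x y → Dsc π x y × label x ≡ i × label y ≡ j)
    nonempty₀-ok : Sem (nonempty₀ t) (∃ λ v → v ∈ π × label v ≡ 0)
    dead-ok : ∀ {q} → q < size t → Sem (siteDead t q) (Dead (site q) π)
    others : ∀ {a} → a ≤ n → (∃ λ q → q < size t × site q ≡ a) ⊎ Dead a π ⊎ E a

-- A block other than block 0 contains its own left end, which is a site below `n` and hence a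
-- value; only block 0 can be empty.
nonempty : Table → ℕ → Verdict
nonempty t zero    = nonempty₀ t
nonempty t (suc i) = guard (suc i ≤? size t) holds

pinch-bump : ∀ a v → pinch a (bump a v) ≡ v
pinch-bump zero    v       = refl
pinch-bump (suc a) zero    = refl
pinch-bump (suc a) (suc v) = cong suc (pinch-bump a v)

pinch-bump-suc : ∀ a v → pinch a (bump (suc a) v) ≡ v
pinch-bump-suc zero    zero    = refl
pinch-bump-suc zero    (suc v) = refl
pinch-bump-suc (suc a) zero    = refl
pinch-bump-suc (suc a) (suc v) = cong suc (pinch-bump-suc a v)

pinch⁻ : ∀ a v → v ≡ bump (suc a) (pinch a v) ⊎ v ≡ bump a (pinch a v)
pinch⁻ zero    zero    = inj₁ refl
pinch⁻ zero    (suc v) = inj₂ refl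
pinch⁻ (suc a) zero    = inj₁ refl
pinch⁻ (suc a) (suc v) with pinch⁻ a v
... | inj₁ eq = inj₁ (cong suc eq)
... | inj₂ eq = inj₂ (cong suc eq)

bump<⇒<pinch : ∀ d {q i} → bump d q < i → q < pinch d i
bump<⇒<pinch zero    {i = suc i}       (s≤s lt) = lt
bump<⇒<pinch (suc d) {zero}  {suc i} _        = s≤s z≤n
bump<⇒<pinch (suc d) {suc q} {suc i} (s≤s lt) = s≤s (bump<⇒<pinch d lt)

<pinch⇒bump< : ∀ d {q i} → q < pinch d i → bump d q < i
<pinch⇒bump< zero    {i = suc i}     lt       = s≤s lt
<pinch⇒bump< (suc d) {zero}  {suc i} lt       = s≤s z≤n
<pinch⇒bump< (suc d) {suc q} {suc i} (s≤s lt) = s≤s (<pinch⇒bump< d lt)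

pinch-≤ : ∀ d {i k} → d ≤ k → i ≤ suc k → pinch d i ≤ k
pinch-≤ zero    {zero}  _         _         = z≤n
pinch-≤ zero    {suc i} _         (s≤s le)  = le
pinch-≤ (suc d) {zero}  _         _         = z≤n
pinch-≤ (suc d) {suc i} (s≤s d≤k) (s≤s le)  = s≤s (pinch-≤ d d≤k le)

pinch-≤-id : ∀ {d i} → i ≤ d → pinch d i ≡ i
pinch-≤-id {zero}          z≤n      = refl
pinch-≤-id {suc d}         z≤n      = refl
pinch-≤-id {suc d} {suc i} (s≤s le) = cong suc (pinch-≤-id le)

pinch-< : ∀ d {q k} → d ≤ k → q < suc k → q ≢ d → pinch d q < k
pinch-< zero    {zero}  _         _        q≢d = ⊥-elim (q≢d refl)
pinch-< zero    {suc q} _         (s≤s lt) _   = lt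
pinch-< (suc d) {zero}  (s≤s _)   _        _   = s≤s z≤n
pinch-< (suc d) {suc q} (s≤s d≤k) (s≤s lt) q≢d = s≤s (pinch-< d d≤k lt (q≢d ∘ cong suc))

module FitsProperties {E : ℕ → Set} {t : Table} {n : ℕ} {π : List ℕ} (p : Perm n π) (F : Fits E t n π) where
  open Fits F

  label-mono : ∀ {x y} → x ≤ y → label x ≤ label y
  label-mono {x} {y} x≤y with <-≤-connex (label y) (label x)
  ... | inj₂ le = le
  ... | inj₁ lt = ⊥-elim (<-irrefl refl
    (site≤⇒ (<-≤-trans lt (label≤ x)) (≤-trans (site≤⇐ (<-≤-trans lt (label≤ x)) lt) x≤y)))

  label-site : ∀ {q} → q < size t → label (site q) ≡ suc q
  label-site {q} q< with <-cmp (label (site q)) (suc q)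
  ... | tri< lt _ _ = ⊥-elim (<⇒≱ (site≤⇒ q< ≤-refl) (≤-pred lt))
  ... | tri≈ _ eq _ = eq
  ... | tri> _ _ gt = ⊥-elim (<⇒≱ (site-mono ≤-refl sq<) (site≤⇐ sq< gt))
    where sq< = <-≤-trans gt (label≤ (site q))

  nonempty-ok : ∀ i → Sem (nonempty t i) (∃ λ v → v ∈ π × label v ≡ i)
  nonempty-ok zero = nonempty₀-ok
  nonempty-ok (suc i) with suc i ≤? size t
  ... | yes i< = site i , full p (site< i<) , label-site i<
  ... | no  i≮ = λ (v , _ , eq) → i≮ (subst (_≤ size t) eq (label≤ v))

  site-≤ : ∀ {q r} → q ≤ r → r < size t → site q ≤ site r
  site-≤ {q} {r} q≤r r< with m≤n⇒m<n∨m≡n q≤r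
  ... | inj₁ lt   = <⇒≤ (site-mono lt r<)
  ... | inj₂ refl = ≤-refl

  <site⇒ : ∀ {q v} → q < size t → v < site q → label v ≤ q
  <site⇒ q< lt = ≮⇒≥ (λ gt → <⇒≱ lt (site≤⇐ q< gt))

  <site⇐ : ∀ {q v} → q < size t → label v ≤ q → v < site q
  <site⇐ q< le = ≰⇒> (λ ge → <⇒≱ (site≤⇒ q< ge) le)

-- `KillLo` compares `x` and `y` with the two sites only, so the blocks of `x` and `y` decide it.
-- The two summands are `byAsc` and `byDsc`.
killLo : Table → ℕ → ℕ → Verdict
killLo t r q = ors (suc (size t)) λ i → ors (suc (size t)) λ j →
  guard (q <? i) (guard (i ≤? r) (guard (r <? j) (asc t i j)))
  ∨ guard (i ≤? q) (guard (r <? j) (dsc t i j))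

killHi : Table → ℕ → ℕ → Verdict
killHi t r q = ors (suc (size t)) λ i → ors (suc (size t)) λ j →
  -- An increasing pair always has `i ≤ j`. The middle guard makes the impossible entries `fails`;
  -- the specifications would leave them `unknown` and spoil the disjunction.
  guard (r <? i) (guard (i ≤? j) (guard (j ≤? q) (asc t i j)))

module _ {E : ℕ → Set} {t : Table} {n : ℕ} {π : List ℕ} (p : Perm n π) (F : Fits E t n π) {r : ℕ} (r< : r < size t) where
  open Fits F
  open FitsProperties p F

  killLo-ok : ∀ {q} → q < size t → Sem (killLo t r q) (KillLo (site r) (site q) π)
  killLo-ok {q} q< = sem-map (killLo t r q) to from
    (sem-ors _ _ λ i → sem-ors _ _ λ j → sem-∨ _ (guard (i ≤? q) _)
      (sem-guard (q <? i) _ (sem-guard (i ≤? r) _ (sem-guard (r <? j) (asc t i j) (asc-ok i j))))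
      (sem-guard (i ≤? q) _ (sem-guard (r <? j) (dsc t i j) (dsc-ok i j))))
    where
    to : _ → KillLo (site r) (site q) π
    to (i , _ , j , _ , inj₁ (q<i , i≤r , r<j , x , y , a , refl , refl)) =
      byAsc a (site≤⇐ q< q<i) (<site⇐ r< i≤r) (site≤⇐ r< r<j)
    to (i , _ , j , _ , inj₂ (i≤q , r<j , x , y , d , refl , refl)) =
      byDsc d (<site⇐ q< i≤q) (site≤⇐ r< r<j)
    from : KillLo (site r) (site q) π → _
    from (byAsc {x} {y} a l m h) = label x , s≤s (label≤ x) , label y , s≤s (label≤ y) ,
      inj₁ (site≤⇒ q< l , <site⇒ r< m , site≤⇒ r< h , x , y , a , refl , refl)
    from (byDsc {x} {y} d l h) = label x , s≤s (label≤ x) , label y , s≤s (label≤ y) ,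
      inj₂ (<site⇒ q< l , site≤⇒ r< h , x , y , d , refl , refl)

  killHi-ok : ∀ {q} → q < size t → Sem (killHi t r q) (KillHi (site r) (site q) π)
  killHi-ok {q} q< = sem-map (killHi t r q) to from
    (sem-ors _ _ λ i → sem-ors _ _ λ j →
      sem-guard (r <? i) _ (sem-guard (i ≤? j) _ (sem-guard (j ≤? q) (asc t i j) (asc-ok i j))))
    where
    to : _ → KillHi (site r) (site q) π
    to (i , _ , j , _ , r<i , _ , j≤q , x , y , a , refl , refl) =
      byAsc a (site≤⇐ r< r<i) (<site⇐ q< j≤q)
    from : KillHi (site r) (site q) π → _
    from (byAsc {x} {y} a l h) = label x , s≤s (label≤ x) , label y , s≤s (label≤ y) ,
      site≤⇒ r< l , label-mono (<⇒≤ (proj₁ a)) , <site⇒ q< h , x , y , a , refl , refl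

-- The new value `s` gets block `suc r` to itself, between the sites `s` and `suc s` into which the
-- old site splits; `pinch (suc r)` leads from the other blocks back to the old ones. New pairs join
-- block `suc r` to nonempty blocks, higher ones in `asc` and lower ones in `dsc`.
insert : ℕ → Table → Table
insert r t .size = suc (size t)
insert r t .asc i j =
  guard (¬? (i ≟ suc r)) (guard (¬? (j ≟ suc r)) (asc t (pinch (suc r) i) (pinch (suc r) j)))
  ∨ guard (i ≟ suc r) (guard (suc r <? j) (nonempty t (pinch (suc r) j)))
insert r t .dsc i j =
  guard (¬? (i ≟ suc r)) (guard (¬? (j ≟ suc r)) (dsc t (pinch (suc r) i) (pinch (suc r) j)))
  ∨ guard (j ≟ suc r) (guard (i <? suc r) (nonempty t (pinch (suc r) i)))
insert r t .nonempty₀ = nonempty₀ t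
-- The old site `r` is examined twice: as site `r` against `killLo`, and as site `suc r` against
-- `killHi`.
insert r t .siteDead q with q ≤? r
... | yes _ = siteDead t q ∨ killLo t r q
... | no _  = siteDead t (pred q) ∨ killHi t r (pred q)

data PinchView (s : ℕ) : ℕ → Set where
  at  : PinchView s s
  off : ∀ v → PinchView s (bump s v)

pinchView : ∀ s w → PinchView s w
pinchView s w with w ≟ s
... | yes refl = at
... | no w≢s   = subst (PinchView s) (bump-pinch s w≢s) (off (pinch s w))

-- The last hypothesis says that the new entry kills every exempt site, so the new table lists all
-- live sites and its exemption is empty.
insert-ok : ∀ {E t n π} → Perm n π → (F : Fits E t n π) → ∀ {r} → r < size t →
            (∀ {a} → E a → Fits.site F r ≤ a × KillHi (Fits.site F r) a π) →
            Fits (const ⊥) (insert r t) (suc n) (ext (Fits.site F r) π)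
insert-ok {E} {t} {n} {π} p F {r} r< killed = record
  { label = label′ ; site = site′
  ; site≤⇒ = λ {q} {v} → to q v ; site≤⇐ = λ {q} {v} → from q v ; label≤ = lab≤ ; site< = λ {q} → s< q ; site-mono = λ {q} {q′} → mono q q′
  ; asc-ok = ascOk ; dsc-ok = dscOk ; nonempty₀-ok = neOk
  ; dead-ok = λ {q} → deadOk q ; others = oth }
  where
  open Fits F
  open FitsProperties p F
  s = site r

  label′ : ℕ → ℕ
  label′ w with w ≟ s
  ... | yes _ = suc r
  ... | no _  = bump (suc r) (label (pinch s w))

  site′ : ℕ → ℕ
  site′ q with q ≤? r
  ... | yes _ = site q
  ... | no _  = suc (site (pred q))

  label-at : label′ s ≡ suc r
  label-at with s ≟ s
  ... | yes _ = refl
  ... | no ¬e = ⊥-elim (¬e refl)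

  label-off : ∀ v → label′ (bump s v) ≡ bump (suc r) (label v)
  label-off v with bump s v ≟ s
  ... | yes e = ⊥-elim (bump-≢ s e)
  ... | no _  = cong (bump (suc r) ∘ label) (pinch-bump s v)

  label-hi : ∀ {v} → s ≤ v → bump (suc r) (label v) ≡ suc (label v)
  label-hi s≤v = bump-≥ (site≤⇒ r< s≤v)

  q<size : ∀ {q} → q ≤ r → q < size t
  q<size q≤r = ≤-<-trans q≤r r<

  to : ∀ q w → q < suc (size t) → site′ q ≤ w → q < label′ w
  to q w q< le with q ≤? r | pinchView s w
  ... | yes q≤r | at = subst (q <_) (sym label-at) (s≤s q≤r)
  ... | yes q≤r | off v rewrite label-off v with bumpView s v
  ...   | below _ eq = <-≤-trans (site≤⇒ (q<size q≤r) (subst (site q ≤_) eq le)) (≤bump (suc r) (label v))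
  ...   | above s≤v _ = <-≤-trans (≤-<-trans q≤r (site≤⇒ r< s≤v)) (≤bump (suc r) (label v))
  to zero w q< le | no q≰r | _ = ⊥-elim (q≰r z≤n)
  to (suc q) w (s≤s q<) le | no q≰r | at = ⊥-elim (<⇒≱ le (site-≤ (≤-pred (≰⇒> q≰r)) q<))
  to (suc q) w (s≤s q<) le | no q≰r | off v rewrite label-off v with bumpView s v
  ... | below v<s eq = ⊥-elim (<⇒≱ (≤-<-trans (subst (suc (site q) ≤_) eq le) v<s)
                                    (m≤n⇒m≤1+n (site-≤ (≤-pred (≰⇒> q≰r)) q<)))
  ... | above s≤v eq = subst (suc q <_) (sym (label-hi s≤v)) (s≤s (site≤⇒ q< (≤-pred (subst (suc (site q) ≤_) eq le))))

  from : ∀ q w → q < suc (size t) → q < label′ w → site′ q ≤ w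
  from q w q< lt with q ≤? r | pinchView s w
  ... | yes q≤r | at = site-≤ q≤r r<
  ... | yes q≤r | off v rewrite label-off v with bumpView (suc r) (label v)
  ...   | below _ eq  = ≤-trans (site≤⇐ (q<size q≤r) (subst (q <_) eq lt)) (≤bump s v)
  ...   | above r<l _ = ≤-trans (site-≤ q≤r r<) (≤-trans (site≤⇐ r< r<l) (≤bump s v))
  from zero w q< lt | no q≰r | _ = ⊥-elim (q≰r z≤n)
  from (suc q) w (s≤s q<) lt | no q≰r | at = ⊥-elim (q≰r (≤-pred (subst (suc q <_) label-at lt)))
  from (suc q) w (s≤s q<) lt | no q≰r | off v rewrite label-off v with bumpView (suc r) (label v)
  ... | below l≤r eq = ⊥-elim (q≰r (≤-pred (<-trans (subst (suc q <_) eq lt) l≤r)))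
  ... | above r<l eq = ≤⇒<bump-site (site≤⇐ q< (≤-pred (subst (suc q <_) eq lt)))
    where
    ≤⇒<bump-site : site q ≤ v → suc (site q) ≤ bump s v
    ≤⇒<bump-site le = subst (suc (site q) ≤_) (sym (bump-≥ (site≤⇐ r< r<l))) (s≤s le)

  lab≤ : ∀ w → label′ w ≤ suc (size t)
  lab≤ w with pinchView s w
  ... | at = subst (_≤ _) (sym label-at) (s≤s (<⇒≤ r<))
  ... | off v = subst (_≤ _) (sym (label-off v)) (≤-pred (bump-<-suc (suc r) (s≤s (label≤ v))))

  s< : ∀ q → q < suc (size t) → site′ q < suc n
  s< q q< with q ≤? r
  ... | yes q≤r = m<n⇒m<1+n (site< (q<size q≤r))
  s< zero    _        | no q≰r = ⊥-elim (q≰r z≤n)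
  s< (suc q) (s≤s q<) | no _   = s≤s (site< q<)

  mono : ∀ a b → a < b → b < suc (size t) → site′ a < site′ b
  mono a zero ()
  mono a (suc b) a<b (s≤s b<) with a ≤? r | suc b ≤? r
  ... | yes _ | yes b≤r = site-mono a<b (q<size b≤r)
  ... | yes a≤r | no _ = s≤s (site-≤ (≤-pred a<b) b<)
  ... | no a≰r | yes b≤r = ⊥-elim (a≰r (≤-trans (<⇒≤ a<b) b≤r))
  mono zero    (suc b) _         (s≤s _)  | no a≰r | no _ = ⊥-elim (a≰r z≤n)
  mono (suc a) (suc b) (s≤s a<b) (s≤s b<) | no _   | no _ = s≤s (site-mono a<b b<)

  unlabel : ∀ {v i} → label′ (bump s v) ≡ i → i ≢ suc r × label v ≡ pinch (suc r) i
  unlabel {v} refl rewrite label-off v = bump-≢ (suc r) , sym (pinch-bump (suc r) (label v))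

  relabel : ∀ {v i} → i ≢ suc r → label v ≡ pinch (suc r) i → label′ (bump s v) ≡ i
  relabel {v} {i} i≢ eq rewrite label-off v | eq = bump-pinch (suc r) i≢

  ascOk : ∀ i j → Sem (asc (insert r t) i j) (∃₂ λ x y → Asc (ext s π) x y × label′ x ≡ i × label′ y ≡ j)
  ascOk i j = sem-map (asc (insert r t) i j) f g (sem-∨ _ (guard (i ≟ suc r) _)
    (sem-guard (¬? (i ≟ suc r)) _ (sem-guard (¬? (j ≟ suc r)) (asc t _ _) (asc-ok _ _)))
    (sem-guard (i ≟ suc r) _ (sem-guard (suc r <? j) (nonempty t (pinch (suc r) j)) (nonempty-ok _))))
    where
    f : _ → ∃₂ λ x y → Asc (ext s π) x y × label′ x ≡ i × label′ y ≡ j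
    f (inj₁ (i≢ , j≢ , x , y , a , eqx , eqy)) = _ , _ , asc-old a , relabel i≢ eqx , relabel j≢ eqy
    f (inj₂ (refl , lt , v , v∈ , eq)) = s , suc v , asc-new v∈ s≤v , label-at ,
      subst (λ w → label′ w ≡ j) (bump-≥ s≤v) (relabel (>⇒≢ lt) eq)
      where
      s≤v : s ≤ v
      s≤v = site≤⇐ r< (subst (r <_) (sym eq) (bump<⇒<pinch (suc r) (subst (_< j) (sym (bump-< ≤-refl)) (<-trans ≤-refl lt))))
    g : (∃₂ λ x y → Asc (ext s π) x y × label′ x ≡ i × label′ y ≡ j) → _
    g (_ , _ , a′ , eqx , eqy) with asc-ext⁻ a′
    ... | old {x} {y} a = inj₁ (proj₁ (unlabel eqx) , proj₁ (unlabel eqy) , x , y , a , proj₂ (unlabel eqx) , proj₂ (unlabel eqy))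
    ... | new {y} y∈ s≤y = inj₂ (trans (sym eqx) label-at , subst (suc r <_) eq′ (s≤s (site≤⇒ r< s≤y)) , y , y∈ , proj₂ (unlabel eqy′))
      where
      eqy′ : label′ (bump s y) ≡ j
      eqy′ = subst (λ w → label′ w ≡ j) (sym (bump-≥ s≤y)) eqy
      eq′ : suc (label y) ≡ j
      eq′ = trans (sym (label-hi s≤y)) (trans (sym (label-off y)) eqy′)

  dscOk : ∀ i j → Sem (dsc (insert r t) i j) (∃₂ λ x y → Dsc (ext s π) x y × label′ x ≡ i × label′ y ≡ j)
  dscOk i j = sem-map (dsc (insert r t) i j) f g (sem-∨ _ (guard (j ≟ suc r) _)
    (sem-guard (¬? (i ≟ suc r)) _ (sem-guard (¬? (j ≟ suc r)) (dsc t _ _) (dsc-ok _ _)))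
    (sem-guard (j ≟ suc r) _ (sem-guard (i <? suc r) (nonempty t (pinch (suc r) i)) (nonempty-ok _))))
    where
    f : _ → ∃₂ λ x y → Dsc (ext s π) x y × label′ x ≡ i × label′ y ≡ j
    f (inj₁ (i≢ , j≢ , x , y , a , eqx , eqy)) = _ , _ , dsc-old a , relabel i≢ eqx , relabel j≢ eqy
    f (inj₂ (refl , lt , v , v∈ , eq)) = v , s , dsc-new v∈ v<s ,
      subst (λ w → label′ w ≡ i) (bump-< v<s) (relabel (<⇒≢ lt) eq) , label-at
      where
      v<s : v < s
      v<s = <site⇐ r< (subst (_≤ r) (sym (trans eq (pinch-≤-id (<⇒≤ lt)))) (≤-pred lt))
    g : (∃₂ λ x y → Dsc (ext s π) x y × label′ x ≡ i × label′ y ≡ j) → _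
    g (_ , _ , a′ , eqx , eqy) with dsc-ext⁻ a′
    ... | old {x} {y} a = inj₁ (proj₁ (unlabel eqx) , proj₁ (unlabel eqy) , x , y , a , proj₂ (unlabel eqx) , proj₂ (unlabel eqy))
    ... | new {x} x∈ x<s = inj₂ (trans (sym eqy) label-at , subst (_< suc r) eq′ (s≤s (<site⇒ r< x<s)) , x , x∈ , proj₂ (unlabel eqx′))
      where
      eqx′ : label′ (bump s x) ≡ i
      eqx′ = subst (λ w → label′ w ≡ i) (sym (bump-< x<s)) eqx
      eq′ : label x ≡ i
      eq′ = trans (sym (bump-< (s≤s (<site⇒ r< x<s)))) (trans (sym (label-off x)) eqx′)

  neOk : Sem (nonempty₀ t) (∃ λ w → w ∈ ext s π × label′ w ≡ 0)
  neOk = sem-map (nonempty₀ t) f g nonempty₀-ok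
    where
    f : (∃ λ v → v ∈ π × label v ≡ 0) → ∃ λ w → w ∈ ext s π × label′ w ≡ 0
    f (v , v∈ , eq) = bump s v , there (∈-map⁺ (bump s) v∈) , trans (label-off v) (cong (bump (suc r)) eq)
    g : (∃ λ w → w ∈ ext s π × label′ w ≡ 0) → ∃ λ v → v ∈ π × label v ≡ 0
    g (_ , here refl , eq) with trans (sym label-at) eq
    ... | ()
    g (_ , there w∈ , eq) with ∈-map⁻ (bump s) w∈
    ... | v , v∈ , refl = v , v∈ , proj₂ (unlabel eq)

  deadOk : ∀ q → q < suc (size t) → Sem (siteDead (insert r t) q) (Dead (site′ q) (ext s π))
  deadOk q q< with q ≤? r
  ... | yes q≤r = sem-map (siteDead t q ∨ killLo t r q) [ deadLo-old le , deadLo-new le ]′ (deadLo⁻ le)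
                    (sem-∨ (siteDead t q) (killLo t r q) (dead-ok (q<size q≤r)) (killLo-ok p F r< (q<size q≤r)))
    where le = site-≤ q≤r r<
  deadOk zero q< | no q≰r = ⊥-elim (q≰r z≤n)
  deadOk (suc q) (s≤s q<) | no q≰r = sem-map (siteDead t q ∨ killHi t r q) [ deadHi-old le , deadHi-new le ]′ (deadHi⁻ le)
                    (sem-∨ (siteDead t q) (killHi t r q) (dead-ok q<) (killHi-ok p F r< q<))
    where le = site-≤ (≤-pred (≰⇒> q≰r)) q<

  site′-lo : ∀ {q} → q ≤ r → site′ q ≡ site q
  site′-lo {q} q≤r with q ≤? r
  ... | yes _  = refl
  ... | no q≰r = ⊥-elim (q≰r q≤r)

  site′-hi : ∀ {q} → r ≤ q → site′ (suc q) ≡ suc (site q)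
  site′-hi {q} r≤q with suc q ≤? r
  ... | yes q<r = ⊥-elim (<⇒≱ q<r r≤q)
  ... | no _    = refl

  oth : ∀ {a} → a ≤ suc n → (∃ λ q → q < suc (size t) × site′ q ≡ a) ⊎ Dead a (ext s π) ⊎ ⊥
  oth {a} a≤ with <-≤-connex s a
  oth {a} a≤ | inj₂ a≤s with others (≤-trans a≤s (<⇒≤ (site< r<)))
  ... | inj₂ (inj₁ d) = inj₂ (inj₁ (deadLo-old a≤s d))
  ... | inj₂ (inj₂ e) = inj₁ (r , m<n⇒m<1+n r< , trans (site′-lo ≤-refl) (≤-antisym (proj₁ (killed e)) a≤s))
  ... | inj₁ (q , q< , refl) with q ≤? r
  ...   | yes q≤r = inj₁ (q , m<n⇒m<1+n q< , site′-lo q≤r)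
  ...   | no q≰r  = inj₁ (r , m<n⇒m<1+n r< , trans (site′-lo ≤-refl) (≤-antisym (site-≤ (<⇒≤ (≰⇒> q≰r)) q<) a≤s))
  oth {suc a} (s≤s a≤) | inj₁ (s≤s s≤a) with others a≤
  ... | inj₂ (inj₁ d) = inj₂ (inj₁ (deadHi-old s≤a d))
  ... | inj₂ (inj₂ e) = inj₂ (inj₁ (deadHi-new s≤a (proj₂ (killed e))))
  ... | inj₁ (q , q< , refl) with r ≤? q
  ...   | yes r≤q = inj₁ (suc q , s≤s q< , site′-hi r≤q)
  ...   | no r≰q  = inj₁ (suc r , s≤s r< , trans (site′-hi ≤-refl) (cong suc (≤-antisym s≤a (site-≤ (<⇒≤ (≰⇒> r≰q)) r<))))

-- `bump (suc d) i` and `bump d i` are the preimages of `i` under `pinch d`: the blocks `d` and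
-- `suc d` when `i` is `d`, and one block named twice otherwise.
merge : ℕ → (ℕ → ℕ → Verdict) → ℕ → ℕ → Verdict
merge d f i j = (f (bump (suc d) i) (bump (suc d) j) ∨ f (bump (suc d) i) (bump d j))
              ∨ (f (bump d i) (bump (suc d) j) ∨ f (bump d i) (bump d j))

drop : ℕ → Table → Table
drop d t .size = pred (size t)
drop d t .asc = merge d (asc t)
drop d t .dsc = merge d (dsc t)
drop d t .nonempty₀ = nonempty t (bump (suc d) 0) ∨ nonempty t (bump d 0)
drop d t .siteDead q = siteDead t (bump d q)

drop-ok : ∀ {t n π} → Perm n π → Fits (const ⊥) t n π → ∀ {d} → d < size t → siteDead t d ≡ holds →
          Fits (const ⊥) (drop d t) n π
drop-ok {t} {n} {π} p F {d} d< isDead = go refl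
  where
  open Fits F
  open FitsProperties p F

  Blocks : (ℕ → ℕ → Set) → (ℕ → ℕ) → ℕ → ℕ → Set
  Blocks R ℓ i j = ∃₂ λ x y → R x y × ℓ x ≡ i × ℓ y ≡ j

  merge-ok : ∀ (f : ℕ → ℕ → Verdict) {R : ℕ → ℕ → Set} → (∀ i j → Sem (f i j) (Blocks R label i j)) →
             ∀ i j → Sem (merge d f i j) (Blocks R (pinch d ∘ label) i j)
  merge-ok f {R} ok i j = sem-map (merge d f i j) to from
    (sem-∨ (f i₀ j₀ ∨ f i₀ j₁) (f i₁ j₀ ∨ f i₁ j₁)
      (sem-∨ (f i₀ j₀) (f i₀ j₁) (ok i₀ j₀) (ok i₀ j₁)) (sem-∨ (f i₁ j₀) (f i₁ j₁) (ok i₁ j₀) (ok i₁ j₁)))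
    where
    i₀ = bump (suc d) i
    i₁ = bump d i
    j₀ = bump (suc d) j
    j₁ = bump d j
    lower : ∀ {v i} → label v ≡ bump (suc d) i → pinch d (label v) ≡ i
    lower eq = trans (cong (pinch d) eq) (pinch-bump-suc d _)
    upper : ∀ {v i} → label v ≡ bump d i → pinch d (label v) ≡ i
    upper eq = trans (cong (pinch d) eq) (pinch-bump d _)
    to : _ → Blocks R (pinch d ∘ label) i j
    to (inj₁ (inj₁ (x , y , a , eqx , eqy))) = x , y , a , lower eqx , lower eqy
    to (inj₁ (inj₂ (x , y , a , eqx , eqy))) = x , y , a , lower eqx , upper eqy
    to (inj₂ (inj₁ (x , y , a , eqx , eqy))) = x , y , a , upper eqx , lower eqy
    to (inj₂ (inj₂ (x , y , a , eqx , eqy))) = x , y , a , upper eqx , upper eqy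
    from : Blocks R (pinch d ∘ label) i j → _
    from (x , y , a , refl , refl) with pinch⁻ d (label x) | pinch⁻ d (label y)
    ... | inj₁ eqx | inj₁ eqy = inj₁ (inj₁ (x , y , a , eqx , eqy))
    ... | inj₁ eqx | inj₂ eqy = inj₁ (inj₂ (x , y , a , eqx , eqy))
    ... | inj₂ eqx | inj₁ eqy = inj₂ (inj₁ (x , y , a , eqx , eqy))
    ... | inj₂ eqx | inj₂ eqy = inj₂ (inj₂ (x , y , a , eqx , eqy))

  ne : Sem (nonempty₀ (drop d t)) (∃ λ v → v ∈ π × pinch d (label v) ≡ 0)
  ne = sem-map (nonempty₀ (drop d t)) to from (sem-∨ (nonempty t (bump (suc d) 0)) (nonempty t (bump d 0)) (nonempty-ok _) (nonempty-ok _))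
    where
    to : _ → ∃ λ v → v ∈ π × pinch d (label v) ≡ 0
    to (inj₁ (v , v∈ , eq)) = v , v∈ , trans (cong (pinch d) eq) (pinch-bump-suc d 0)
    to (inj₂ (v , v∈ , eq)) = v , v∈ , trans (cong (pinch d) eq) (pinch-bump d 0)
    from : (∃ λ v → v ∈ π × pinch d (label v) ≡ 0) → _
    from (v , v∈ , eq) with pinch⁻ d (label v)
    ... | inj₁ eq′ = inj₁ (v , v∈ , trans eq′ (cong (bump (suc d)) eq))
    ... | inj₂ eq′ = inj₂ (v , v∈ , trans eq′ (cong (bump d) eq))

  bump-mono-≤ : ∀ {k} → size t ≡ suc k → ∀ {q} → q < k → bump d q < size t
  bump-mono-≤ eq q< rewrite eq = bump-<-suc d q<

  go : ∀ {k} → size t ≡ k → Fits (const ⊥) (drop d t) n π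
  go {zero}  eq = ⊥-elim (n≮0 (subst (d <_) eq d<))
  go {suc k} eq = record
    { label = pinch d ∘ label ; site = site ∘ bump d
    ; site≤⇒ = λ q< le → bump<⇒<pinch d (site≤⇒ (bnd q<) le)
    ; site≤⇐ = λ q< lt → site≤⇐ (bnd q<) (<pinch⇒bump< d lt)
    ; label≤ = λ v → subst (pinch d (label v) ≤_) (cong pred (sym eq))
                       (pinch-≤ d d≤k (subst (label v ≤_) eq (label≤ v)))
    ; site< = λ q< → site< (bnd q<)
    ; site-mono = λ lt q< → site-mono (bump-mono-< d lt) (bnd q<)
    ; asc-ok = merge-ok (asc t) asc-ok ; dsc-ok = merge-ok (dsc t) dsc-ok ; nonempty₀-ok = ne
    ; dead-ok = λ q< → dead-ok (bnd q<)
    ; others = oth }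
    where
    d≤k : d ≤ k
    d≤k = ≤-pred (subst (d <_) eq d<)
    bnd : ∀ {q} → q < pred (size t) → bump d q < size t
    bnd q< = bump-mono-≤ eq (subst (_ <_) (cong pred eq) q<)
    oth : ∀ {a} → a ≤ n → (∃ λ q → q < pred (size t) × site (bump d q) ≡ a) ⊎ Dead a π ⊎ ⊥
    oth a≤ with others a≤
    ... | inj₂ e = inj₂ e
    ... | inj₁ (q , q< , refl) with q ≟ d
    ...   | yes refl = inj₂ (inj₁ (subst (λ v → Sem v (Dead (site d) π)) isDead (dead-ok d<)))
    ...   | no q≢d   = inj₁ (pinch d q , subst (pinch d q <_) (cong pred (sym eq)) (pinch-< d d≤k (subst (q <_) eq q<) q≢d) ,
                              cong site (bump-pinch d q≢d))

dropIf : ℕ → Table → Verdict → Table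
dropIf d t holds = drop d t
dropIf d t fails = t
dropIf d t unknown = t

-- The order is from the highest site down, so that dropping a site does not renumber those still to
-- be examined.
sweep : ℕ → Table → Table
sweep zero    t = t
sweep (suc d) t = sweep d (dropIf d t (siteDead t d))

sweep-ok : ∀ {t n π} → Perm n π → ∀ d → d ≤ size t → Fits (const ⊥) t n π → Fits (const ⊥) (sweep d t) n π
sweep-ok p zero    _  F = F
sweep-ok {t} p (suc d) d< F with siteDead t d in eq
... | holds = sweep-ok p d (≤-pred-≤ d<) (drop-ok p F d< eq)
  where
  ≤-pred-≤ : ∀ {m} → d < m → d ≤ pred m
  ≤-pred-≤ (s≤s le) = le
... | fails = sweep-ok p d (<⇒≤ d<) F
... | unknown = sweep-ok p d (<⇒≤ d<) F

next : Table → ℕ → Table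
next t r = sweep (suc (size t)) (insert r t)

next-ok : ∀ {E t n π} → Perm n π → (F : Fits E t n π) → ∀ {r} → r < size t →
          (∀ {a} → E a → Fits.site F r ≤ a × KillHi (Fits.site F r) a π) →
          Fits (const ⊥) (next t r) (suc n) (ext (Fits.site F r) π)
next-ok p F r< killed = sweep-ok (perm-ext (<⇒≤ (Fits.site< F r<)) p) _ ≤-refl (insert-ok p F r< killed)

-- Finite specifications and the eight classes containing 123

Pairs : Set
Pairs = List (ℕ × ℕ)

known : Pairs → Pairs → ℕ → ℕ → Verdict
known ys ns i j with (i , j) ∈? ys | (i , j) ∈? ns
... | yes _ | _     = holds
... | no _  | yes _ = fails
... | no _  | no _  = unknown

record Spec : Set where
  constructor spec
  field
    sites : ℕ
    asc⁺ asc⁻ dsc⁺ dsc⁻ : Pairs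
    first : Verdict

toTable : Spec → Table
toTable (spec k a⁺ a⁻ d⁺ d⁻ f) = table k (known a⁺ a⁻) (known d⁺ d⁻) f (const fails)

Refines : (ℕ → ℕ → Verdict) → Pairs → Pairs → Set
Refines f ys ns = All (λ (i , j) → f i j ≡ holds) ys × All (λ (i , j) → f i j ≡ fails) ns

-- Only listed entries are compared, which makes this decidable although a table is a function on
-- all pairs of blocks.
Matches : Table → Spec → Set
Matches t (spec k a⁺ a⁻ d⁺ d⁻ f) =
  size t ≡ k × Refines (asc t) a⁺ a⁻ × Refines (dsc t) d⁺ d⁻ × nonempty₀ t ≡ f × All (λ q → siteDead t q ≡ fails) (upTo k)

_≟ᵛ_ : DecidableEquality Verdict
holds ≟ᵛ holds = yes refl
holds ≟ᵛ fails = no λ ()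
holds ≟ᵛ unknown = no λ ()
fails ≟ᵛ holds = no λ ()
fails ≟ᵛ fails = yes refl
fails ≟ᵛ unknown = no λ ()
unknown ≟ᵛ holds = no λ ()
unknown ≟ᵛ fails = no λ ()
unknown ≟ᵛ unknown = yes refl

refines? : ∀ f ys ns → Dec (Refines f ys ns)
refines? f ys ns = All.all? (λ (i , j) → f i j ≟ᵛ holds) ys ×-dec All.all? (λ (i , j) → f i j ≟ᵛ fails) ns

matches? : ∀ t σ → Dec (Matches t σ)
matches? t (spec k a⁺ a⁻ d⁺ d⁻ f) =
  size t ≟ k ×-dec refines? (asc t) a⁺ a⁻ ×-dec refines? (dsc t) d⁺ d⁻ ×-dec nonempty₀ t ≟ᵛ f
  ×-dec All.all? (λ q → siteDead t q ≟ᵛ fails) (upTo k)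

refines-ok : ∀ {f : ℕ → ℕ → Verdict} {P : ℕ → ℕ → Set} ys ns → Refines f ys ns → (∀ i j → Sem (f i j) (P i j)) →
             ∀ i j → Sem (known ys ns i j) (P i j)
refines-ok {f} {P} ys ns (ry , rn) ok i j with (i , j) ∈? ys | (i , j) ∈? ns
... | yes m | _     = subst (λ v → Sem v (P i j)) (All.lookup ry m) (ok i j)
... | no _  | yes m = subst (λ v → Sem v (P i j)) (All.lookup rn m) (ok i j)
... | no _  | no _  = tt

matches-ok : ∀ {t n π} σ → Matches t σ → Fits (const ⊥) t n π → Fits (const ⊥) (toTable σ) n π
matches-ok {t} {n} {π} (spec k a⁺ a⁻ d⁺ d⁻ f) (refl , ra , rd , refl , rdead) F = record
  { label = label ; site = site ; site≤⇒ = site≤⇒ ; site≤⇐ = site≤⇐ ; label≤ = label≤ ; site< = site<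
  ; site-mono = site-mono ; asc-ok = refines-ok a⁺ a⁻ ra asc-ok ; dsc-ok = refines-ok d⁺ d⁻ rd dsc-ok
  ; nonempty₀-ok = nonempty₀-ok
  ; dead-ok = λ {q} q< → subst (λ v → Sem v (Dead (site q) π)) (All.lookup rdead (∈-upTo⁺ q<)) (dead-ok q<)
  ; others = others }
  where open Fits F

-- Representatives of the classes: 012, 1023, 2013, 0312, 14203, 10423, 20413, 03412.  Increasing pairs that
-- start in block 0 or lie in the last block can never kill a site, so the specifications leave them out.
data Class : Set where
  k₀ k₁ k₂ k₃ k₄ k₅ k₆ k₇ : Class

-- Decreasing pairs inside one block are absent too: to kill a site, `byDsc` needs them in blocks
-- `i ≤ q ≤ r < j`.
classSpec : Class → Spec
classSpec k₀ = spec 3 ((1 , 2) ∷ (1 , 3) ∷ (2 , 3) ∷ []) ((1 , 1) ∷ (2 , 2) ∷ []) [] ((0 , 1) ∷ (0 , 2) ∷ (0 , 3) ∷ (1 , 2) ∷ (1 , 3) ∷ (2 , 3) ∷ []) fails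
classSpec k₁ = spec 3 ((1 , 2) ∷ (1 , 3) ∷ (2 , 3) ∷ []) ((1 , 1) ∷ (2 , 2) ∷ []) ((0 , 1) ∷ []) ((0 , 2) ∷ (0 , 3) ∷ (1 , 2) ∷ (1 , 3) ∷ (2 , 3) ∷ []) holds
classSpec k₂ = spec 2 ((1 , 2) ∷ []) ((1 , 1) ∷ []) ((0 , 1) ∷ []) ((0 , 2) ∷ (1 , 2) ∷ []) holds
classSpec k₃ = spec 3 ((1 , 2) ∷ (1 , 3) ∷ (2 , 3) ∷ []) ((1 , 1) ∷ (2 , 2) ∷ []) ((2 , 3) ∷ []) ((0 , 1) ∷ (0 , 2) ∷ (0 , 3) ∷ (1 , 2) ∷ (1 , 3) ∷ []) fails
classSpec k₄ = spec 2 ((1 , 2) ∷ []) ((1 , 1) ∷ []) ((0 , 1) ∷ (1 , 2) ∷ []) [] holds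
classSpec k₅ = spec 3 ((1 , 2) ∷ (1 , 3) ∷ (2 , 3) ∷ []) ((1 , 1) ∷ (2 , 2) ∷ []) ((0 , 1) ∷ (2 , 3) ∷ []) ((0 , 2) ∷ (0 , 3) ∷ (1 , 2) ∷ (1 , 3) ∷ []) holds
classSpec k₆ = spec 1 [] [] ((0 , 1) ∷ []) [] holds
classSpec k₇ = spec 2 ((1 , 2) ∷ []) ((1 , 1) ∷ []) [] ((0 , 1) ∷ (0 , 2) ∷ (1 , 2) ∷ []) fails

classKids : Class → List Class
classKids k₀ = k₀ ∷ k₁ ∷ k₂ ∷ []
classKids k₁ = k₂ ∷ k₁ ∷ k₂ ∷ []
classKids k₂ = k₂ ∷ k₂ ∷ []
classKids k₃ = k₀ ∷ k₅ ∷ k₆ ∷ []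
classKids k₄ = k₄ ∷ k₆ ∷ []
classKids k₅ = k₂ ∷ k₅ ∷ k₆ ∷ []
classKids k₆ = k₆ ∷ []
classKids k₇ = k₀ ∷ k₂ ∷ []

KidsMatch : Class → Set
KidsMatch c = Pointwise (λ r c′ → Matches (next (toTable (classSpec c)) r) (classSpec c′))
                        (upTo (Spec.sites (classSpec c))) (classKids c)

kidsMatch? : ∀ c → Dec (KidsMatch c)
kidsMatch? c = Pointwise.decidable (λ r c′ → matches? _ (classSpec c′)) _ _

-- Each transition is run on a closed table during type checking. That every required verdict comes
-- out definite confirms that the omitted entries have no influence.
kidsMatch : ∀ c → KidsMatch c
kidsMatch k₀ = from-yes (kidsMatch? k₀)
kidsMatch k₁ = from-yes (kidsMatch? k₁)
kidsMatch k₂ = from-yes (kidsMatch? k₂)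
kidsMatch k₃ = from-yes (kidsMatch? k₃)
kidsMatch k₄ = from-yes (kidsMatch? k₄)
kidsMatch k₅ = from-yes (kidsMatch? k₅)
kidsMatch k₆ = from-yes (kidsMatch? k₆)
kidsMatch k₇ = from-yes (kidsMatch? k₇)

module _ {n π} (p : Perm n π) where

  asc-<ˡ : ∀ {x y} → Asc π x y → x < n
  asc-<ˡ = bound p ∘ asc-∈ˡ

  asc-<ʳ : ∀ {x y} → Asc π x y → y < n
  asc-<ʳ = bound p ∘ asc-∈ʳ

  dsc-<ˡ : ∀ {x y} → Dsc π x y → x < n
  dsc-<ˡ = bound p ∘ dsc-∈ˡ

  dsc-<ʳ : ∀ {x y} → Dsc π x y → y < n
  dsc-<ʳ = bound p ∘ dsc-∈ʳ

  asc-top : ∀ {x y} → Asc π x y → Asc (ext n π) x y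
  asc-top a = subst₂ (Asc _) (bump-< (asc-<ˡ a)) (bump-< (asc-<ʳ a)) (asc-old a)

  dsc-top : ∀ {x y} → Dsc π x y → Dsc (ext n π) x y
  dsc-top d = subst₂ (Dsc _) (bump-< (dsc-<ˡ d)) (bump-< (dsc-<ʳ d)) (dsc-old d)

  asc-top⁻ : ∀ {x y} → Asc (ext n π) x y → Asc π x y
  asc-top⁻ a′ with asc-ext⁻ a′
  ... | old a      = subst₂ (Asc π) (sym (bump-< (asc-<ˡ a))) (sym (bump-< (asc-<ʳ a))) a
  ... | new y∈ n≤y = ⊥-elim (<⇒≱ (bound p y∈) n≤y)

  dsc-top⁻ : ∀ {x y} → Dsc (ext n π) x y → Dsc π x y ⊎ y ≡ n
  dsc-top⁻ d′ with dsc-ext⁻ d′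
  ... | old d   = inj₁ (subst₂ (Dsc π) (sym (bump-< (dsc-<ˡ d))) (sym (bump-< (dsc-<ʳ d))) d)
  ... | new _ _ = inj₂ refl

  ¬killLo-top : ∀ {a} → ¬ KillLo n a π
  ¬killLo-top (byAsc a _ _ n≤y) = <⇒≱ (asc-<ʳ a) n≤y
  ¬killLo-top (byDsc d _ n≤y)   = <⇒≱ (dsc-<ʳ d) n≤y

-- Permutations avoiding 123

-- The sites from `c` on are safe because prepending `s` creates a 123 only if `s ≤ x` for the
-- bottom `x` of an ascent.
record Base (n c : ℕ) (π : List ℕ) : Set where
  field
    c≤n  : c ≤ n
    safe : ∀ {x y} → Asc π x y → x < c
    live : ∀ {a} → c ≤ a → ¬ Dead a π

module _ {n c π} (p : Perm n π) (base : Base n c π) where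
  open Base base

  base-top : Base (suc n) c (ext n π)
  base-top .Base.c≤n = m≤n⇒m≤1+n c≤n
  base-top .Base.safe a = safe (asc-top⁻ p a)
  base-top .Base.live {a} c≤a dead with <-≤-connex n a
  ... | inj₂ a≤n = [ live c≤a , ¬killLo-top p ]′ (deadLo⁻ a≤n dead)
  base-top .Base.live {suc a} c≤a dead | inj₁ (s≤s n≤a) with deadHi⁻ n≤a dead
  ... | inj₁ d = live (≤-trans c≤n n≤a) d
  ... | inj₂ (byAsc as n≤x _) = <⇒≱ (asc-<ˡ p as) n≤x

  module _ {s} (c≤s : c ≤ s) (s<n : s < n) where

    -- Larger values follow the new entry, so `s` becomes the highest ascent bottom and the bound
    -- moves to `suc s`. No site above is killed, as no old ascent has its bottom at `s` or higher.
    base-ins : Base (suc n) (suc s) (ext s π)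
    base-ins .Base.c≤n = s≤s (<⇒≤ s<n)
    base-ins .Base.safe a′ with asc-ext⁻ a′
    ... | old a   = bump-<-suc s (<-≤-trans (safe a) c≤s)
    ... | new _ _ = ≤-refl
    base-ins .Base.live {suc a} (s≤s s≤a) dead with deadHi⁻ s≤a dead
    ... | inj₁ d = live (≤-trans c≤s s≤a) d
    ... | inj₂ (byAsc as s≤x _) = <⇒≱ (<-≤-trans (safe as) c≤s) s≤x

    -- The maximum plays the 4 of 2341, `s` the 3 and `x` the 1; the site `a` would supply the 2.
    dsc-kills : ∀ {x y a} → Dsc π x y → suc y ≡ n → x < a → a ≤ s → Dead a (ext s π)
    dsc-kills d refl x<a a≤s = deadLo-new a≤s (byDsc d x<a (≤-pred s<n))

    dsc-above : ∀ {x y} → c ≤ x → x < y → y < n → Dsc π x y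
    dsc-above c≤x x<y y<n with asc-or-dsc p x<y y<n
    ... | inj₁ a = ⊥-elim (<⇒≱ (safe a) c≤x)
    ... | inj₂ d = d

-- Once the maximum stands before some value below `c`, prepending a safe `s < n` kills all sites
-- from `c` to `s` by `dsc-kills`, so no new live site is left behind below the bound.
Crossing : ℕ → ℕ → List ℕ → Set
Crossing n c π = ∃₂ λ x y → Dsc π x y × x < c × suc y ≡ n

-- Nothing is live below `c`, and `cross` keeps it so in every descendant. These are the plain nodes
-- of the Catalan tree.
record Dull (n c : ℕ) (π : List ℕ) : Set where
  field
    base  : Base n c π
    dead  : ∀ {a} → a < c → Dead a π
    cross : Crossing n c π

module _ {n c : ℕ} {π : List ℕ} (p : Perm n π) where

  cross-ins : ∀ {s} → c ≤ s → s < n → Crossing n c π → Crossing (suc n) (suc s) (ext s π)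
  cross-ins {s} c≤s s<n (x , y , d , x<c , refl) =
    bump s x , suc y , subst (Dsc _ _) (bump-≥ (≤-pred s<n)) (dsc-old d) , bump-<-suc s (<-≤-trans x<c c≤s) , refl

  cross-top : ∀ {x} → x < c → x < n → Crossing (suc n) c (ext n π)
  cross-top x<c x<n = _ , _ , dsc-new (full p x<n) x<n , x<c , refl

  dull-ins : Base n c π → ∀ {s} → c ≤ s → s < n → (∀ {a} → a < c → Dead a (ext s π)) → Crossing n c π →
             Dull (suc n) (suc s) (ext s π)
  dull-ins base c≤s s<n dead cr .Dull.base = base-ins p base c≤s s<n
  dull-ins base {s} c≤s s<n dead (x , y , d , x<c , eq) .Dull.dead {a} a≤s with <-≤-connex a c
  ... | inj₁ a<c = dead a<c
  ... | inj₂ c≤a = dsc-kills p base c≤s s<n d eq (<-≤-trans x<c c≤a) (≤-pred a≤s)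
  dull-ins base c≤s s<n dead cr .Dull.cross = cross-ins c≤s s<n cr

  dull-top : Dull n c π → Dull (suc n) c (ext n π)
  dull-top D .Dull.base = base-top p (Dull.base D)
  dull-top D .Dull.dead a<c = deadLo-old (≤-trans (<⇒≤ a<c) (Base.c≤n (Dull.base D))) (Dull.dead D a<c)
  dull-top D .Dull.cross = let x , y , d , x<c , _ = Dull.cross D in cross-top x<c (dsc-<ˡ p d)

-- `link` controls what follows after `b` is prepended: `b`, `x` and `c` become a 123, and by 4123
-- every site above `c` dies. Of the arbitrarily many safe sites only `c` itself can survive.
record Split (n b c : ℕ) (π : List ℕ) : Set where
  field
    base : Base n c π
    b<c  : b < c
    c<n  : c < n
    live : ¬ Dead b π
    dead : ∀ {a} → a < c → a ≢ b → Dead a π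
    link : ∃ λ x → b ≤ x × Asc π x c

module _ {n b c : ℕ} {π : List ℕ} (p : Perm n π) where

  split-top : Split n b c π → Split (suc n) b c (ext n π)
  split-top S = record
    { base = base-top p base ; b<c = b<c ; c<n = m<n⇒m<1+n c<n
    ; live = [ live , ¬killLo-top p ]′ ∘ deadLo⁻ (<⇒≤ (<-trans b<c c<n))
    ; dead = λ a<c a≢b → deadLo-old (<⇒≤ (<-trans a<c c<n)) (dead a<c a≢b)
    ; link = map₂ (map₂ (asc-top p)) link }
    where open Split S

  split-ins : Base n c π → ∀ {s} → c ≤ s → s < n → b ≤ s → ¬ Dead b (ext s π) →
              (∀ {a} → a ≤ s → a ≢ b → Dead a (ext s π)) → Split (suc n) b (suc s) (ext s π)
  split-ins base {s} c≤s s<n b≤s live dead = record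
    { base = base-ins p base c≤s s<n ; b<c = s≤s b≤s ; c<n = s≤s s<n ; live = live
    ; dead = λ a≤s → dead (≤-pred a≤s) ; link = s , b≤s , asc-new (full p s<n) ≤-refl }

-- The table of the two sites b and c, and the birth of the first 123

record Flags : Set where
  constructor flags
  field
    a₁₁ d₀₁ d₀₂ d₁₂ e₀ : Verdict

record Marked (f : Flags) (b c : ℕ) (π : List ℕ) : Set where
  open Flags f
  field
    a₁₁-ok : Sem a₁₁ (∃₂ λ x y → Asc π x y × b ≤ x × y < c)
    d₀₁-ok : Sem d₀₁ (∃₂ λ x y → Dsc π x y × x < b × b ≤ y × y < c)
    d₀₂-ok : Sem d₀₂ (∃₂ λ x y → Dsc π x y × x < b × c ≤ y)
    d₁₂-ok : Sem d₁₂ (∃₂ λ x y → Dsc π x y × b ≤ x × x < c × c ≤ y)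
    e₀-ok  : Sem e₀ (0 < b)

-- Block 1 consists of the values from `b` to below `c`, and the entry at `1 2` of the increasing
-- pairs is `link`. The safe sites above `c` are not listed; they form the exempt set of `preFits`.
preTable : Flags → Table
preTable f = table 2 a d e₀ (const fails)
  where
  open Flags f
  a d : ℕ → ℕ → Verdict
  a 1 1 = a₁₁
  a 1 2 = holds
  a _ _ = unknown
  d 0 1 = d₀₁
  d 0 2 = d₀₂
  d 1 2 = d₁₂
  d _ _ = unknown

module _ {n b c π f} (p : Perm n π) (S : Split n b c π) (M : Marked f b c π) where
  open Split S
  open Flags f
  open Marked M

  private
    lab : ℕ → ℕ
    lab v with v <? b | v <? c
    ... | yes _ | _     = 0
    ... | no _  | yes _ = 1
    ... | no _  | no _  = 2

    data LabView (v : ℕ) : ℕ → Set where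
      low  : v < b → LabView v 0
      mid  : b ≤ v → v < c → LabView v 1
      high : c ≤ v → LabView v 2

    labView : ∀ v → LabView v (lab v)
    labView v with v <? b | v <? c
    ... | yes v<b | _       = low v<b
    ... | no v≮b  | yes v<c = mid (≮⇒≥ v≮b) v<c
    ... | no _    | no v≮c  = high (≮⇒≥ v≮c)

    low⇒ : ∀ {v} → v < b → lab v ≡ 0
    low⇒ {v} v<b with lab v | labView v
    ... | _ | low _     = refl
    ... | _ | mid b≤v _ = ⊥-elim (<⇒≱ v<b b≤v)
    ... | _ | high c≤v  = ⊥-elim (<⇒≱ v<b (≤-trans (<⇒≤ b<c) c≤v))

    mid⇒ : ∀ {v} → b ≤ v → v < c → lab v ≡ 1
    mid⇒ {v} b≤v v<c with lab v | labView v
    ... | _ | low v<b  = ⊥-elim (<⇒≱ v<b b≤v)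
    ... | _ | mid _ _  = refl
    ... | _ | high c≤v = ⊥-elim (<⇒≱ v<c c≤v)

    high⇒ : ∀ {v} → c ≤ v → lab v ≡ 2
    high⇒ {v} c≤v with lab v | labView v
    ... | _ | low v<b   = ⊥-elim (<⇒≱ v<b (≤-trans (<⇒≤ b<c) c≤v))
    ... | _ | mid _ v<c = ⊥-elim (<⇒≱ v<c c≤v)
    ... | _ | high _    = refl

    ⇒low : ∀ {v} → lab v ≡ 0 → v < b
    ⇒low {v} eq with lab v | labView v
    ... | _ | low v<b = v<b
    ⇒low () | _ | mid _ _
    ⇒low () | _ | high _

    ⇒mid : ∀ {v} → lab v ≡ 1 → b ≤ v × v < c
    ⇒mid {v} eq with lab v | labView v
    ... | _ | mid b≤v v<c = b≤v , v<c
    ⇒mid () | _ | low _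
    ⇒mid () | _ | high _

    ⇒high : ∀ {v} → lab v ≡ 2 → c ≤ v
    ⇒high {v} eq with lab v | labView v
    ... | _ | high c≤v = c≤v
    ⇒high () | _ | low _
    ⇒high () | _ | mid _ _

    st : ℕ → ℕ
    st zero    = b
    st (suc _) = c

    to : ∀ q v → q < 2 → st q ≤ v → q < lab v
    to q v q< le with lab v | labView v
    to zero    v _ le | _ | low v<b   = ⊥-elim (<⇒≱ v<b le)
    to zero    v _ le | _ | mid _ _   = s≤s z≤n
    to zero    v _ le | _ | high _    = s≤s z≤n
    to 1       v _ le | _ | low v<b   = ⊥-elim (<⇒≱ (<-trans v<b b<c) le)
    to 1       v _ le | _ | mid _ v<c = ⊥-elim (<⇒≱ v<c le)
    to 1       v _ le | _ | high _    = ≤-refl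
    to (suc (suc _)) v (s≤s (s≤s ())) _ | _ | _

    from : ∀ q v → q < lab v → st q ≤ v
    from q v lt with lab v | labView v
    from zero    v lt | _ | mid b≤v _ = b≤v
    from (suc q) v (s≤s ()) | _ | mid _ _
    from zero    v lt | _ | high c≤v  = ≤-trans (<⇒≤ b<c) c≤v
    from (suc q) v lt | _ | high c≤v  = c≤v

    lab≤ : ∀ v → lab v ≤ 2
    lab≤ v with lab v | labView v
    ... | _ | low _   = z≤n
    ... | _ | mid _ _ = s≤s z≤n
    ... | _ | high _  = ≤-refl

    st< : ∀ q → st q < n
    st< zero    = <-trans b<c c<n
    st< (suc q) = c<n

    mono : ∀ q r → q < r → r < 2 → st q < st r
    mono zero    (suc r) _ _ = b<c
    mono (suc q) (suc (suc r)) _ (s≤s (s≤s ()))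
    mono (suc q) 1 (s≤s ()) _

    ascOk : ∀ i j → Sem (asc (preTable f) i j) (∃₂ λ x y → Asc π x y × lab x ≡ i × lab y ≡ j)
    ascOk 0 _ = tt
    ascOk 1 0 = tt
    ascOk 1 1 = sem-map a₁₁
      (λ (x , y , a , b≤x , y<c) → let x<y = proj₁ a in
        x , y , a , mid⇒ b≤x (<-trans x<y y<c) , mid⇒ (≤-trans b≤x (<⇒≤ x<y)) y<c)
      (λ (x , y , a , ex , ey) → x , y , a , proj₁ (⇒mid ex) , proj₂ (⇒mid ey)) a₁₁-ok
    ascOk 1 2 = let x , b≤x , a = link in x , c , a , mid⇒ b≤x (proj₁ a) , high⇒ ≤-refl
    ascOk 1 (suc (suc (suc _))) = tt
    ascOk (suc (suc _)) _ = tt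

    dscOk : ∀ i j → Sem (dsc (preTable f) i j) (∃₂ λ x y → Dsc π x y × lab x ≡ i × lab y ≡ j)
    dscOk 0 0 = tt
    dscOk 0 1 = sem-map d₀₁
      (λ (x , y , d , x<b , b≤y , y<c) → x , y , d , low⇒ x<b , mid⇒ b≤y y<c)
      (λ (x , y , d , ex , ey) → x , y , d , ⇒low ex , ⇒mid ey) d₀₁-ok
    dscOk 0 2 = sem-map d₀₂
      (λ (x , y , d , x<b , c≤y) → x , y , d , low⇒ x<b , high⇒ c≤y)
      (λ (x , y , d , ex , ey) → x , y , d , ⇒low ex , ⇒high ey) d₀₂-ok
    dscOk 0 (suc (suc (suc _))) = tt
    dscOk 1 0 = tt
    dscOk 1 1 = tt
    dscOk 1 2 = sem-map d₁₂
      (λ (x , y , d , b≤x , x<c , c≤y) → x , y , d , mid⇒ b≤x x<c , high⇒ c≤y)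
      (λ (x , y , d , ex , ey) → x , y , d , proj₁ (⇒mid ex) , proj₂ (⇒mid ex) , ⇒high ey) d₁₂-ok
    dscOk 1 (suc (suc (suc _))) = tt
    dscOk (suc (suc _)) _ = tt

    oth : ∀ {a} → a ≤ n → (∃ λ q → q < 2 × st q ≡ a) ⊎ Dead a π ⊎ c < a
    oth {a} _ with <-cmp a c
    ... | tri> _ _ c<a  = inj₂ (inj₂ c<a)
    ... | tri≈ _ refl _ = inj₁ (1 , ≤-refl , refl)
    ... | tri< a<c _ _ with a ≟ b
    ...   | yes refl = inj₁ (0 , s≤s z≤n , refl)
    ...   | no a≢b   = inj₂ (inj₁ (dead a<c a≢b))

    deadOk : ∀ q → ¬ Dead (st q) π
    deadOk zero    = live
    deadOk (suc q) = Base.live base ≤-refl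

  preFits : Fits (c <_) (preTable f) n π
  preFits = record
    { label = lab ; site = st ; site≤⇒ = to _ _ ; site≤⇐ = λ _ → from _ _ ; label≤ = lab≤ ; site< = λ {q} _ → st< q
    ; site-mono = mono _ _ ; asc-ok = ascOk ; dsc-ok = dscOk
    ; nonempty₀-ok = sem-map e₀ (λ 0<b → 0 , full p (<-trans 0<b (<-trans b<c c<n)) , low⇒ 0<b)
                       (λ (v , _ , eq) → ≤-<-trans z≤n (⇒low eq)) e₀-ok
    ; dead-ok = λ {q} _ → deadOk q ; others = oth }

  birth : ∀ k → Matches (next (preTable f) 0) (classSpec k) →
          Fits (const ⊥) (toTable (classSpec k)) (suc n) (ext b π)
  birth k m = matches-ok (classSpec k) m (next-ok p preFits (s≤s z≤n) killed)
    where
    killed : ∀ {a} → c < a → b ≤ a × KillHi b a π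
    killed c<a = let x , b≤x , as = link in <⇒≤ (<-trans b<c c<a) , byAsc as b≤x c<a

-- A parameter p of dull, fresh, chain, late, stuck stands for n ∸ c, and decr n is the decreasing permutation.
-- In band a e j, n ∸ c = j + e and j is the number of safe sites s < n that leave the site 0 live.
data State : Set where
  inner                          : Class → State
  dull decr fresh chain late stuck : ℕ → State
  band                           : Bool → ℕ → ℕ → State

bandClass : Bool → Class
bandClass false = k₃
bandClass true  = k₇

-- The index `i` stands for the safe site `n ∸ suc i`, which lies above the `Threshold` exactly when
-- `i < j`; then the site 0 survives.
bandEntry : ℕ → ℕ → State
bandEntry j i with i <? j
... | yes _ = band true (suc i) 0
... | no _  = dull (suc i)

kids : State → List State
kids (inner k)      = map inner (classKids k)
kids (dull p)       = dull (suc p) ∷ applyDownFrom (dull ∘ suc) p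
kids (decr zero)    = decr 1 ∷ []
kids (decr (suc m)) = decr (2 ℕ.+ m) ∷ fresh (suc m) ∷ applyDownFrom (λ i → band false (suc i) 0) m
kids (fresh zero)   = []
kids (fresh (suc m)) = inner k₀ ∷ band false (suc m) 1 ∷ chain (suc m) ∷ applyDownFrom (late ∘ suc) m
kids (chain zero)    = []
kids (chain (suc m)) = inner k₂ ∷ stuck (2 ℕ.+ m) ∷ chain (suc m) ∷ applyDownFrom (late ∘ suc) m
kids (late p)        = inner k₄ ∷ stuck (suc p) ∷ applyDownFrom (dull ∘ suc) p
kids (stuck p)       = inner k₄ ∷ stuck (suc p) ∷ applyDownFrom (dull ∘ suc) p
kids (band a e j)    = inner (bandClass a) ∷ band a e (suc j) ∷ applyDownFrom (bandEntry j) (j ℕ.+ e)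

chainFlags lateFlags stuckFlags freshFlags : Flags
freshFlags = flags fails fails fails fails fails
chainFlags = flags fails holds fails fails holds
lateFlags  = flags fails holds fails holds holds
stuckFlags = flags fails holds holds holds holds

bandFlags : Bool → Flags
bandFlags false = flags fails fails fails holds fails
bandFlags true  = flags holds fails fails holds fails

-- `t` is the highest top of an ascent. When `b` is 0, a safe `s` kills the site 0 exactly if some
-- ascent reaches `s` or higher, so 0 survives at the `j` sites strictly between `t` and `n`.
record Threshold (j n : ℕ) (π : List ℕ) : Set where
  field
    t     : ℕ
    t+j   : suc (t ℕ.+ j) ≡ n
    wit   : ∃ λ x → Asc π x t
    bnd   : ∀ {x y} → Asc π x y → y ≤ t

-- In `fresh` and `chain` no value below `c` stands after one that is at least `c`. In `late` and
-- `stuck` every safe site below `n` kills `b`: in `late` because an ascent from above `b` ends in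
-- the maximum, in `stuck` because the maximum stands before a value below `b`.
Describes : State → ℕ → List ℕ → Set
Describes (inner k)    n π = Fits (const ⊥) (toTable (classSpec k)) n π
Describes (dull p)     n π = ∃ λ c → n ≡ c ℕ.+ p × Dull n c π
Describes (decr m)     n π = n ≡ m × (∀ {x y} → ¬ Asc π x y) × (∀ {a} → ¬ Dead a π)
Describes (fresh p)    n π = ∃ λ c → n ≡ c ℕ.+ p × Split n 0 c π × Marked freshFlags 0 c π
Describes (chain p)    n π = ∃₂ λ b c → n ≡ c ℕ.+ p × Split n b c π × Marked chainFlags b c π
Describes (late p)     n π = ∃₂ λ b c → n ≡ c ℕ.+ p × Split n b c π × Marked lateFlags b c π × Crossing n c π ×
                             (∃₂ λ x y → Asc π x y × b ≤ x × suc y ≡ n)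
Describes (stuck p)    n π = ∃₂ λ b c → n ≡ c ℕ.+ p × Split n b c π × Marked stuckFlags b c π ×
                             (∃₂ λ x y → Dsc π x y × x < b × suc y ≡ n)
Describes (band a e j) n π = ∃ λ c → n ≡ c ℕ.+ (j ℕ.+ e) × Split n 0 c π × Marked (bandFlags a) 0 c π × Crossing n c π ×
                             Threshold j n π

-- Live sites and children of every state

record Step (σ : State) (n : ℕ) (π : List ℕ) : Set where
  field
    sites   : List ℕ
    sites-unique  : Unique sites
    sound   : ∀ {a} → a ∈ sites → a ≤ n × ¬ Dead a π
    complete : ∀ {a} → a ≤ n → ¬ Dead a π → a ∈ sites
    match   : Pointwise (λ a τ → Describes τ (suc n) (ext a π)) sites (kids σ)

pointwise-applyUpTo : ∀ {A B C : Set} {R : A → B → Set} {S : C → B → Set} {g : ℕ → A} {f : ℕ → C} m {ys} →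
                      (∀ {i} → i < m → ∀ {y} → R (g i) y → S (f i) y) →
                      Pointwise R (applyUpTo g m) ys → Pointwise S (applyUpTo f m) ys
pointwise-applyUpTo zero    h []       = []
pointwise-applyUpTo (suc m) h (r ∷ rs) = h (s≤s z≤n) r ∷ pointwise-applyUpTo m (h ∘ s≤s) rs

pointwise-applyDownFrom : ∀ {A B : Set} {R : A → B → Set} {f : ℕ → A} {g : ℕ → B} m →
                          (∀ {i} → i < m → R (f i) (g i)) → Pointwise R (applyDownFrom f m) (applyDownFrom g m)
pointwise-applyDownFrom zero    h = []
pointwise-applyDownFrom (suc m) h = h ≤-refl ∷ pointwise-applyDownFrom m (h ∘ m<n⇒m<1+n)

step-inner : ∀ k {n π} → Perm n π → Describes (inner k) n π → Step (inner k) n π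
step-inner k {n} {π} p F = record
  { sites = applyUpTo site m
  ; sites-unique = Unique.applyUpTo⁺₁ site m (λ i<j j<m → <⇒≢ (site-mono i<j j<m))
  ; sound = snd
  ; complete = comp
  ; match = subst (λ xs → Pointwise _ xs (kids (inner k))) (map-id (applyUpTo site m)) (Pointwise.map⁺ id inner
      (pointwise-applyUpTo m (λ r< {k′} mt → matches-ok (classSpec k′) mt (next-ok p F r< λ ())) (kidsMatch k))) }
  where
  open Fits F
  m = Spec.sites (classSpec k)
  snd : ∀ {a} → a ∈ applyUpTo site m → a ≤ n × ¬ Dead a π
  snd a∈ with ∈-applyUpTo⁻ site a∈
  ... | q , q< , refl = <⇒≤ (site< q<) , dead-ok q<
  comp : ∀ {a} → a ≤ n → ¬ Dead a π → a ∈ applyUpTo site m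
  comp a≤n ¬d with others a≤n
  ... | inj₁ (q , q< , refl) = ∈-applyUpTo⁺ site q<
  ... | inj₂ (inj₁ d)        = ⊥-elim (¬d d)

module _ {n c p : ℕ} (n≡c+p : n ≡ c ℕ.+ p) where

  safeSite : ℕ → ℕ
  safeSite i = n ∸ suc i

  safeSites : List ℕ
  safeSites = applyDownFrom safeSite p

  private
    p≤n : p ≤ n
    p≤n = subst (p ≤_) (sym n≡c+p) (m≤n+m p c)

  safeSite< : ∀ {i} → i < p → safeSite i < n
  safeSite< i<p = ∸-monoʳ-< (s≤s z≤n) (≤-trans i<p p≤n)

  safeSite+ : ∀ {i} → i < p → suc n ≡ suc (safeSite i) ℕ.+ suc i
  safeSite+ i<p = cong suc (sym (m∸n+n≡m (≤-trans i<p p≤n)))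

  safeSite≥ : ∀ {i} → i < p → c ≤ safeSite i
  safeSite≥ {i} i<p = +-cancelʳ-≤ (suc i) c (safeSite i)
    (≤-trans (+-monoʳ-≤ c i<p) (≤-reflexive (trans (sym n≡c+p) (suc-injective (safeSite+ i<p)))))

  safeSites-unique : Unique safeSites
  safeSites-unique = Unique.applyDownFrom⁺₁ safeSite p
    (λ j<i i<p → <⇒≢ (∸-monoʳ-< (s≤s j<i) (≤-trans i<p p≤n)))

  ∈-safeSites⁻ : ∀ {a} → a ∈ safeSites → c ≤ a × a < n
  ∈-safeSites⁻ a∈ with ∈-applyDownFrom⁻ safeSite a∈
  ... | i , i<p , refl = safeSite≥ i<p , safeSite< i<p

  ∈-safeSites⁺ : ∀ {a} → c ≤ a → a < n → a ∈ safeSites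
  ∈-safeSites⁺ {a} c≤a a<n = subst (_∈ safeSites) eq (∈-applyDownFrom⁺ safeSite i<p)
    where
    eq : n ∸ suc (n ∸ suc a) ≡ a
    eq = trans (cong (n ∸_) (sym (+-∸-assoc 1 a<n))) (m∸[m∸n]≡n (<⇒≤ a<n))
    i<p : n ∸ suc a < p
    i<p = subst (_≤ p) (+-∸-assoc 1 a<n) (≤-trans (∸-monoʳ-≤ n c≤a) (≤-reflexive (trans (cong (_∸ c) n≡c+p) (m+n∸m≡n c p))))

  topSites-unique : Unique (n ∷ safeSites)
  topSites-unique = All.tabulate (λ a∈ n≡a → <-irrefl (sym n≡a) (proj₂ (∈-safeSites⁻ a∈))) ∷ safeSites-unique

  ∈-topSites⁻ : ∀ {a} → a ∈ n ∷ safeSites → c ≤ a × a ≤ n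
  ∈-topSites⁻ (here refl) = subst (c ≤_) (sym n≡c+p) (m≤m+n c p) , ≤-refl
  ∈-topSites⁻ (there a∈)  = map₂ <⇒≤ (∈-safeSites⁻ a∈)

  ∈-topSites⁺ : ∀ {a} → c ≤ a → a ≤ n → a ∈ n ∷ safeSites
  ∈-topSites⁺ c≤a a≤n with m≤n⇒m<n∨m≡n a≤n
  ... | inj₁ a<n  = there (∈-safeSites⁺ c≤a a<n)
  ... | inj₂ refl = here refl

step-dull : ∀ q {n π} → Perm n π → Describes (dull q) n π → Step (dull q) n π
step-dull q {n} {π} p (c , eq , D) = record
  { sites = n ∷ safeSites eq
  ; sites-unique = topSites-unique eq
  ; sound = λ a∈ → let c≤a , a≤n = ∈-topSites⁻ eq a∈ in a≤n , live c≤a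
  ; complete = comp
  ; match = (c , trans (cong suc eq) (sym (+-suc c q)) , dull-top p D)
            ∷ pointwise-applyDownFrom q λ i<q → _ , safeSite+ eq i<q , dull-ins p base (safeSite≥ eq i<q) (safeSite< eq i<q)
                (λ a<c → deadLo-old (≤-trans (<⇒≤ a<c) (safeSite≥ eq i<q)) (dead a<c)) cross }
  where
  open Dull D
  open Base base
  comp : ∀ {a} → a ≤ n → ¬ Dead a π → a ∈ n ∷ safeSites eq
  comp {a} a≤n ¬d with <-≤-connex a c
  ... | inj₁ a<c = ⊥-elim (¬d (dead a<c))
  ... | inj₂ c≤a = ∈-topSites⁺ eq c≤a a≤n

split-step : ∀ {n b c π q} {σ τ υ : State} {τs} (eq : n ≡ c ℕ.+ q) → Split n b c π → kids σ ≡ τ ∷ υ ∷ τs →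
             Describes τ (suc n) (ext b π) → Describes υ (suc n) (ext n π) →
             Pointwise (λ a ρ → Describes ρ (suc n) (ext a π)) (safeSites eq) τs → Step σ n π
split-step {n} {b} {c} {π} eq S keq dτ dυ ds = record
  { sites = b ∷ n ∷ safeSites eq
  ; sites-unique = All.tabulate (λ a∈ b≡a → <⇒≢ (<-≤-trans b<c (proj₁ (∈-topSites⁻ eq a∈))) b≡a) ∷ topSites-unique eq
  ; sound = snd ; complete = comp
  ; match = subst (Pointwise _ _) (sym keq) (dτ ∷ dυ ∷ ds) }
  where
  open Split S
  snd : ∀ {a} → a ∈ b ∷ n ∷ safeSites eq → a ≤ n × ¬ Dead a π
  snd (here refl) = <⇒≤ (<-trans b<c c<n) , live
  snd (there a∈)  = let c≤a , a≤n = ∈-topSites⁻ eq a∈ in a≤n , Base.live base c≤a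
  comp : ∀ {a} → a ≤ n → ¬ Dead a π → a ∈ b ∷ n ∷ safeSites eq
  comp {a} a≤n ¬d with <-≤-connex a c
  ... | inj₂ c≤a = there (∈-topSites⁺ eq c≤a a≤n)
  ... | inj₁ a<c with a ≟ b
  ...   | yes refl = here refl
  ...   | no a≢b   = ⊥-elim (¬d (dead a<c a≢b))

module _ {n b c π} (p : Perm n π) (S : Split n b c π) where
  open Split S

  split-dull : ∀ {s} → c ≤ s → s < n → KillLo s b π → Crossing n c π → Dull (suc n) (suc s) (ext s π)
  split-dull {s} c≤s s<n kill = dull-ins p base c≤s s<n λ {a} a<c → go a a<c
    where
    go : ∀ a → a < c → Dead a (ext s π)
    go a a<c with a ≟ b
    ... | yes refl = deadLo-new (≤-trans (<⇒≤ a<c) c≤s) kill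
    ... | no a≢b   = deadLo-old (≤-trans (<⇒≤ a<c) c≤s) (dead a<c a≢b)

  crossing-top : Crossing (suc n) c (ext n π)
  crossing-top = let _ , _ , a = link in cross-top p (Base.safe base a) (asc-<ˡ p a)

  marked-top : ∀ {a d e d₀₂ d₁₂ v} → Marked (flags a d d₀₂ d₁₂ e) b c π →
               Sem v (∃₂ λ x y → Dsc (ext n π) x y × x < b × c ≤ y) → Marked (flags a d v holds e) b c (ext n π)
  marked-top {a} {d} M d₀₂′ = record
    { a₁₁-ok = sem-map a (λ (x , y , as , r) → x , y , asc-top p as , r) (λ (x , y , as , r) → x , y , asc-top⁻ p as , r) a₁₁-ok
    ; d₀₁-ok = sem-map d (λ (x , y , ds , r) → x , y , dsc-top p ds , r) back d₀₁-ok
    ; d₀₂-ok = d₀₂′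
    ; d₁₂-ok = let x , b≤x , as = link in x , n , dsc-new (asc-∈ˡ as) (asc-<ˡ p as) , b≤x , Base.safe base as , <⇒≤ c<n
    ; e₀-ok = e₀-ok }
    where
    open Marked M
    back : (∃₂ λ x y → Dsc (ext n π) x y × x < b × b ≤ y × y < c) → ∃₂ λ x y → Dsc π x y × x < b × b ≤ y × y < c
    back (x , y , ds , x<b , b≤y , y<c) with dsc-top⁻ p ds
    ... | inj₁ ds′  = x , y , ds′ , x<b , b≤y , y<c
    ... | inj₂ refl = ⊥-elim (<-asym y<c c<n)

  -- As `0 < b`, the prepended maximum stands before the value 0, and this decreasing pair is the
  -- witness that `stuck` asks for.
  stuck-top : ∀ {q d₀₂ d₁₂} → n ≡ c ℕ.+ q → Marked (flags fails holds d₀₂ d₁₂ holds) b c π →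
              Describes (stuck (suc q)) (suc n) (ext n π)
  stuck-top {q} eq M = b , c , trans (cong suc eq) (sym (+-suc c q)) , split-top p S ,
    marked-top M (0 , n , d , e₀-ok , <⇒≤ c<n) , 0 , n , d , e₀-ok , refl
    where
    open Marked M
    0<n = <-trans e₀-ok (<-trans b<c c<n)
    d = dsc-new (full p 0<n) 0<n

entry? : ∀ f k → Dec (Matches (next (preTable f) 0) (classSpec k))
entry? f k = matches? _ _

step-stuck : ∀ q {n π} → Perm n π → Describes (stuck q) n π → Step (stuck q) n π
step-stuck q p (b , c , eq , S , M , x , y , d , x<b , refl) = split-step eq S refl
  (birth p S M k₄ (from-yes (entry? stuckFlags k₄)))
  (stuck-top p S eq M)
  (pointwise-applyDownFrom q λ i<q → _ , safeSite+ eq i<q ,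
    split-dull p S (safeSite≥ eq i<q) (safeSite< eq i<q)
      (byDsc d x<b (≤-pred (safeSite< eq i<q))) (x , y , d , <-trans x<b (Split.b<c S) , refl))

step-late : ∀ q {n π} → Perm n π → Describes (late q) n π → Step (late q) n π
step-late q p (b , c , eq , S , M , cr , x , y , as , b≤x , refl) = split-step eq S refl
  (birth p S M k₄ (from-yes (entry? lateFlags k₄)))
  (stuck-top p S eq M)
  (pointwise-applyDownFrom q λ i<q → _ , safeSite+ eq i<q ,
    split-dull p S (safeSite≥ eq i<q) (safeSite< eq i<q)
      (byAsc as b≤x (<-≤-trans (Base.safe (Split.base S) as) (safeSite≥ eq i<q)) (≤-pred (safeSite< eq i<q))) cr)

module _ {n b c π} (p : Perm n π) (S : Split n b c π)
         (uncrossed : ∀ {x y} → Dsc π x y → x < c → c ≤ y → ⊥) where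
  open Split S

  private
    0<c : 0 < c
    0<c = ≤-<-trans z≤n b<c

  uncrossed-asc : ∀ {x y} → x < c → c ≤ y → y < n → Asc π x y
  uncrossed-asc x<c c≤y y<n with asc-or-dsc p (<-≤-trans x<c c≤y) y<n
  ... | inj₁ a = a
  ... | inj₂ d = ⊥-elim (uncrossed d x<c c≤y)

  -- The live site jumps from `b` to `c`. Site `c` survives because no value below `c` stands after
  -- one above. Sites between `c` and `s` die through the maximum, which stands before `c`. Site `b`
  -- dies by 1324: the bottom `x` of `link` comes before the old value `s`, and the new entry is the
  -- 3.
  rebox : ∀ {s} → c ≤ s → s < n → Split (suc n) c (suc s) (ext s π)
  rebox {s} c≤s s<n = split-ins p base c≤s s<n c≤s c-live c-dead
    where
    c-live : ¬ Dead c (ext s π)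
    c-live d with deadLo⁻ c≤s d
    ... | inj₁ d′                  = Base.live base ≤-refl d′
    ... | inj₂ (byAsc a c≤x _ _)   = <⇒≱ (Base.safe base a) c≤x
    ... | inj₂ (byDsc ds x<c s≤y)  = uncrossed ds x<c (≤-trans c≤s s≤y)
    c-dead : ∀ {a} → a ≤ s → a ≢ c → Dead a (ext s π)
    c-dead {a} a≤s a≢c with <-cmp a c
    ... | tri≈ _ a≡c _ = ⊥-elim (a≢c a≡c)
    ... | tri> _ _ c<a = dsc-kills p base c≤s s<n
                           (dsc-above p base c≤s s<n ≤-refl (<-≤-trans c<a (≤-trans a≤s (≤-pred′ s<n))) (pred-< s<n)) (suc-pred′ s<n) c<a a≤s
      where
      ≤-pred′ : ∀ {s n} → s < n → s ≤ pred n
      ≤-pred′ (s≤s le) = le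
      pred-< : ∀ {s n} → s < n → pred n < n
      pred-< (s≤s _) = ≤-refl
      suc-pred′ : ∀ {s n} → s < n → suc (pred n) ≡ n
      suc-pred′ (s≤s _) = refl
    ... | tri< a<c _ _ with a ≟ b
    ...   | no a≢b   = deadLo-old a≤s (dead a<c a≢b)
    ...   | yes refl = let x , b≤x , as = link ; x<c = Base.safe base as in
                       deadLo-new a≤s (byAsc (uncrossed-asc x<c c≤s s<n) b≤x (<-≤-trans x<c c≤s) ≤-refl)

  private
    0-dsc : ∀ {s} → c ≤ s → s < n → Dsc (ext s π) 0 s
    0-dsc c≤s s<n = dsc-new (full p (<-trans 0<s s<n)) 0<s
      where 0<s = <-≤-trans 0<c c≤s

    no-crossing : ∀ {s x y} → c ≤ s → Dsc (ext s π) x y → x < c → suc s ≤ y → ⊥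
    no-crossing {s} c≤s d x<c s<y with dsc-ext⁻ d
    ... | new _ _ = <-irrefl refl s<y
    ... | old {x} {y} d′ = uncrossed d′ (≤-<-trans (≤bump s x) x<c) (≤-trans c≤s (<bump⇒≤ s<y))

  -- The middle block is the single value `c`, which is also the first entry: it holds no ascent,
  -- and nothing stands before it.
  chain-next : ∀ {q} → n ≡ c ℕ.+ q → Describes (chain q) (suc n) (ext c π)
  chain-next eq = c , suc c , cong suc eq , rebox ≤-refl c<n , record
    { a₁₁-ok = λ (x , y , a , c≤x , y≤c) → <⇒≱ (<-≤-trans (proj₁ a) (≤-pred y≤c)) c≤x
    ; d₀₁-ok = 0 , c , 0-dsc ≤-refl c<n , 0<c , ≤-refl , ≤-refl
    ; d₀₂-ok = λ (x , y , d , x<c , c<y) → no-crossing ≤-refl d x<c c<y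
    ; d₁₂-ok = λ (x , y , d , c≤x , x≤c , _) → not-c (≤-antisym (≤-pred x≤c) c≤x) d
    ; e₀-ok = 0<c }
    where
    not-c : ∀ {x y} → x ≡ c → Dsc (ext c π) x y → ⊥
    not-c eq d with dsc-ext⁻ d
    ... | old _     = bump-≢ c eq
    ... | new _ x<c = <⇒≢ x<c eq

  late-next : ∀ {s q} → c < s → s < n → suc n ≡ suc s ℕ.+ q → Describes (late q) (suc n) (ext s π)
  late-next {s} {q} c<s s<n@(s≤s s≤m) eq = c , suc s , eq , rebox (<⇒≤ c<s) s<n , record
    { a₁₁-ok = λ (x , y , a , c≤x , y≤s) → no-asc a c≤x y≤s
    ; d₀₁-ok = 0 , s , 0-dsc (<⇒≤ c<s) s<n , 0<c , <⇒≤ c<s , ≤-refl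
    ; d₀₂-ok = λ (x , y , d , x<c , s<y) → no-crossing (<⇒≤ c<s) d x<c s<y
    ; d₁₂-ok = c , n , d , ≤-refl , m<n⇒m<1+n c<s , s<n
    ; e₀-ok = 0<c }
    , (c , n , d , m<n⇒m<1+n c<s , refl) , s , n , asc-new (full p ≤-refl) s≤m , <⇒≤ c<s , refl
    where
    d : Dsc (ext s π) c n
    d = subst₂ (Dsc _) (bump-< c<s) (bump-≥ s≤m)
          (dsc-old (dsc-above p base (<⇒≤ c<s) s<n ≤-refl (<-≤-trans c<s s≤m) ≤-refl))
    no-asc : ∀ {x y} → Asc (ext s π) x y → c ≤ x → y < suc s → ⊥
    no-asc a c≤x y≤s with asc-ext⁻ a
    ... | new _ s≤y = <⇒≱ y≤s (s≤s s≤y)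
    ... | old {x} a′ = <⇒≱ x<c (subst (c ≤_) (bump-< (<-trans x<c c<s)) c≤x)
      where x<c = Base.safe base a′

  chain-late-kids : ∀ {m} (eq : n ≡ c ℕ.+ suc m) →
    Pointwise (λ a ρ → Describes ρ (suc n) (ext a π)) (safeSites eq) (chain (suc m) ∷ applyDownFrom (late ∘ suc) m)
  -- The lowest safe site is `c` itself and continues the chain; the others lie strictly above `c`
  -- and are `late`.
  chain-late-kids {m} eq = subst (λ s → Describes (chain (suc m)) (suc n) (ext s π)) (sym last) (chain-next eq)
    ∷ pointwise-applyDownFrom m λ i<m → late-next
        (subst (_< _) last (∸-monoʳ-< (s≤s i<m) (subst (suc m ≤_) (sym eq) (m≤n+m (suc m) c))))
        (safeSite< eq (m<n⇒m<1+n i<m)) (safeSite+ eq (m<n⇒m<1+n i<m))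
    where
    last : n ∸ suc m ≡ c
    last = trans (cong (_∸ suc m) eq) (m+n∸n≡m c (suc m))

marked-uncrossed : ∀ {n b c π a d e} → Perm n π → Marked (flags a d fails fails e) b c π →
                   ∀ {x y} → Dsc π x y → x < c → c ≤ y → ⊥
marked-uncrossed {b = b} p M {x} {y} d x<c c≤y with <-≤-connex x b
... | inj₁ x<b = Marked.d₀₂-ok M (x , y , d , x<b , c≤y)
... | inj₂ b≤x = Marked.d₁₂-ok M (x , y , d , b≤x , x<c , c≤y)

¬crosses-0 : ∀ {R : ℕ → ℕ → Set} {P : ℕ → Set} → ¬ (∃₂ λ x y → R x y × x < 0 × P y)
¬crosses-0 (_ , _ , _ , () , _)

step-chain : ∀ q {n π} → Perm n π → Describes (chain q) n π → Step (chain q) n π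
step-chain zero    p (b , c , eq , S , M) = ⊥-elim (<-irrefl (sym (trans eq (+-identityʳ c))) (Split.c<n S))
step-chain (suc m) p (b , c , eq , S , M) = split-step eq S refl
  (birth p S M k₂ (from-yes (entry? chainFlags k₂)))
  (stuck-top p S eq M)
  (chain-late-kids p S (marked-uncrossed p M) eq)

step-fresh : ∀ q {n π} → Perm n π → Describes (fresh q) n π → Step (fresh q) n π
step-fresh zero    p (c , eq , S , M) = ⊥-elim (<-irrefl (sym (trans eq (+-identityʳ c))) (Split.c<n S))
step-fresh (suc m) {n} {π} p (c , eq , S , M) = split-step eq S refl
  (birth p S M k₀ (from-yes (entry? freshFlags k₀)))
  (c , trans (cong suc eq) (sym (+-suc c (suc m))) , split-top p S , marked-top p S M ¬crosses-0 , crossing-top p S , threshold (Split.c<n S))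
  (chain-late-kids p S (marked-uncrossed p M) eq)
  where
  threshold : c < n → Threshold 1 (suc n) (ext n π)
  threshold (s≤s c≤t) = record
    -- `t` is the old maximum `n ∸ 1`: it stands after every value below `c`, and the prepended `n`
    -- is the top of no ascent. This leaves the one site `n` between `t` and `suc n`.
    { t = _ ; t+j = cong suc (+-comm _ 1)
    ; wit = let x , _ , a = Split.link S in
        x , asc-top p (uncrossed-asc p S (marked-uncrossed p M) (Base.safe (Split.base S) a) c≤t ≤-refl)
    ; bnd = λ a → ≤-pred (asc-<ʳ p (asc-top⁻ p a)) }

module _ {n c π} (p : Perm n π) (base : Base n c π) where

  -- The ascent from the new entry `s` reaches the maximum `n`, so the threshold jumps there and `j`
  -- restarts at 0.
  band-next : ∀ {a s q} → c ≤ s → s < n → suc n ≡ suc s ℕ.+ q → ¬ Dead 0 (ext s π) →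
              (∀ {a} → a ≤ s → a ≢ 0 → Dead a (ext s π)) → Crossing (suc n) (suc s) (ext s π) →
              Sem (Flags.a₁₁ (bandFlags a)) (∃₂ λ x y → Asc (ext s π) x y × 0 ≤ x × y < suc s) →
              Describes (band a q 0) (suc n) (ext s π)
  band-next {a} {s} c≤s s<n@(s≤s s≤m) eq live dead cr a₁₁ =
    suc s , eq , split-ins p base c≤s s<n z≤n live dead , marked a a₁₁ cr , cr , record
      { t = n ; t+j = cong suc (+-identityʳ n) ; wit = s , asc-new (full p ≤-refl) s≤m
      ; bnd = λ as → ≤-pred (asc-<ʳ (perm-ext (<⇒≤ s<n) p) as) }
    where
    marked : ∀ a → Sem (Flags.a₁₁ (bandFlags a)) (∃₂ λ x y → Asc (ext s π) x y × 0 ≤ x × y < suc s) →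
             Crossing (suc n) (suc s) (ext s π) → Marked (bandFlags a) 0 (suc s) (ext s π)
    marked false a₁₁ (x , _ , d , x≤s , refl) = record
      { a₁₁-ok = a₁₁ ; d₀₁-ok = ¬crosses-0 ; d₀₂-ok = ¬crosses-0
      ; d₁₂-ok = x , n , d , z≤n , x≤s , s<n ; e₀-ok = λ () }
    marked true a₁₁ (x , _ , d , x≤s , refl) = record
      { a₁₁-ok = a₁₁ ; d₀₁-ok = ¬crosses-0 ; d₀₂-ok = ¬crosses-0
      ; d₁₂-ok = x , n , d , z≤n , x≤s , s<n ; e₀-ok = λ () }

band-entry : ∀ {n c q π j} → Perm n π → (eq : n ≡ c ℕ.+ q) → Split n 0 c π → Crossing n c π → Threshold j n π →
             ∀ {i} → i < q → Describes (bandEntry j i) (suc n) (ext (safeSite {c = c} eq i) π)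
band-entry {n} {c} {q} {π} {j} p eq S cr th {i} i<q with i <? j
... | no i≮j = _ , safeSite+ eq i<q , split-dull p S c≤s s<n (byAsc (proj₂ wit) z≤n (<-≤-trans x<c c≤s) s≤t) cr
  where
  open Threshold th
  c≤s = safeSite≥ eq i<q
  s<n = safeSite< eq i<q
  x<c = Base.safe (Split.base S) (proj₂ wit)
  s≤t : safeSite {c = c} eq i ≤ t
  s≤t = +-cancelʳ-≤ j _ t (≤-trans (+-monoʳ-≤ _ (≮⇒≥ i≮j))
          (≤-reflexive (suc-injective (trans (sym (+-suc _ i)) (trans (sym (suc-injective (safeSite+ eq i<q))) (sym t+j))))))
... | yes i<j = band-next p base {a = true} c≤s s<n (safeSite+ eq i<q) 0-live 0-dead (cross-ins p c≤s s<n cr)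
                  (let x , _ , a = link in _ , _ , asc-old a , z≤n , bump-<-suc s (≤-<-trans (bnd a) t<s))
  where
  open Threshold th
  open Split S
  s = safeSite {c = c} eq i
  c≤s = safeSite≥ eq i<q
  s<n = safeSite< eq i<q
  t<s : t < s
  t<s = +-cancelʳ-< i t s (<-≤-trans (+-monoʳ-< t i<j)
          (≤-reflexive (sym (suc-injective (trans (sym (+-suc s i)) (trans (sym (suc-injective (safeSite+ eq i<q))) (sym t+j)))))))
  0-live : ¬ Dead 0 (ext s π)
  0-live d with deadLo⁻ z≤n d
  ... | inj₁ d′                = live d′
  ... | inj₂ (byAsc a _ _ s≤y) = <⇒≱ (≤-<-trans (bnd a) t<s) s≤y
  0-dead : ∀ {a} → a ≤ s → a ≢ 0 → Dead a (ext s π)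
  0-dead {a} a≤s a≢0 with <-≤-connex a c
  ... | inj₁ a<c = deadLo-old a≤s (dead a<c a≢0)
  ... | inj₂ c≤a = let x , y , d , x<c , eq = cr in dsc-kills p base c≤s s<n d eq (<-≤-trans x<c c≤a) a≤s

step-band : ∀ a e j {n π} → Perm n π → Describes (band a e j) n π → Step (band a e j) n π
step-band a e j {n} {π} p (c , eq , S , M , cr , th) = split-step eq S refl
  (birth′ a M) (c , trans (cong suc eq) (sym (+-suc c (j ℕ.+ e))) , split-top p S , marked′ a M , crossing-top p S , record
    { t = t ; t+j = cong suc (trans (+-suc t j) t+j) ; wit = map₂ (asc-top p) wit ; bnd = bnd ∘ asc-top⁻ p })
  (pointwise-applyDownFrom (j ℕ.+ e) (band-entry {q = j ℕ.+ e} p eq S cr th))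
  where
  open Threshold th
  birth′ : ∀ a → Marked (bandFlags a) 0 c π → Describes (inner (bandClass a)) (suc n) (ext 0 π)
  birth′ false M = birth p S M k₃ (from-yes (entry? (bandFlags false) k₃))
  birth′ true  M = birth p S M k₇ (from-yes (entry? (bandFlags true) k₇))
  marked′ : ∀ a → Marked (bandFlags a) 0 c π → Marked (bandFlags a) 0 c (ext n π)
  marked′ false M = marked-top p S M ¬crosses-0
  marked′ true  M = marked-top p S M ¬crosses-0

module _ {n π} (p : Perm n π) (no-asc : ∀ {x y} → ¬ Asc π x y) (live : ∀ {a} → ¬ Dead a π) where

  private
    base : Base n 0 π
    base = record { c≤n = z≤n ; safe = λ a → ⊥-elim (no-asc a) ; live = λ _ → live }

    0-live : ∀ {s} → ¬ Dead 0 (ext s π)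
    0-live d with deadLo⁻ z≤n d
    ... | inj₁ d′              = live d′
    ... | inj₂ (byAsc a _ _ _) = no-asc a

  decr-top : Describes (decr (suc n)) (suc n) (ext n π)
  decr-top = refl , no-asc ∘ asc-top⁻ p , Base.live (base-top p base) z≤n

  fresh-next : 0 < n → Describes (fresh n) (suc n) (ext 0 π)
  fresh-next 0<n = 1 , refl , split-ins p base z≤n 0<n z≤n 0-live (λ a≤0 a≢0 → ⊥-elim (a≢0 (n≤0⇒n≡0 a≤0))) , record
    { a₁₁-ok = λ (x , y , (x<y , _) , _ , y<1) → n≮0 (<-≤-trans x<y (≤-pred y<1))
    ; d₀₁-ok = ¬crosses-0 ; d₀₂-ok = ¬crosses-0
    ; d₁₂-ok = λ (x , y , d , _ , x<1 , 0<y) → no-dsc d x<1 0<y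
    ; e₀-ok = λ () }
    where
    no-dsc : ∀ {x y} → Dsc (ext 0 π) x y → x < 1 → 0 < y → ⊥
    no-dsc d x<1 0<y with dsc-ext⁻ d
    ... | old _ = n≮0 (≤-pred x<1)

  band-start : ∀ {s q} → 0 < s → s < n → suc n ≡ suc s ℕ.+ q → Describes (band false q 0) (suc n) (ext s π)
  band-start {s} 0<s s<n@(s≤s {n = m} s≤m) eq = band-next p base {a = false} z≤n s<n eq 0-live
    (λ a≤s a≢0 → dsc-kills p base z≤n s<n d refl (n≢0⇒n>0 a≢0) a≤s)
    (0 , n , subst₂ (Dsc _) (bump-< 0<s) (bump-≥ s≤m) (dsc-old d) , s≤s z≤n , refl)
    λ (x , y , a , _ , y≤s) → no-asc′ a y≤s
    where
    d : Dsc π 0 m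
    d = dsc-above p base z≤n s<n z≤n (<-≤-trans 0<s s≤m) ≤-refl
    no-asc′ : ∀ {x y} → Asc (ext s π) x y → y < suc s → ⊥
    no-asc′ a y≤s with asc-ext⁻ a
    ... | old a′    = no-asc a′
    ... | new _ s≤y = <⇒≱ y≤s (s≤s s≤y)

step-decr : ∀ m {n π} → Perm n π → Describes (decr m) n π → Step (decr m) n π
step-decr m {n} {π} p (refl , no-asc , live) = record
  { sites = n ∷ safeSites {c = 0} {p = m} refl
  ; sites-unique = topSites-unique {c = 0} {p = m} refl
  ; sound = λ a∈ → proj₂ (∈-topSites⁻ {c = 0} {p = m} refl a∈) , live
  ; complete = λ a≤n _ → ∈-topSites⁺ {c = 0} {p = m} refl z≤n a≤n
  ; match = match m refl }
  where
  match : ∀ m (eq : n ≡ 0 ℕ.+ m) → Pointwise (λ a ρ → Describes ρ (suc n) (ext a π)) (n ∷ safeSites {c = 0} {p = m} eq) (kids (decr m))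
  match zero    refl = decr-top p no-asc live ∷ []
  match (suc m) refl = decr-top p no-asc live
    ∷ subst (λ s → Describes (fresh n) (suc n) (ext s π)) (sym (n∸n≡0 m)) (fresh-next p no-asc live (s≤s z≤n))
    ∷ pointwise-applyDownFrom m λ {i} i<m → band-start p no-asc live
        (m<n⇒0<n∸m i<m) (safeSite< {c = 0} {p = suc m} refl (m<n⇒m<1+n i<m)) (safeSite+ {c = 0} {p = suc m} refl (m<n⇒m<1+n i<m))

step : ∀ σ {n π} → Perm n π → Describes σ n π → Step σ n π
step (inner k)    = step-inner k
step (dull q)     = step-dull q
step (decr m)     = step-decr m
step (fresh q)    = step-fresh q
step (chain q)    = step-chain q
step (late q)     = step-late q
step (stuck q)    = step-stuck q
step (band a e j) = step-band a e j

-- Levels of the generating tree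

record Growth (n : ℕ) (L : List (List ℕ)) (xs : List State) : Set where
  field
    next-level : List (List ℕ)
    distinct   : Unique L → Unique next-level
    from-level : ∀ {ρ} → ρ ∈ next-level → ∃₂ λ a π → π ∈ L × a ≤ n × ¬ Dead a π × ρ ≡ ext a π
    to-level   : ∀ {a π} → π ∈ L → a ≤ n → ¬ Dead a π → ext a π ∈ next-level
    described  : Pointwise (λ π σ → Describes σ (suc n) π) next-level (concatMap kids xs)

-- Children of different parents are distinct because `ext-injective` recovers the parent; this
-- keeps the levels free of repetitions.
grow : ∀ {n L xs} → All (Avoider n) L → Pointwise (λ π σ → Describes σ n π) L xs → Growth n L xs
grow [] [] = record
  { next-level = [] ; distinct = λ _ → [] ; from-level = λ () ; to-level = λ () ; described = [] }
grow {n} {π ∷ L} {σ ∷ xs} (av ∷ avs) (d ∷ ds) = record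
  { next-level = map (λ a → ext a π) sites ++ next-level
  ; distinct = dist ; from-level = fr ; to-level = to
  ; described = Pointwise.++⁺ (subst (Pointwise _ _) (map-id _) (Pointwise.map⁺ (λ a → ext a π) id match)) described }
  where
  open Step (step σ (Avoider.perm av) d)
  open Growth (grow avs ds)
  dist : Unique (π ∷ L) → Unique (map (λ a → ext a π) sites ++ next-level)
  dist (π∉L ∷ uL) = Unique.++⁺ (Unique.map⁺ (proj₁ ∘ ext-injective) sites-unique) (distinct uL) disjoint
    where
    disjoint : ∀ {ρ} → ¬ (ρ ∈ map (λ a → ext a π) sites × ρ ∈ next-level)
    disjoint (ρ∈ , ρ∈′) with ∈-map⁻ (λ a → ext a π) ρ∈ | from-level ρ∈′
    ... | a , _ , refl | b , π′ , π′∈ , _ , _ , eq = All.lookup π∉L π′∈ (proj₂ (ext-injective eq))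
  fr : ∀ {ρ} → ρ ∈ map (λ a → ext a π) sites ++ next-level →
       ∃₂ λ a π′ → π′ ∈ π ∷ L × a ≤ n × ¬ Dead a π′ × ρ ≡ ext a π′
  fr ρ∈ with ∈-++⁻ (map (λ a → ext a π) sites) ρ∈
  ... | inj₁ m with ∈-map⁻ (λ a → ext a π) m
  ...   | a , a∈ , eq = a , π , here refl , proj₁ (sound a∈) , proj₂ (sound a∈) , eq
  fr ρ∈ | inj₂ m = let a , π′ , π′∈ , r = from-level m in a , π′ , there π′∈ , r
  to : ∀ {a π′} → π′ ∈ π ∷ L → a ≤ n → ¬ Dead a π′ → ext a π′ ∈ map (λ a → ext a π) sites ++ next-level
  to (here refl) a≤n ¬d = ∈-++⁺ˡ (∈-map⁺ (λ a → ext a π) (complete a≤n ¬d))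
  to (there π′∈) a≤n ¬d = ∈-++⁺ʳ (map (λ a → ext a π) sites) (to-level π′∈ a≤n ¬d)

states : ℕ → List State
states zero    = decr 0 ∷ []
states (suc n) = concatMap kids (states n)

record Level (n : ℕ) : Set where
  field
    perms    : List (List ℕ)
    distinct : Unique perms
    sound    : ∀ {π} → π ∈ perms → Avoider n π
    complete : ∀ {π} → Avoider n π → π ∈ perms
    described : Pointwise (λ π σ → Describes σ n π) perms (states n)

level : ∀ n → Level n
level zero = record
  { perms = [] ∷ [] ; distinct = [] ∷ []
  ; sound = λ { (here refl) → record { perm = record { unique = [] ; bound = λ () ; full = λ () } ; ¬bad = ¬bad-[] } }
  ; complete = λ av → here (no-members (λ v∈ → n≮0 (bound (Avoider.perm av) v∈)))
  ; described = (refl , (λ { (_ , ()) }) , ¬dead-[]) ∷ [] }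
  where
  ¬bad-[] : ¬ Bad []
  ¬bad-[] (bad₁ () _ _ _)
  ¬bad-[] (bad₂ () _ _ _)
  ¬bad-[] (bad₃ () _ _ _)
  ¬dead-[] : ∀ {a} → ¬ Dead a []
  ¬dead-[] (dead₁ () _ _ _)
  ¬dead-[] (dead₂ () _ _ _)
  ¬dead-[] (dead₃ () _ _ _)
  no-members : ∀ {π : List ℕ} → (∀ {v} → ¬ v ∈ π) → π ≡ []
  no-members {[]}    _ = refl
  no-members {v ∷ π} h = ⊥-elim (h (here refl))
level (suc n) = record
  { perms = next-level ; distinct = G.distinct distinct ; sound = snd ; complete = comp ; described = G.described }
  where
  open Level (level n)
  module G = Growth (grow (All.tabulate sound) described)
  open G using (next-level)
  snd : ∀ {ρ} → ρ ∈ next-level → Avoider (suc n) ρ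
  snd ρ∈ with G.from-level ρ∈
  ... | a , π , π∈ , a≤n , ¬d , refl = record
    { perm = perm-ext a≤n (Avoider.perm (sound π∈))
    ; ¬bad = [ Avoider.¬bad (sound π∈) , ¬d ]′ ∘ bad-ext⁻ }
  comp : ∀ {ρ} → Avoider (suc n) ρ → ρ ∈ next-level
  comp av with ext-perm⁻ (Avoider.perm av)
  ... | a , π , a≤n , p , refl = G.to-level
    (complete (record { perm = p ; ¬bad = Avoider.¬bad av ∘ bad-ext })) a≤n (Avoider.¬bad av ∘ dead⇒bad)

card-states : ∀ n → HasCard (InSnT T n) (length (states n))
card-states n = perms , distinct , (λ π → mk⇔ (avoider⇒inSnT ∘ sound) (complete ∘ inSnT⇒avoider)) , Pointwise.Pointwise-length described
  where open Level (level n)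

count : ℕ → State → ℕ
count zero    σ = 1
count (suc d) σ = sum (map (count d) (kids σ))

sum-concatMap : ∀ d xs → sum (map (count d) (concatMap kids xs)) ≡ sum (map (count (suc d)) xs)
sum-concatMap d []       = refl
sum-concatMap d (σ ∷ xs) = begin
  sum (map (count d) (kids σ ++ concatMap kids xs))                        ≡⟨ cong sum (map-++ (count d) (kids σ) _) ⟩
  sum (map (count d) (kids σ) ++ map (count d) (concatMap kids xs))        ≡⟨ sum-++ (map (count d) (kids σ)) _ ⟩
  count (suc d) σ ℕ.+ sum (map (count d) (concatMap kids xs))                ≡⟨ cong (count (suc d) σ ℕ.+_) (sum-concatMap d xs) ⟩
  count (suc d) σ ℕ.+ sum (map (count (suc d)) xs)                           ∎
  where open ≡-Reasoning

-- The free depth `d` lets the induction trade a level for a unit of depth; `d = 0` gives the size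
-- of the level.
sum-states : ∀ n d → sum (map (count d) (states n)) ≡ count (d ℕ.+ n) (decr 0)
sum-states zero    d = trans (+-identityʳ _) (cong (λ m → count m (decr 0)) (sym (+-identityʳ d)))
sum-states (suc n) d = trans (sum-concatMap d (states n))
  (trans (sum-states n (suc d)) (cong (λ m → count m (decr 0)) (sym (+-suc d n))))

length-states : ∀ n → length (states n) ≡ count n (decr 0)
length-states n = trans (sym (sum-ones (states n))) (sum-states n 0)
  where
  sum-ones : ∀ xs → sum (map (count 0) xs) ≡ length xs
  sum-ones []       = refl
  sum-ones (_ ∷ xs) = cong suc (sum-ones xs)

-- Power series

-- [convSum] is defined through a local function; unification recovers it as [partial].
mutual
  partial : (ℕ → ℕ → ℤ) → ℕ → ℕ → ℤ
  partial = _

  convSum-suc : ∀ f n → convSum f (suc n) ≡ f (suc n) (n ℕ.∸ n) + partial f (suc n) n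
  convSum-suc f n with suc n
  ... | N = refl

convSum-partial : ∀ f n → convSum f n ≡ partial f n n
convSum-partial f zero    = refl
convSum-partial f (suc n) = refl

partial-shift : ∀ f n i → i ℕ.≤ n → partial f (suc n) i ≡ partial (λ i j → f i (suc j)) n i
partial-shift f n zero    _   = refl
partial-shift f n (suc i) i<n =
  cong₂ _+_ (cong (f (suc i)) (ℕ.+-∸-assoc 1 i<n)) (partial-shift f n i (ℕ.<⇒≤ i<n))

-- Splitting off the constant term of `b` leaves a convolution with its tail, which is the form that
-- the inductions below use.
⊛-suc : ∀ a b n → (a ⊛ b) (suc n) ≡ a (suc n) * b 0 + (a ⊛ λ i → b (suc i)) n
⊛-suc a b n = cong₂ _+_ (cong (λ i → a (suc n) * b i) (ℕ.n∸n≡0 n))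
  (trans (partial-shift (λ i j → a i * b j) n n ℕ.≤-refl) (sym (convSum-partial (λ i j → a i * b (suc j)) n)))

⊛-congˡ : ∀ {a a′} b → (∀ n → a n ≡ a′ n) → ∀ n → (a ⊛ b) n ≡ (a′ ⊛ b) n
⊛-congˡ b eq zero = cong (_* b 0) (eq 0)
⊛-congˡ {a} {a′} b eq (suc n) = begin
  (a ⊛ b) (suc n)                                ≡⟨ ⊛-suc a b n ⟩
  a (suc n) * b 0 + (a ⊛ λ i → b (suc i)) n      ≡⟨ cong₂ _+_ (cong (_* b 0) (eq (suc n))) (⊛-congˡ (λ i → b (suc i)) eq n) ⟩
  a′ (suc n) * b 0 + (a′ ⊛ λ i → b (suc i)) n    ≡⟨ ⊛-suc a′ b n ⟨
  (a′ ⊛ b) (suc n)                               ∎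
  where open ≡-Reasoning

lin : ℤ → Series
lin c = poly (+ 1 ∷ c ∷ [])

-- Multiplication by 1 + c x.
Δ : ℤ → Series → Series
Δ c a zero    = a zero
Δ c a (suc n) = a (suc n) + c * a n

Δ-cong : ∀ c {a a′} → (∀ n → a n ≡ a′ n) → ∀ n → Δ c a n ≡ Δ c a′ n
Δ-cong c eq zero    = eq 0
Δ-cong c eq (suc n) = cong₂ _+_ (eq (suc n)) (cong (c *_) (eq n))

lin-⊛ : ∀ c b n → (lin c ⊛ b) n ≡ Δ c b n
lin-⊛ c b zero          = ℤ.*-identityˡ (b 0)
lin-⊛ c b (suc zero)    = trans (cong (_+_ (c * b 0)) (ℤ.*-identityˡ (b 1))) (ℤ.+-comm (c * b 0) (b 1))
lin-⊛ c b (suc (suc n)) = begin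
  (lin c ⊛ b) (2 ℕ.+ n)                              ≡⟨ ⊛-suc (lin c) b (suc n) ⟩
  + 0 * b 0 + (lin c ⊛ λ i → b (suc i)) (suc n)      ≡⟨ cong₂ _+_ (ℤ.*-zeroˡ (b 0)) (lin-⊛ c (λ i → b (suc i)) (suc n)) ⟩
  + 0 + Δ c b (2 ℕ.+ n)                              ≡⟨ ℤ.+-identityˡ _ ⟩
  Δ c b (2 ℕ.+ n)                                    ∎
  where open ≡-Reasoning

-- Associativity for one linear factor; iterated, it lets `denom` act on a series factor by factor.
Δ-⊛ : ∀ c a b n → (Δ c a ⊛ b) n ≡ Δ c (a ⊛ b) n
Δ-⊛ c a b zero       = refl
Δ-⊛ c a b (suc zero) = arith (a 1) (a 0) (b 0) (b 1) c
  where
  arith : ∀ x y u v c → (x + c * y) * u + y * v ≡ (x * u + y * v) + c * (y * u)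
  arith = solve-∀
Δ-⊛ c a b (suc (suc n)) = begin
  (Δ c a ⊛ b) (2 ℕ.+ n)                                         ≡⟨ ⊛-suc (Δ c a) b (suc n) ⟩
  (a (2 ℕ.+ n) + c * a (suc n)) * b 0 + (Δ c a ⊛ b′) (suc n)    ≡⟨ cong (_+_ ((a (2 ℕ.+ n) + c * a (suc n)) * b 0)) (Δ-⊛ c a b′ (suc n)) ⟩
  (a (2 ℕ.+ n) + c * a (suc n)) * b 0 + ((a ⊛ b′) (suc n) + c * (a ⊛ b′) n)
    ≡⟨ arith (a (2 ℕ.+ n)) (a (suc n)) (b 0) ((a ⊛ b′) (suc n)) ((a ⊛ b′) n) c ⟩
  (a (2 ℕ.+ n) * b 0 + (a ⊛ b′) (suc n)) + c * (a (suc n) * b 0 + (a ⊛ b′) n)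
    ≡⟨ cong₂ (λ u v → u + c * v) (⊛-suc a b (suc n)) (⊛-suc a b n) ⟨
  Δ c (a ⊛ b) (2 ℕ.+ n)                                         ∎
  where
  open ≡-Reasoning
  b′ : Series
  b′ i = b (suc i)
  arith : ∀ x y u v w c → (x + c * y) * u + (v + c * w) ≡ (x * u + v) + c * (y * u + w)
  arith = solve-∀

Δ^ : ℤ → ℕ → Series → Series
Δ^ c zero    a = a
Δ^ c (suc k) a = Δ c (Δ^ c k a)

Δ^-cong : ∀ c k {a a′} → (∀ n → a n ≡ a′ n) → ∀ n → Δ^ c k a n ≡ Δ^ c k a′ n
Δ^-cong c zero    eq = eq
Δ^-cong c (suc k) eq = Δ-cong c (Δ^-cong c k eq)

one-⊛ : ∀ b n → (poly (+ 1 ∷ []) ⊛ b) n ≡ b n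
one-⊛ b zero    = ℤ.*-identityˡ (b 0)
one-⊛ b (suc n) = trans (⊛-suc (poly (+ 1 ∷ [])) b n)
  (trans (cong₂ _+_ (ℤ.*-zeroˡ (b 0)) (one-⊛ (λ i → b (suc i)) n)) (ℤ.+-identityˡ _))

lin^-⊛ : ∀ c k b n → ((lin c ^ˢ k) ⊛ b) n ≡ Δ^ c k b n
lin^-⊛ c zero    b n = one-⊛ b n
lin^-⊛ c (suc k) b n = begin
  ((lin c ⊛ (lin c ^ˢ k)) ⊛ b) n   ≡⟨ ⊛-congˡ b (lin-⊛ c (lin c ^ˢ k)) n ⟩
  (Δ c (lin c ^ˢ k) ⊛ b) n         ≡⟨ Δ-⊛ c (lin c ^ˢ k) b n ⟩
  Δ c ((lin c ^ˢ k) ⊛ b) n         ≡⟨ Δ-cong c (lin^-⊛ c k b) n ⟩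
  Δ^ c (suc k) b n                 ∎
  where open ≡-Reasoning

Δ^-⊛ : ∀ c k a b n → (Δ^ c k a ⊛ b) n ≡ Δ^ c k (a ⊛ b) n
Δ^-⊛ c zero    a b n = refl
Δ^-⊛ c (suc k) a b n = trans (Δ-⊛ c (Δ^ c k a) b n) (Δ-cong c (Δ^-⊛ c k a b) n)

denom-⊛ : ∀ g n → (denom ⊛ g) n ≡ Δ^ (- + 1) 6 (Δ^ (- + 2) 2 g) n
denom-⊛ g n = begin
  (((lin (- + 1) ^ˢ 6) ⊛ q²) ⊛ g) n        ≡⟨ ⊛-congˡ g (lin^-⊛ (- + 1) 6 q²) n ⟩
  (Δ^ (- + 1) 6 q² ⊛ g) n                  ≡⟨ Δ^-⊛ (- + 1) 6 q² g n ⟩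
  Δ^ (- + 1) 6 (q² ⊛ g) n                  ≡⟨ Δ^-cong (- + 1) 6 (lin^-⊛ (- + 2) 2 g) n ⟩
  Δ^ (- + 1) 6 (Δ^ (- + 2) 2 g) n          ∎
  where
  open ≡-Reasoning
  q² : Series
  q² = lin (- + 2) ^ˢ 2

-- Counting the nodes of the tree

bin : ℕ → ℕ → ℤ
bin zero    d       = + 1
bin (suc i) zero    = + 0
bin (suc i) (suc d) = bin (suc i) d + bin i d

-- dp d = d 2ᵈ
pw dp : ℕ → ℤ
pw zero    = + 1
pw (suc d) = pw d + pw d
dp zero    = + 0
dp (suc d) = (dp d + pw d) + (dp d + pw d)

-- The solutions of the linear recurrences given by `classKids`, with value 1 at depth 0.
classCount : Class → ℕ → ℤ
classCount k₀ d = + 3 * pw d - bin 1 d - + 2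
classCount k₁ d = + 2 * pw d - + 1
classCount k₂ d = pw d
classCount k₃ d = + 2 * pw d - + 1
classCount k₄ d = bin 1 d + + 1
classCount k₅ d = pw d + bin 1 d
classCount k₆ d = + 1
classCount k₇ d = + 2 * pw d - bin 1 d - + 1

sum-inner : ∀ d ks → (∀ k → + count d (inner k) ≡ classCount k d) →
            + sum (map (count d) (map inner ks)) ≡ foldr (λ k → _+_ (classCount k d)) (+ 0) ks
sum-inner d []       eq = refl
sum-inner d (k ∷ ks) eq = cong₂ _+_ (eq k) (sum-inner d ks eq)

classCount-suc : ∀ k d → foldr (λ k → _+_ (classCount k d)) (+ 0) (classKids k) ≡ classCount k (suc d)
classCount-suc k₀ d = arith (pw d) (bin 1 d)
  where
  arith : ∀ e x → (+ 3 * e - x - + 2) + ((+ 2 * e - + 1) + (e + + 0)) ≡ + 3 * (e + e) - (x + + 1) - + 2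
  arith = solve-∀
classCount-suc k₁ d = arith (pw d)
  where
  arith : ∀ e → e + ((+ 2 * e - + 1) + (e + + 0)) ≡ + 2 * (e + e) - + 1
  arith = solve-∀
classCount-suc k₂ d = cong (_+_ (pw d)) (ℤ.+-identityʳ (pw d))
classCount-suc k₃ d = arith (pw d) (bin 1 d)
  where
  arith : ∀ e x → (+ 3 * e - x - + 2) + ((e + x) + + 1) ≡ + 2 * (e + e) - + 1
  arith = solve-∀
classCount-suc k₄ d = refl
classCount-suc k₅ d = arith (pw d) (bin 1 d)
  where
  arith : ∀ e x → e + ((e + x) + + 1) ≡ e + e + (x + + 1)
  arith = solve-∀
classCount-suc k₆ d = refl
classCount-suc k₇ d = arith (pw d) (bin 1 d)
  where
  arith : ∀ e x → (+ 3 * e - x - + 2) + (e + + 0) ≡ + 2 * (e + e) - (x + + 1) - + 1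
  arith = solve-∀

inner-count : ∀ d k → + count d (inner k) ≡ classCount k d
inner-count zero k₀ = refl
inner-count zero k₁ = refl
inner-count zero k₂ = refl
inner-count zero k₃ = refl
inner-count zero k₄ = refl
inner-count zero k₅ = refl
inner-count zero k₆ = refl
inner-count zero k₇ = refl
inner-count (suc d) k = trans (sum-inner d (classKids k) (inner-count d)) (classCount-suc k d)

-- These are ballot numbers, because `dull` obeys the rule p → 1, ..., p + 1.
ballot : ℕ → ℕ → ℕ
ballot p d = count d (dull p)

sumDown : ℕ → (ℕ → State) → ℕ → ℕ
sumDown d g p = sum (map (count d) (applyDownFrom g p))

dullSum : ℕ → ℕ → ℕ
dullSum d p = sumDown d (dull ∘ suc) p

-- A constant excess per child adds up to a multiple of the number of children; this is where the
-- slopes come from.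
sumDown-shift : ∀ d g p e → (∀ {i} → i < p → + count d (g i) ≡ + ballot (suc i) d + e) →
                + sumDown d g p ≡ + dullSum d p + + p * e
sumDown-shift d g zero    e eq = sym (trans (ℤ.+-identityˡ _) (ℤ.*-zeroˡ e))
sumDown-shift d g (suc p) e eq =
  trans (cong₂ _+_ (eq ℕ.≤-refl) (sumDown-shift d g p e (eq ∘ ℕ.m<n⇒m<1+n))) (arith (+ ballot (suc p) d) e (+ dullSum d p) (+ p))
  where
  arith : ∀ a e b p → (a + e) + (b + p * e) ≡ (a + b) + (+ 1 + p) * e
  arith = solve-∀

-- The excesses below compare the number of descendants of a state with that of [dull p] with the same
-- number p + 1 of safe sites; they are affine in the parameters of the state.
stuckX slopeX chainX₀ freshX₀ bandX₁ decrX₀ decrX₁ : ℕ → ℤ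
bandX₀ : Bool → ℕ → ℤ

-- At depth 0 every state counts 1, so there is no excess. From depth 1 on the closed forms are
-- written in the depth minus one, which keeps their coefficients integral.
stuckX zero    = + 0
stuckX (suc d) = + 1 + + 2 * bin 1 d + bin 2 d

slopeX zero    = + 0
slopeX (suc d) = bin 1 d + + 2 * bin 2 d + bin 3 d

chainX₀ zero    = + 0
chainX₀ (suc d) = + 2 * pw d - + 1

freshX₀ zero    = + 0
freshX₀ (suc d) = + 2 * pw d + dp d - bin 1 d - + 1

bandX₀ a     zero    = + 0
bandX₀ false (suc d) = + 1 + bin 1 d + bin 2 d + dp d
bandX₀ true  (suc d) = + 1 + dp d

bandX₁ zero    = + 0
bandX₁ (suc d) = + 2 + bin 1 d - + 2 * pw d + dp d

decrX₀ zero    = + 0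
decrX₀ (suc d) = + 2 - bin 2 d + bin 3 d + + 3 * bin 4 d + bin 5 d - + 2 * pw d + dp d

decrX₁ zero    = + 0
decrX₁ (suc d) = + 2 + bin 1 d + + 2 * bin 2 d + + 3 * bin 3 d + bin 4 d - + 2 * pw d + dp d

-- This and the next identities are what the inductions of the counting lemmas leave over once the
-- ballot numbers are matched, separately for constant term and slope.
stuckX-suc : ∀ d → classCount k₄ d + stuckX d ≡ stuckX (suc d)
stuckX-suc zero    = refl
stuckX-suc (suc d) = arith (bin 1 d) (bin 2 d)
  where
  arith : ∀ x y → ((x + + 1) + + 1) + (+ 1 + + 2 * x + y) ≡ + 1 + + 2 * (x + + 1) + (y + x)
  arith = solve-∀

slopeX-suc : ∀ d → slopeX d + stuckX d ≡ slopeX (suc d)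
slopeX-suc zero    = refl
slopeX-suc (suc d) = arith (bin 1 d) (bin 2 d) (bin 3 d)
  where
  arith : ∀ x y z → (x + + 2 * y + z) + (+ 1 + + 2 * x + y) ≡ (x + + 1) + + 2 * (y + x) + (z + y)
  arith = solve-∀

chainX₀-suc : ∀ d → classCount k₂ d + chainX₀ d ≡ chainX₀ (suc d)
chainX₀-suc zero    = refl
chainX₀-suc (suc d) = arith (pw d)
  where
  arith : ∀ e → (e + e) + (+ 2 * e - + 1) ≡ + 2 * (e + e) - + 1
  arith = solve-∀

bandX₁-suc : ∀ d → bandX₁ d + bandX₀ true d ≡ bandX₁ (suc d)
bandX₁-suc zero    = refl
bandX₁-suc (suc d) = arith (bin 1 d) (pw d) (dp d)
  where
  arith : ∀ x e f → (+ 2 + x - + 2 * e + f) + (+ 1 + f) ≡ + 2 + (x + + 1) - + 2 * (e + e) + ((f + e) + (f + e))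
  arith = solve-∀

bandX₀-suc : ∀ a d → classCount (bandClass a) d + (bandX₀ a d + bandX₁ d) ≡ bandX₀ a (suc d)
bandX₀-suc false zero    = refl
bandX₀-suc true  zero    = refl
bandX₀-suc false (suc d) = arith (bin 1 d) (bin 2 d) (pw d) (dp d)
  where
  arith : ∀ x y e f → (+ 2 * (e + e) - + 1) + ((+ 1 + x + y + f) + (+ 2 + x - + 2 * e + f)) ≡
                      + 1 + (x + + 1) + (y + x) + ((f + e) + (f + e))
  arith = solve-∀
bandX₀-suc true (suc d) = arith (bin 1 d) (pw d) (dp d)
  where
  arith : ∀ x e f → (+ 2 * (e + e) - (x + + 1) - + 1) + ((+ 1 + f) + (+ 2 + x - + 2 * e + f)) ≡
                    + 1 + ((f + e) + (f + e))
  arith = solve-∀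

-- `fresh (suc m)` has only `m` children of type `late`. Counting them as `suc m` less one gives the
-- slope `stuckX d` and subtracts it from the constant term.
freshX₀-suc : ∀ d → classCount k₀ d + (bandX₀ false d + bandX₁ d) + (chainX₀ d - stuckX d) ≡ freshX₀ (suc d)
freshX₀-suc zero    = refl
freshX₀-suc (suc d) = arith (bin 1 d) (bin 2 d) (pw d) (dp d)
  where
  arith : ∀ x y e f → (+ 3 * (e + e) - (x + + 1) - + 2) + ((+ 1 + x + y + f) + (+ 2 + x - + 2 * e + f))
                      + ((+ 2 * e - + 1) - (+ 1 + + 2 * x + y)) ≡
                      + 2 * (e + e) + ((f + e) + (f + e)) - (x + + 1) - + 1
  arith = solve-∀

decrX₁-suc : ∀ d → decrX₁ d + slopeX d + bandX₀ false d ≡ decrX₁ (suc d)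
decrX₁-suc zero    = refl
decrX₁-suc (suc d) = arith (bin 1 d) (bin 2 d) (bin 3 d) (bin 4 d) (pw d) (dp d)
  where
  arith : ∀ x y z w e f →
    (+ 2 + x + + 2 * y + + 3 * z + w - + 2 * e + f) + (x + + 2 * y + z) + (+ 1 + x + y + f) ≡
    + 2 + (x + + 1) + + 2 * (y + x) + + 3 * (z + y) + (w + z) - + 2 * (e + e) + ((f + e) + (f + e))
  arith = solve-∀

-- The first child has a parameter larger by one, which adds `decrX₁ d`; the `m` bands count as
-- `suc m` less one, which subtracts `bandX₀ false d`.
decrX₀-suc : ∀ d → decrX₀ d + decrX₁ d + freshX₀ d - bandX₀ false d ≡ decrX₀ (suc d)
decrX₀-suc zero    = refl
decrX₀-suc (suc d) = arith (bin 1 d) (bin 2 d) (bin 3 d) (bin 4 d) (bin 5 d) (pw d) (dp d)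
  where
  arith : ∀ x y z w v e f →
    (+ 2 - y + z + + 3 * w + v - + 2 * e + f) + (+ 2 + x + + 2 * y + + 3 * z + w - + 2 * e + f)
      + (+ 2 * e + f - x - + 1) - (+ 1 + x + y + f) ≡
    + 2 - (y + x) + (z + y) + + 3 * (w + z) + (v + w) - + 2 * (e + e) + ((f + e) + (f + e))
  arith = solve-∀

stuck-count : ∀ d q → + count d (stuck q) ≡ + ballot q d + stuckX d
stuck-count zero    q = refl
stuck-count (suc d) q = begin
  + count d (inner k₄) + (+ count d (stuck (suc q)) + S)          ≡⟨ cong₂ (λ u v → u + (v + S)) (inner-count d k₄) (stuck-count d (suc q)) ⟩
  classCount k₄ d + ((+ ballot (suc q) d + stuckX d) + S)         ≡⟨ arith (classCount k₄ d) (+ ballot (suc q) d) (stuckX d) S ⟩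
  (+ ballot (suc q) d + S) + (classCount k₄ d + stuckX d)         ≡⟨ cong (_+_ (+ ballot (suc q) d + S)) (stuckX-suc d) ⟩
  + ballot q (suc d) + stuckX (suc d)                             ∎
  where
  open ≡-Reasoning
  S = + dullSum d q
  arith : ∀ c b x s → c + ((b + x) + s) ≡ (b + s) + (c + x)
  arith = solve-∀

late-count : ∀ d q → + count d (late q) ≡ + ballot q d + stuckX d
late-count zero    q = refl
late-count (suc d) q = stuck-count (suc d) q

chain-count : ∀ d m → + count d (chain (suc m)) ≡ + ballot (suc m) d + (chainX₀ d + + suc m * slopeX d)
chain-count zero    m = cong (_+_ (+ 1)) (sym (trans (ℤ.+-identityˡ _) (ℤ.*-zeroʳ (+ suc m))))
chain-count (suc d) m = begin
  + count d (inner k₂) + (+ count d (stuck (2 ℕ.+ m)) + (+ count d (chain (suc m)) + + sumDown d (late ∘ suc) m))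
    ≡⟨ cong₂ (λ u v → u + v) (inner-count d k₂) (cong₂ _+_ (stuck-count d (2 ℕ.+ m))
         (cong₂ _+_ (chain-count d m) (sumDown-shift d (late ∘ suc) m (stuckX d) (λ {i} _ → late-count d (suc i))))) ⟩
  classCount k₂ d + ((b + stuckX d) + ((b′ + (chainX₀ d + + suc m * slopeX d)) + (S + + m * stuckX d)))
    ≡⟨ arith (classCount k₂ d) b (stuckX d) b′ (chainX₀ d) (+ m) (slopeX d) S ⟩
  (b + (b′ + S)) + ((classCount k₂ d + chainX₀ d) + + suc m * (slopeX d + stuckX d))
    ≡⟨ cong₂ (λ u v → (b + (b′ + S)) + (u + + suc m * v)) (chainX₀-suc d) (slopeX-suc d) ⟩
  + ballot (suc m) (suc d) + (chainX₀ (suc d) + + suc m * slopeX (suc d)) ∎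
  where
  open ≡-Reasoning
  b = + ballot (2 ℕ.+ m) d
  b′ = + ballot (suc m) d
  S = + dullSum d m
  arith : ∀ c b x b′ y m s S → c + ((b + x) + ((b′ + (y + (+ 1 + m) * s)) + (S + m * x))) ≡
                               (b + (b′ + S)) + ((c + y) + (+ 1 + m) * (s + x))
  arith = solve-∀

bandX : Bool → ℕ → ℕ → ℤ
bandX a j d = bandX₀ a d + + j * bandX₁ d

-- Only the `j` highest safe sites carry an excess. The induction on `e` strips off the lower ones,
-- which are `dull`.
bandEntry-sum : ∀ d j e x → (∀ i → + count d (band true (suc i) 0) ≡ + ballot (suc i) d + x) →
                + sumDown d (bandEntry j) (j ℕ.+ e) ≡ + dullSum d (j ℕ.+ e) + + j * x
bandEntry-sum d j zero x eq rewrite ℕ.+-identityʳ j = sumDown-shift d (bandEntry j) j x entry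
  where
  entry : ∀ {i} → i < j → + count d (bandEntry j i) ≡ + ballot (suc i) d + x
  entry {i} i<j with i <? j
  ... | yes _  = eq i
  ... | no i≮j = ⊥-elim (i≮j i<j)
bandEntry-sum d j (suc e) x eq rewrite ℕ.+-suc j e =
  trans (cong₂ _+_ entry (bandEntry-sum d j e x eq)) (sym (ℤ.+-assoc (+ ballot (suc (j ℕ.+ e)) d) (+ dullSum d (j ℕ.+ e)) (+ j * x)))
  where
  entry : + count d (bandEntry j (j ℕ.+ e)) ≡ + ballot (suc (j ℕ.+ e)) d
  entry with (j ℕ.+ e) <? j
  ... | yes lt = ⊥-elim (ℕ.<⇒≱ lt (ℕ.m≤m+n j e))
  ... | no _   = refl

band-count : ∀ d a e j → + count d (band a e j) ≡ + ballot (j ℕ.+ e) d + bandX a j d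
band-count zero    a e j = cong (_+_ (+ 1)) (sym (trans (ℤ.+-identityˡ _) (ℤ.*-zeroʳ (+ j))))
band-count (suc d) a e j = begin
  + count d (inner (bandClass a)) + (+ count d (band a e (suc j)) + + sumDown d (bandEntry j) (j ℕ.+ e))
    ≡⟨ cong₂ _+_ (inner-count d (bandClass a)) (cong₂ _+_ (band-count d a e (suc j))
         (bandEntry-sum d j e (bandX₀ true d) λ i → trans (band-count d true (suc i) 0) (cong (_+_ (+ ballot (suc i) d)) (zero-slope (bandX₀ true d) (bandX₁ d))))) ⟩
  classCount (bandClass a) d + ((b + (bandX₀ a d + + suc j * bandX₁ d)) + (S + + j * bandX₀ true d))
    ≡⟨ arith (classCount (bandClass a) d) b (bandX₀ a d) (+ j) (bandX₁ d) S (bandX₀ true d) ⟩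
  (b + S) + ((classCount (bandClass a) d + (bandX₀ a d + bandX₁ d)) + + j * (bandX₁ d + bandX₀ true d))
    ≡⟨ cong₂ (λ u v → (b + S) + (u + + j * v)) (bandX₀-suc a d) (bandX₁-suc d) ⟩
  + ballot (j ℕ.+ e) (suc d) + bandX a j (suc d) ∎
  where
  open ≡-Reasoning
  b = + ballot (suc (j ℕ.+ e)) d
  S = + dullSum d (j ℕ.+ e)
  zero-slope : ∀ x y → x + + 0 * y ≡ x
  zero-slope = solve-∀
  arith : ∀ c b x j y S t → c + ((b + (x + (+ 1 + j) * y)) + (S + j * t)) ≡ (b + S) + ((c + (x + y)) + j * (y + t))
  arith = solve-∀

fresh-count : ∀ d m → + count d (fresh (suc m)) ≡ + ballot (suc m) d + (freshX₀ d + + suc m * slopeX d)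
fresh-count zero    m = cong (_+_ (+ 1)) (sym (trans (ℤ.+-identityˡ _) (ℤ.*-zeroʳ (+ suc m))))
fresh-count (suc d) m = begin
  + count d (inner k₀) + (+ count d (band false (suc m) 1) + (+ count d (chain (suc m)) + + sumDown d (late ∘ suc) m))
    ≡⟨ cong₂ _+_ (inner-count d k₀) (cong₂ _+_ (band-count d false (suc m) 1)
         (cong₂ _+_ (chain-count d m) (sumDown-shift d (late ∘ suc) m (stuckX d) (λ {i} _ → late-count d (suc i))))) ⟩
  classCount k₀ d + ((b + (bandX₀ false d + + 1 * bandX₁ d)) + ((b′ + (chainX₀ d + + suc m * slopeX d)) + (S + + m * stuckX d)))
    ≡⟨ arith (classCount k₀ d) b (bandX₀ false d) (bandX₁ d) (stuckX d) b′ (chainX₀ d) (+ m) (slopeX d) S ⟩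
  (b + (b′ + S)) + ((classCount k₀ d + (bandX₀ false d + bandX₁ d) + (chainX₀ d - stuckX d)) + + suc m * (slopeX d + stuckX d))
    ≡⟨ cong₂ (λ u v → (b + (b′ + S)) + (u + + suc m * v)) (freshX₀-suc d) (slopeX-suc d) ⟩
  + ballot (suc m) (suc d) + (freshX₀ (suc d) + + suc m * slopeX (suc d)) ∎
  where
  open ≡-Reasoning
  b = + ballot (2 ℕ.+ m) d
  b′ = + ballot (suc m) d
  S = + dullSum d m
  arith : ∀ c b p q x b′ y m s S → c + ((b + (p + + 1 * q)) + ((b′ + (y + (+ 1 + m) * s)) + (S + m * x))) ≡
                               (b + (b′ + S)) + ((c + (p + q) + (y - x)) + (+ 1 + m) * (s + x))
  arith = solve-∀

decr-count : ∀ d m → + count d (decr (suc m)) ≡ + ballot (suc m) d + (decrX₀ d + + suc m * decrX₁ d)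
decr-count zero    m = cong (_+_ (+ 1)) (sym (trans (ℤ.+-identityˡ _) (ℤ.*-zeroʳ (+ suc m))))
decr-count (suc d) m = begin
  + count d (decr (2 ℕ.+ m)) + (+ count d (fresh (suc m)) + + sumDown d (λ i → band false (suc i) 0) m)
    ≡⟨ cong₂ _+_ (decr-count d (suc m)) (cong₂ _+_ (fresh-count d m)
         (sumDown-shift d (λ i → band false (suc i) 0) m (bandX₀ false d + + 0 * bandX₁ d) (λ {i} _ → band-count d false (suc i) 0))) ⟩
  (b + (decrX₀ d + + (2 ℕ.+ m) * decrX₁ d)) + ((b′ + (freshX₀ d + + suc m * slopeX d)) + (S + + m * (bandX₀ false d + + 0 * bandX₁ d)))
    ≡⟨ arith b (decrX₀ d) (decrX₁ d) b′ (freshX₀ d) (slopeX d) S (+ m) (bandX₀ false d) (bandX₁ d) ⟩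
  (b + (b′ + S)) + ((decrX₀ d + decrX₁ d + freshX₀ d - bandX₀ false d) + + suc m * (decrX₁ d + slopeX d + bandX₀ false d))
    ≡⟨ cong₂ (λ u v → (b + (b′ + S)) + (u + + suc m * v)) (decrX₀-suc d) (decrX₁-suc d) ⟩
  + ballot (suc m) (suc d) + (decrX₀ (suc d) + + suc m * decrX₁ (suc d)) ∎
  where
  open ≡-Reasoning
  b = + ballot (2 ℕ.+ m) d
  b′ = + ballot (suc m) d
  S = + dullSum d m
  arith : ∀ b x y b′ p s S m t u → (b + (x + (+ 2 + m) * y)) + ((b′ + (p + (+ 1 + m) * s)) + (S + m * (t + + 0 * u))) ≡
          (b + (b′ + S)) + ((x + y + p - t) + (+ 1 + m) * (y + s + t))
  arith = solve-∀

-- Ballot numbers and the Catalan numbers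

-- N C (d − 1), read as 0 when d = 0
lower : ℕ → ℕ → ℕ
lower N zero    = 0
lower N (suc d) = N C d

lower-pascal : ∀ N d → lower N d ℕ.+ N C d ≡ suc N C d
lower-pascal N zero    = refl
lower-pascal N (suc d) = nCk+nC[k+1]≡[n+1]C[k+1] N d

-- This is the reflection formula. `kids (dull (suc p))` is `dull (2 + p)` followed by
-- `kids (dull p)`, so the ballot recurrence holds by computation and runs parallel to Pascal's
-- rule. At `p = 0` the symmetry of row 2d + 1 replaces the missing neighbour.
ballot-binomial : ∀ d p N → N ≡ d ℕ.+ d ℕ.+ p → ballot p d ℕ.+ lower N d ≡ N C d
ballot-binomial zero    p N eq = refl
ballot-binomial (suc d) zero (suc N) eq = begin
  (ballot 1 d ℕ.+ 0) ℕ.+ suc N C d               ≡⟨ cong₂ ℕ._+_ (ℕ.+-identityʳ (ballot 1 d)) (sym (lower-pascal N d)) ⟩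
  ballot 1 d ℕ.+ (lower N d ℕ.+ N C d)           ≡⟨ ℕ.+-assoc (ballot 1 d) (lower N d) (N C d) ⟨
  (ballot 1 d ℕ.+ lower N d) ℕ.+ N C d           ≡⟨ cong (ℕ._+ N C d) (ballot-binomial d 1 N N≡) ⟩
  N C d ℕ.+ N C d                                ≡⟨ cong (N C d ℕ.+_) (trans (cong (N C_) (sym N∸d)) (sym (nCk≡nC[n∸k] d<N))) ⟩
  N C d ℕ.+ N C suc d                            ≡⟨ nCk+nC[k+1]≡[n+1]C[k+1] N d ⟩
  suc N C suc d                                  ∎
  where
  open ≡-Reasoning
  arith : ∀ d → d ℕ.+ suc d ℕ.+ 0 ≡ d ℕ.+ d ℕ.+ 1
  arith = ℕSolver.solve-∀
  N≡ : N ≡ d ℕ.+ d ℕ.+ 1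
  N≡ = trans (ℕ.suc-injective eq) (arith d)
  N≡′ : N ≡ d ℕ.+ suc d
  N≡′ = trans (ℕ.suc-injective eq) (ℕ.+-identityʳ _)
  d<N : suc d ℕ.≤ N
  d<N = subst (suc d ℕ.≤_) (sym N≡′) (ℕ.m≤n+m (suc d) d)
  N∸d : N ℕ.∸ suc d ≡ d
  N∸d = trans (cong (ℕ._∸ suc d) N≡′) (ℕ.m+n∸n≡m d (suc d))
ballot-binomial (suc d) (suc p) (suc N) eq = begin
  (ballot (2 ℕ.+ p) d ℕ.+ ballot p (suc d)) ℕ.+ suc N C d
    ≡⟨ cong (ballot (2 ℕ.+ p) d ℕ.+ ballot p (suc d) ℕ.+_) (lower-pascal N d) ⟨
  (ballot (2 ℕ.+ p) d ℕ.+ ballot p (suc d)) ℕ.+ (lower N d ℕ.+ N C d)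
    ≡⟨ swap (ballot (2 ℕ.+ p) d) (ballot p (suc d)) (lower N d) (N C d) ⟩
  (ballot (2 ℕ.+ p) d ℕ.+ lower N d) ℕ.+ (ballot p (suc d) ℕ.+ N C d)
    ≡⟨ cong₂ ℕ._+_ (ballot-binomial d (2 ℕ.+ p) N (trans (ℕ.suc-injective eq) (arith₁ d p)))
                   (ballot-binomial (suc d) p N (trans (ℕ.suc-injective eq) (arith₂ d p))) ⟩
  N C d ℕ.+ N C suc d                            ≡⟨ nCk+nC[k+1]≡[n+1]C[k+1] N d ⟩
  suc N C suc d                                  ∎
  where
  open ≡-Reasoning
  swap : ∀ a b c e → (a ℕ.+ b) ℕ.+ (c ℕ.+ e) ≡ (a ℕ.+ c) ℕ.+ (b ℕ.+ e)
  swap = ℕSolver.solve-∀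
  arith₁ : ∀ d p → d ℕ.+ suc d ℕ.+ suc p ≡ d ℕ.+ d ℕ.+ (2 ℕ.+ p)
  arith₁ = ℕSolver.solve-∀
  arith₂ : ∀ d p → d ℕ.+ suc d ℕ.+ suc p ≡ suc (d ℕ.+ suc d ℕ.+ p)
  arith₂ = ℕSolver.solve-∀

absorption : ∀ n k → suc k ℕ.* (suc n C suc k) ≡ suc n ℕ.* (n C k)
absorption zero    zero    = refl
absorption zero    (suc k) = ℕ.*-zeroʳ (2 ℕ.+ k)
absorption (suc n) zero    = trans (ℕ.*-identityˡ _) (trans (nC1≡n (2 ℕ.+ n)) (sym (ℕ.*-identityʳ (2 ℕ.+ n))))
absorption (suc n) (suc k) = begin
  (2 ℕ.+ k) ℕ.* (suc (suc n) C suc (suc k))      ≡⟨ cong ((2 ℕ.+ k) ℕ.*_) (nCk+nC[k+1]≡[n+1]C[k+1] (suc n) (suc k)) ⟨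
  (2 ℕ.+ k) ℕ.* (u ℕ.+ v)                        ≡⟨ arith₁ k u v ⟩
  (suc k ℕ.* u ℕ.+ (2 ℕ.+ k) ℕ.* v) ℕ.+ u        ≡⟨ cong (ℕ._+ u) (cong₂ ℕ._+_ (absorption n k) (absorption n (suc k))) ⟩
  (suc n ℕ.* (n C k) ℕ.+ suc n ℕ.* (n C suc k)) ℕ.+ u
    ≡⟨ cong (ℕ._+ u) (ℕ.*-distribˡ-+ (suc n) (n C k) (n C suc k)) ⟨
  suc n ℕ.* (n C k ℕ.+ n C suc k) ℕ.+ u          ≡⟨ cong (λ w → suc n ℕ.* w ℕ.+ u) (nCk+nC[k+1]≡[n+1]C[k+1] n k) ⟩
  suc n ℕ.* u ℕ.+ u                              ≡⟨ ℕ.+-comm (suc n ℕ.* u) u ⟩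
  (2 ℕ.+ n) ℕ.* u                                ∎
  where
  open ≡-Reasoning
  u = suc n C suc k
  v = suc n C suc (suc k)
  arith₁ : ∀ k u v → (2 ℕ.+ k) ℕ.* (u ℕ.+ v) ≡ (suc k ℕ.* u ℕ.+ (2 ℕ.+ k) ℕ.* v) ℕ.+ u
  arith₁ = ℕSolver.solve-∀

-- The number `a` is the central binomial `M` minus its neighbour `L`. By absorption
-- `(2 + m) L = (1 + m) M`, so `M` is exactly `a (2 + m)` and the division in `catalan` leaves no
-- remainder.
ballot-catalan : ∀ n → ballot 0 n ≡ catalan n
ballot-catalan zero    = refl
ballot-catalan (suc m) = sym (trans (/-congˡ {o = 2 ℕ.+ m} central) (m*n/n≡m a (2 ℕ.+ m)))
  where
  open ≡-Reasoning
  N = 2 ℕ.* suc m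
  a = ballot 0 (suc m)
  L = N C m
  M = N C suc m
  a+L : a ℕ.+ L ≡ M
  a+L = ballot-binomial (suc m) 0 N (arith m)
    where
    arith : ∀ m → 2 ℕ.* suc m ≡ suc m ℕ.+ suc m ℕ.+ 0
    arith = ℕSolver.solve-∀
  ratio : (2 ℕ.+ m) ℕ.* L ≡ suc m ℕ.* M
  ratio = ℕ.+-cancelˡ-≡ (suc m ℕ.* L) _ _ (begin
    suc m ℕ.* L ℕ.+ (2 ℕ.+ m) ℕ.* L     ≡⟨ arith m L ⟩
    suc N ℕ.* L                         ≡⟨ absorption N m ⟨
    suc m ℕ.* (suc N C suc m)           ≡⟨ cong (suc m ℕ.*_) (nCk+nC[k+1]≡[n+1]C[k+1] N m) ⟨
    suc m ℕ.* (L ℕ.+ M)                 ≡⟨ ℕ.*-distribˡ-+ (suc m) L M ⟩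
    suc m ℕ.* L ℕ.+ suc m ℕ.* M         ∎)
    where
    arith : ∀ m L → suc m ℕ.* L ℕ.+ (2 ℕ.+ m) ℕ.* L ≡ suc (2 ℕ.* suc m) ℕ.* L
    arith = ℕSolver.solve-∀
  central : M ≡ a ℕ.* (2 ℕ.+ m)
  central = ℕ.+-cancelʳ-≡ (suc m ℕ.* M) M _ (begin
    M ℕ.+ suc m ℕ.* M                       ≡⟨ cong ((2 ℕ.+ m) ℕ.*_) a+L ⟨
    (2 ℕ.+ m) ℕ.* (a ℕ.+ L)                 ≡⟨ arith m a L ⟩
    a ℕ.* (2 ℕ.+ m) ℕ.+ (2 ℕ.+ m) ℕ.* L     ≡⟨ cong (a ℕ.* (2 ℕ.+ m) ℕ.+_) ratio ⟩
    a ℕ.* (2 ℕ.+ m) ℕ.+ suc m ℕ.* M         ∎)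
    where
    arith : ∀ m a L → (2 ℕ.+ m) ℕ.* (a ℕ.+ L) ≡ a ℕ.* (2 ℕ.+ m) ℕ.+ (2 ℕ.+ m) ℕ.* L
    arith = ℕSolver.solve-∀

-- The excess over the Catalan numbers as a rational series

excess : Series
excess zero    = + 0
-- The root `decr 0` has the single child `decr 1`, whose parameter 1 multiplies the slope.
excess (suc d) = decrX₀ d + + 1 * decrX₁ d

decr-catalan : ∀ n → + count n (decr 0) + - + catalan n ≡ excess n
decr-catalan zero    = refl
decr-catalan (suc d) = begin
  + (count d (decr 1) ℕ.+ 0) + - + catalan (suc d)
    ≡⟨ cong₂ (λ u v → + u + - + v) (ℕ.+-identityʳ _) (trans (sym (ballot-catalan (suc d))) (ℕ.+-identityʳ _)) ⟩
  + count d (decr 1) + - + ballot 1 d              ≡⟨ cong (_+ - + ballot 1 d) (decr-count d 0) ⟩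
  (+ ballot 1 d + excess (suc d)) + - + ballot 1 d ≡⟨ arith (+ ballot 1 d) (excess (suc d)) ⟩
  excess (suc d)                                   ∎
  where
  open ≡-Reasoning
  arith : ∀ b x → (b + x) + - b ≡ x
  arith = solve-∀

record Coeffs : Set where
  constructor coeffs
  field
    b₀ b₁ b₂ b₃ b₄ b₅ e f : ℤ

eval : Coeffs → Series
eval (coeffs b₀ b₁ b₂ b₃ b₄ b₅ e f) d =
  b₀ + b₁ * bin 1 d + b₂ * bin 2 d + b₃ * bin 3 d + b₄ * bin 4 d + b₅ * bin 5 d + e * pw d + f * dp d

-- With `c = -2` it sends 2ᵈ to 0 and d 2ᵈ to a multiple of 2ᵈ; with `c = -1` it lowers the order of
-- each binomial by one. Two steps of the first kind and six of the second therefore annihilate all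
-- coordinates.
advance : ℤ → Coeffs → Coeffs
advance c (coeffs b₀ b₁ b₂ b₃ b₄ b₅ e f) = coeffs
  ((+ 1 + c) * b₀ + b₁) ((+ 1 + c) * b₁ + b₂) ((+ 1 + c) * b₂ + b₃) ((+ 1 + c) * b₃ + b₄) ((+ 1 + c) * b₄ + b₅)
  ((+ 1 + c) * b₅) ((+ 2 + c) * e + + 2 * f) ((+ 2 + c) * f)

eval-advance : ∀ c A d → eval A (suc d) + c * eval A d ≡ eval (advance c A) d
eval-advance c (coeffs b₀ b₁ b₂ b₃ b₄ b₅ e f) d =
  arith c b₀ b₁ b₂ b₃ b₄ b₅ e f (bin 1 d) (bin 2 d) (bin 3 d) (bin 4 d) (bin 5 d) (pw d) (dp d)
  where
  arith : ∀ c b₀ b₁ b₂ b₃ b₄ b₅ e f x y z w v p q →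
    (b₀ + b₁ * (x + + 1) + b₂ * (y + x) + b₃ * (z + y) + b₄ * (w + z) + b₅ * (v + w) + e * (p + p) + f * ((q + p) + (q + p)))
      + c * (b₀ + b₁ * x + b₂ * y + b₃ * z + b₄ * w + b₅ * v + e * p + f * q) ≡
    ((+ 1 + c) * b₀ + b₁) + ((+ 1 + c) * b₁ + b₂) * x + ((+ 1 + c) * b₂ + b₃) * y + ((+ 1 + c) * b₃ + b₄) * z
      + ((+ 1 + c) * b₄ + b₅) * w + ((+ 1 + c) * b₅) * v + ((+ 2 + c) * e + + 2 * f) * p + ((+ 2 + c) * f) * q
  arith = solve-∀

advance^ : ℤ → ℕ → Coeffs → Coeffs
advance^ c zero    A = A
advance^ c (suc j) A = advance c (advance^ c j A)

Δ-tail : ∀ c k {a A} → (∀ n → a (k ℕ.+ n) ≡ eval A n) → ∀ n → Δ c a (suc k ℕ.+ n) ≡ eval (advance c A) n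
Δ-tail c k {a} {A} eq n = trans
  (cong₂ (λ u v → u + c * v) (trans (cong a (sym (ℕ.+-suc k n))) (eq (suc n))) (eq n))
  (eval-advance c A n)

Δ^-tail : ∀ c j k {a A} → (∀ n → a (k ℕ.+ n) ≡ eval A n) → ∀ n → Δ^ c j a (j ℕ.+ k ℕ.+ n) ≡ eval (advance^ c j A) n
Δ^-tail c zero    k eq = eq
Δ^-tail c (suc j) k {a} {A} eq = Δ-tail c (j ℕ.+ k) {Δ^ c j a} {advance^ c j A} (Δ^-tail c j k {a} {A} eq)

-- The coordinates of `decrX₀` plus those of `decrX₁`.
excessCoeffs : Coeffs
excessCoeffs = coeffs (+ 4) (+ 1) (+ 1) (+ 4) (+ 4) (+ 1) (- + 4) (+ 2)

excess-eval : ∀ n → excess (2 ℕ.+ n) ≡ eval excessCoeffs n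
excess-eval n = arith (bin 1 n) (bin 2 n) (bin 3 n) (bin 4 n) (bin 5 n) (pw n) (dp n)
  where
  arith : ∀ x y z w v p q →
    (+ 2 - y + z + + 3 * w + v - + 2 * p + q) + + 1 * (+ 2 + x + + 2 * y + + 3 * z + w - + 2 * p + q) ≡
    + 4 + + 1 * x + + 1 * y + + 4 * z + + 4 * w + + 1 * v + - + 4 * p + + 2 * q
  arith = solve-∀

excess-numer : ∀ n → Δ^ (- + 1) 6 (Δ^ (- + 2) 2 excess) n ≡ numer n
excess-numer 0 = refl
excess-numer 1 = refl
excess-numer 2 = refl
excess-numer 3 = refl
excess-numer 4 = refl
excess-numer 5 = refl
excess-numer 6 = refl
excess-numer 7 = refl
excess-numer 8 = refl
excess-numer 9 = refl
-- The closed form of `excess` starts at index 2, and each of the eight factors delays it by one.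
-- From index 10 on all coordinates reduce to 0; the ten earlier coefficients are evaluated.
excess-numer (suc (suc (suc (suc (suc (suc (suc (suc (suc (suc n)))))))))) =
  Δ^-tail (- + 1) 6 4 {Δ^ (- + 2) 2 excess} {advance^ (- + 2) 2 excessCoeffs}
    (Δ^-tail (- + 2) 2 2 {excess} {excessCoeffs} excess-eval) n

theorem3p1 : Σ (ℕ → ℕ) λ f →
    (∀ n → HasCard (InSnT T n) (f n)) ×
    (∀ n → (denom ⊛ ((λ m → + f m) ⊕ neg C-series)) n ≡ numer n)
theorem3p1 = (λ n → length (states n)) , card-states , λ n → begin
  (denom ⊛ F) n                                ≡⟨ denom-⊛ F n ⟩
  Δ^ (- + 1) 6 (Δ^ (- + 2) 2 F) n              ≡⟨ Δ^-cong (- + 1) 6 (Δ^-cong (- + 2) 2 F≡excess) n ⟩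
  Δ^ (- + 1) 6 (Δ^ (- + 2) 2 excess) n         ≡⟨ excess-numer n ⟩
  numer n                                      ∎
  where
  open ≡-Reasoning
  F : Series
  F = (λ m → + length (states m)) ⊕ neg C-series
  F≡excess : ∀ n → F n ≡ excess n
  F≡excess n = trans (cong (λ m → + m + - + catalan n) (length-states n)) (decr-catalan n)
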